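{- Let $S \subseteq \mathbb{Z}$ with $|S| = 4$. Then $p_{\mathbb{Z}}(S) \ge 3$; that is, there is a coloring of $\mathbb{Z}$ with $3$ colors such that every translate $n+S$, $n \in \mathbb{Z}$, contains an element of each of the three colors.
   Context: For an abelian group $G$, $S \subseteq G$ and $n \in G$, the set $n+S=\{n+s : s\in S\}$ is a translate of $S$. A coloring of the elements of $G$ is $S$-polychromatic if every translate of $S$ contains an element of each color. The polychromatic number $p_G(S)$ (written $p(S)$ when $G$ is clear) is the largest number of colors for which an $S$-polychromatic coloring of $G$ exists. -}

module Defs where

open import Algebra.Bundles using (AbelianGroup)
open import Data.Fin.Base using (Fin)
open import Data.Nat.Base using (ℕ; _≤_)
open import Data.Product.Base using (_×_; ∃-syntax)
open import Function.Bundles using (_⇔_)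
open import Function.Definitions using (Congruent; Injective)
open import Level using (Level; _⊔_)
open import Relation.Binary.PropositionalEquality.Core using (_≡_)
open import Relation.Unary using (Pred; _∈_)

module _ {c ℓ : Level} (G : AbelianGroup c ℓ) where
  open AbelianGroup G

  -- |S| = k.  The equivalence also forces S to respect _≈_.
  HasCardinality : ∀ {s} → Pred Carrier s → ℕ → Set (c ⊔ ℓ ⊔ s)
  HasCardinality S k =
    ∃[ f ] Injective {A = Fin k} _≡_ _≈_ f × (∀ x → x ∈ S ⇔ (∃[ i ] f i ≈ x))

  Translate : ∀ {s} → Carrier → Pred Carrier s → Pred Carrier (c ⊔ ℓ ⊔ s)
  Translate n S x = ∃[ y ] y ∈ S × x ≈ n ∙ y

  Polychromatic : ∀ {s k} → Pred Carrier s → (Carrier → Fin k) → Set (c ⊔ ℓ ⊔ s)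
  Polychromatic S χ = ∀ n colour → ∃[ x ] x ∈ Translate n S × χ x ≡ colour

  HasPolychromaticColouring : ∀ {s} → Pred Carrier s → ℕ → Set (c ⊔ ℓ ⊔ s)
  HasPolychromaticColouring S k =
    ∃[ χ ] Congruent {B = Fin k} _≈_ _≡_ χ × Polychromatic S χ

  -- p_G(S) = p.  A relation rather than a function, since computing the
  -- largest k for an arbitrary G and S is not constructively possible.
  IsPolychromaticNumber : ∀ {s} → Pred Carrier s → ℕ → Set (c ⊔ ℓ ⊔ s)
  IsPolychromaticNumber S p =
    HasPolychromaticColouring S p × (∀ k → HasPolychromaticColouring S k → k ≤ p)

{-# OPTIONS --safe #-}
module Submission where

-- After translating and dividing by the gcd, colour by residues mod 3 if all three occur. Otherwise let 0 and d be elements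
-- in different residue classes with d as large as possible, and let a, b be the other two elements. Colour n by ⌊kn/d⌋ mod 3
-- with 3 ∤ k: multiplication by k puts 0 and d a third of the circle ℤ/3d apart, and every translate meets all three arcs
-- once ka and kb lie on opposite sides of the remaining third point, at distance at most d from each other.
-- Shifted to that point, the pairs (k(a + d) , k(b + d)) form a plane lattice, covered by the lines Pp + Qq = 3dℓ of a
-- relation with P², Q² ≤ 3d (Thue). If d ≥ 51, the line with ℓ = 1 or ℓ = 2 has a long enough segment in the required
-- region, unless |P|, |Q| ≤ 3. Modulo 3 only three families of small relations survive, and they are coloured directly;
-- d ≤ 50 is settled by evaluation.

open import Defs
open import Data.Bool.Base using (Bool; true; false; _∧_; _∨_; not; T)
open import Data.Bool.Properties using (T-∧; T-∨)
open import Data.Empty using (⊥)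
open import Data.Fin.Base using (Fin; fromℕ<; toℕ; remQuot; combine)
import Data.Fin.Base as Fin
open import Data.Fin.Patterns using (0F; 1F; 2F; 3F)
open import Data.Fin.Properties using
  (toℕ<n; toℕ-fromℕ<; fromℕ<-cong; fromℕ<-toℕ; toℕ-injective; pigeonhole; combine-remQuot; all?; any?)
  renaming (_≟_ to _≟ᶠ_)
import Data.Fin.Properties as Fin
open import Data.Integer.Base using
  (ℤ; +_; -[1+_]; +[1+_]; 0ℤ; ∣_∣; -_; _+_; _*_; _-_; _≤_; _<_; +≤+; _%ℕ_; _/ℕ_; _⊖_)
open import Data.Integer.DivMod using (n%ℕd<d; a≡a%ℕn+[a/ℕn]*n; [n/ℕd]*d≤n; n<s[n/ℕd]*d)
open import Data.Integer.Divisibility.Signed using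
  (_∣_; divides; _∣?_; ∣⇒∣ᵤ; ∣ᵤ⇒∣; ∣m∣n⇒∣m+n; ∣m∣n⇒∣m-n; ∣n⇒∣m*n; ∣m⇒∣-m; ∣m+n∣m⇒∣n)
import Data.Integer.Properties as ℤ
open import Data.Integer.Properties using (+-0-abelianGroup)
open import Algebra.Properties.AbelianGroup +-0-abelianGroup using () renaming (∙-cancelʳ to +-cancelʳ)
open import Data.Integer.Tactic.RingSolver using (solve-∀)
open import Data.List.Base using (List; []; _∷_)
import Data.Nat.Base as ℕ
open import Data.Nat.Base using (ℕ; zero; suc; NonZero; _≥_)
import Data.Nat.Divisibility as ℕ
import Data.Nat.DivMod as ℕ
open import Data.Nat.GCD using (module Bézout; module GCD)
import Data.Nat.Properties as ℕ
open import Data.Nat.Tactic.RingSolver using () renaming (solve-∀ to solveℕ-∀)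
open import Data.Product.Base using (_×_; _,_; Σ-syntax; ∃-syntax; proj₁; proj₂; swap)
open import Data.Sum.Base using (_⊎_; inj₁; inj₂)
open import Data.Unit.Base using (tt)
open import Data.Vec.Base using (Vec; []; _∷_)
open import Function.Bundles using (Equivalence)
open import Relation.Binary.Definitions using (Tri; tri<; tri≈; tri>)
open import Relation.Binary.PropositionalEquality
open import Relation.Nullary using (¬_; Dec; yes; no; contradiction)
open import Relation.Nullary.Decidable using (toWitness; ⌊_⌋; from-yes; _×-dec_; _⊎-dec_; ¬?)
open import Relation.Unary using (Pred)

nonneg : ∀ {x y} → x ≤ y → 0ℤ ≤ y - x
nonneg = ℤ.i≤j⇒0≤j-i

infixl 6 _⊕_
infixl 7 _⊗_

_⊕_ : ∀ {x y} → 0ℤ ≤ x → 0ℤ ≤ y → 0ℤ ≤ x + y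
_⊕_ = ℤ.+-mono-≤

_⊗_ : ∀ {x y} → 0ℤ ≤ x → 0ℤ ≤ y → 0ℤ ≤ x * y
_⊗_ {+ m} {+ n} _ _ = subst (0ℤ ≤_) (ℤ.pos-* m n) (+≤+ ℕ.z≤n)

pos : ∀ n → 0ℤ ≤ + n
pos _ = +≤+ ℕ.z≤n

≤-by : ∀ {e x y} → 0ℤ ≤ e → y ≡ x + e → x ≤ y
≤-by {e} {x} 0≤e refl = subst (_≤ x + e) (ℤ.+-identityʳ x) (ℤ.+-monoʳ-≤ x 0≤e)

≡-by : ∀ {x y} → x - y ≡ 0ℤ → x ≡ y
≡-by = ℤ.i-j≡0⇒i≡j _ _

private
  abs-bound : ∀ {r r′ d : ℕ} (m : ℤ) → r ℕ.< d → r′ ℕ.< d → m * + d ≡ r ⊖ r′ → m ≡ 0ℤ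
  abs-bound {r} {r′} {d} m r<d r′<d eq = ℤ.∣i∣≡0⇒i≡0 (ℕ.n<1⇒n≡0 (ℕ.*-cancelʳ-< d ∣ m ∣ 1 (begin-strict
    ∣ m ∣ ℕ.* d    ≡⟨ ℤ.abs-* m (+ d) ⟨
    ∣ m * + d ∣    ≡⟨ cong ∣_∣ eq ⟩
    ∣ r ⊖ r′ ∣     ≤⟨ ℤ.∣m⊝n∣≤m⊔n r r′ ⟩
    r ℕ.⊔ r′       <⟨ ℕ.⊔-lub r<d r′<d ⟩
    d              ≡⟨ ℕ.*-identityˡ d ⟨
    1 ℕ.* d        ∎)))
    where open ℕ.≤-Reasoning

  quotient-difference : ∀ r r′ m m′ d → r + m * d ≡ r′ + m′ * d → (m′ - m) * d ≡ r - r′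
  quotient-difference r r′ m m′ d eq = ≡-by (begin
    (m′ - m) * d - (r - r′)          ≡⟨ ring r r′ m m′ d ⟩
    (r′ + m′ * d) - (r + m * d)      ≡⟨ cong (_- (r + m * d)) (sym eq) ⟩
    (r + m * d) - (r + m * d)        ≡⟨ ℤ.+-inverseʳ (r + m * d) ⟩
    0ℤ                               ∎)
    where
    open ≡-Reasoning
    ring : ∀ r r′ m m′ d → (m′ - m) * d - (r - r′) ≡ (r′ + m′ * d) - (r + m * d)
    ring = solve-∀

/ℕ-unique : ∀ d .{{_ : NonZero d}} v m {r : ℕ} → r ℕ.< d → v ≡ + r + m * + d → v /ℕ d ≡ m
/ℕ-unique d v m {r} r<d eq = sym (≡-by (abs-bound (m - v /ℕ d) (n%ℕd<d v d) r<d
  (trans (quotient-difference (+ (v %ℕ d)) (+ r) (v /ℕ d) m (+ d)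
           (trans (sym (a≡a%ℕn+[a/ℕn]*n v d)) eq))
         (ℤ.m-n≡m⊖n (v %ℕ d) r))))

%ℕ-unique : ∀ d .{{_ : NonZero d}} v m {r : ℕ} → r ℕ.< d → v ≡ + r + m * + d → v %ℕ d ≡ r
%ℕ-unique d v m {r} r<d eq = ℤ.+-injective (+-cancelʳ (m * + d) _ _ (begin
  + (v %ℕ d) + m * + d          ≡⟨ cong (λ q → + (v %ℕ d) + q * + d) (/ℕ-unique d v m r<d eq) ⟨
  + (v %ℕ d) + (v /ℕ d) * + d   ≡⟨ a≡a%ℕn+[a/ℕn]*n v d ⟨
  v                             ≡⟨ eq ⟩
  + r + m * + d                 ∎))
  where open ≡-Reasoning

Quad : Set
Quad = Fin 4 → ℤ

quad : ℤ → ℤ → ℤ → ℤ → Quad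
quad w x y z 0F = w
quad w x y z 1F = x
quad w x y z 2F = y
quad w x y z 3F = z

Tricolourable : Quad → Set
Tricolourable s = Σ[ χ ∈ (ℤ → Fin 3) ] (∀ n c → ∃[ i ] χ (n + s i) ≡ c)

tricolourable-pull : ∀ {s s′ : Quad} (k t : ℤ) (σ : Fin 4 → Fin 4) → (∀ i → s′ i ≡ k * s (σ i) + t) →
  Tricolourable s′ → Tricolourable s
tricolourable-pull {s} {s′} k t σ eq (χ , rainbow) = (λ n → χ (k * n)) , λ n c →
  let i , χ≡c = rainbow (k * n - t) c in
  σ i , trans (cong χ (trans (shift k n t (s (σ i))) (cong (λ u → k * n - t + u) (sym (eq i))))) χ≡c
  where
  shift : ∀ k n t v → k * (n + v) ≡ k * n - t + (k * v + t)
  shift = solve-∀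

tricolourable-scale : ∀ {s : Quad} g .{{_ : NonZero g}} → Tricolourable s → Tricolourable (λ i → s i * + g)
tricolourable-scale {s} g (χ , rainbow) = (λ n → χ (n /ℕ g)) , λ n c →
  let i , χ≡c = rainbow (n /ℕ g) c in
  i , trans (cong χ (/ℕ-unique g (n + s i * + g) (n /ℕ g + s i) (n%ℕd<d n g) (split n (s i)))) χ≡c
  where
  split : ∀ n v → n + v * + g ≡ + (n %ℕ g) + (n /ℕ g + v) * + g
  split n v = begin
    n + v * + g                                  ≡⟨ cong (_+ v * + g) (a≡a%ℕn+[a/ℕn]*n n g) ⟩
    + (n %ℕ g) + (n /ℕ g) * + g + v * + g        ≡⟨ lemma (+ (n %ℕ g)) (n /ℕ g) v (+ g) ⟩
    + (n %ℕ g) + (n /ℕ g + v) * + g              ∎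
    where
    open ≡-Reasoning
    lemma : ∀ r q v g → r + q * g + v * g ≡ r + (q + v) * g
    lemma = solve-∀

residue₃ : ℤ → Fin 3
residue₃ v = fromℕ< (n%ℕd<d v 3)

residue₃-unique : ∀ {v} (c : Fin 3) (m : ℤ) → v ≡ + toℕ c + m * + 3 → residue₃ v ≡ c
residue₃-unique {v} c m eq = trans (fromℕ<-cong _ _ (%ℕ-unique 3 v m (toℕ<n c) eq) (n%ℕd<d v 3) (toℕ<n c))
  (fromℕ<-toℕ c (toℕ<n c))

residue₃-spec : ∀ v → v ≡ + toℕ (residue₃ v) + (v /ℕ 3) * + 3
residue₃-spec v = subst (λ r → v ≡ + r + (v /ℕ 3) * + 3) (sym (toℕ-fromℕ< (n%ℕd<d v 3))) (a≡a%ℕn+[a/ℕn]*n v 3)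

toNat : ∀ {x} → 0ℤ ≤ x → ∃[ n ] x ≡ + n
toNat {+ n} _ = n , refl

-- Colour n by ⌊kn/d⌋ mod 3: each colour class is an arc of length d on the circle ℤ/3d.
gaps⇒tricolourable : ∀ d .{{_ : NonZero d}} {D} → D ≡ + d → {s : Quad} (k : ℤ) (x t : Quad) →
  (∀ i → k * s i ≡ x i + t i * (+ 3 * D)) →
  x 1F ≤ x 0F + D → x 2F ≤ x 1F + D → x 3F ≤ x 2F + D → x 0F + + 2 * D ≤ x 3F →
  Tricolourable s
gaps⇒tricolourable d refl {s} k x t lift gap₁ gap₂ gap₃ gap₀ = χ , rainbow
  where
  χ : ℤ → Fin 3
  χ n = residue₃ ((k * n) /ℕ d)

  module _ (n : ℤ) (c : Fin 3) where
    y : Quad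
    y i = k * n + x i

    q₀ q m : ℤ
    q₀ = y 0F /ℕ d
    q  = (+ toℕ c - q₀) /ℕ 3
    m  = + toℕ c + (- q) * + 3

    ρ : ℕ
    ρ = (+ toℕ c - q₀) %ℕ 3

    m≡q₀+ρ : m ≡ q₀ + + ρ
    m≡q₀+ρ = ≡-by (trans (rearrange (+ toℕ c) q q₀ (+ ρ))
      (ℤ.i≡j⇒i-j≡0 (a≡a%ℕn+[a/ℕn]*n (+ toℕ c - q₀) 3)))
      where
      rearrange : ∀ c q q₀ ρ → c + (- q) * + 3 - (q₀ + ρ) ≡ (c - q₀) - (ρ + q * + 3)
      rearrange = solve-∀

    ρ≤2 : 0ℤ ≤ + 2 - + ρ
    ρ≤2 = nonneg (+≤+ (ℕ.s≤s⁻¹ (n%ℕd<d (+ toℕ c - q₀) 3)))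

    y₀<md+d : y 0F < m * + d + + d
    y₀<md+d = ℤ.<-≤-trans (n<s[n/ℕd]*d (y 0F) d)
      (≤-by (pos ρ ⊗ pos d) (trans (cong (λ m → m * + d + + d) m≡q₀+ρ) (expand q₀ (+ ρ) (+ d))))
      where
      expand : ∀ q r d → (q + r) * d + d ≡ (+ 1 + q) * d + r * d
      expand = solve-∀

    md≤y₀+2d : m * + d ≤ y 0F + + 2 * + d
    md≤y₀+2d = ≤-by (nonneg ([n/ℕd]*d≤n (y 0F) d) ⊕ ρ≤2 ⊗ pos d)
      (trans (expand (y 0F) q₀ (+ ρ) (+ d)) (cong (λ m → m * + d + (y 0F - q₀ * + d + (+ 2 - + ρ) * + d)) (sym m≡q₀+ρ)))
      where
      expand : ∀ y q r d → y + + 2 * d ≡ (q + r) * d + (y - q * d + (+ 2 - r) * d)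
      expand = solve-∀

    hit : ∀ i → m * + d ≤ y i → y i < m * + d + + d → ∃[ i ] χ (n + s i) ≡ c
    hit i md≤y y<md+d with r , y-md≡r ← toNat (nonneg md≤y) =
      i , residue₃-unique c (t i - q) (trans (/ℕ-unique d (k * (n + s i)) (m + t i * + 3) r<d decompose) (regroup (+ toℕ c) q (t i)))
      where
      regroup : ∀ c q t → c + (- q) * + 3 + t * + 3 ≡ c + (t - q) * + 3
      regroup = solve-∀
      r<d : r ℕ.< d
      r<d = ℤ.drop‿+<+ (subst₂ _<_ y-md≡r (cancel (m * + d) (+ d)) (ℤ.+-monoˡ-< (- (m * + d)) y<md+d))
        where
        cancel : ∀ z d → z + d - z ≡ d
        cancel = solve-∀
      decompose : k * (n + s i) ≡ + r + (m + t i * + 3) * + d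
      decompose = begin
        k * (n + s i)                                ≡⟨ ℤ.*-distribˡ-+ k n (s i) ⟩
        k * n + k * s i                              ≡⟨ cong (λ u → k * n + u) (lift i) ⟩
        k * n + (x i + t i * (+ 3 * + d))            ≡⟨ expand (k * n) (x i) (t i) (+ d) m ⟩
        (y i - m * + d) + (m + t i * + 3) * + d      ≡⟨ cong (_+ (m + t i * + 3) * + d) y-md≡r ⟩
        + r + (m + t i * + 3) * + d                  ∎
        where
        open ≡-Reasoning
        expand : ∀ kn x t d m → kn + (x + t * (+ 3 * d)) ≡ (kn + x - m * d) + (m + t * + 3) * d
        expand = solve-∀

    next : ∀ {i j} → x j ≤ x i + + d → y i < m * + d → y j < m * + d + + d
    next {i} {j} gap y<md = ℤ.≤-<-trans
      (subst (y j ≤_) (sym (ℤ.+-assoc (k * n) (x i) (+ d))) (ℤ.+-monoʳ-≤ (k * n) gap))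
      (ℤ.+-monoˡ-< (+ d) y<md)

    y₀+2d≤y₃ : y 0F + + 2 * + d ≤ y 3F
    y₀+2d≤y₃ = subst (_≤ y 3F) (sym (ℤ.+-assoc (k * n) (x 0F) (+ 2 * + d))) (ℤ.+-monoʳ-≤ (k * n) gap₀)

    rainbow : ∃[ i ] χ (n + s i) ≡ c
    rainbow with m * + d ℤ.≤? y 0F
    ... | yes hit₀ = hit 0F hit₀ y₀<md+d
    ... | no miss₀ with m * + d ℤ.≤? y 1F
    ... | yes hit₁ = hit 1F hit₁ (next gap₁ (ℤ.≰⇒> miss₀))
    ... | no miss₁ with m * + d ℤ.≤? y 2F
    ... | yes hit₂ = hit 2F hit₂ (next gap₂ (ℤ.≰⇒> miss₁))
    ... | no miss₂ with m * + d ℤ.≤? y 3F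
    ... | yes hit₃ = hit 3F hit₃ (next gap₃ (ℤ.≰⇒> miss₂))
    ... | no miss₃ = contradiction (ℤ.≤-trans md≤y₀+2d y₀+2d≤y₃) miss₃

tricolourable-reindex : ∀ {s s′ : Quad} (σ : Fin 4 → Fin 4) → (∀ i → s′ i ≡ s (σ i)) → Tricolourable s′ → Tricolourable s
tricolourable-reindex {s} σ eq = tricolourable-pull (+ 1) 0ℤ σ λ i → trans (eq i) (sym (unit (s (σ i))))
  where
  unit : ∀ v → + 1 * v + 0ℤ ≡ v
  unit = solve-∀

-- p and q are the positions of ka and kb relative to the point 2kd ≡ - kd of the circle ℤ/3d.
record Sandwich (d : ℕ) (a b : ℤ) : Set where
  field
    k p q u v : ℤ
    3∤k : ¬ (+ 3 ∣ k)
    lift-a : k * (a + + d) ≡ p + u * (+ 3 * + d)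
    lift-b : k * (b + + d) ≡ q + v * (+ 3 * + d)
    p≤0 : p ≤ 0ℤ
    0≤q : 0ℤ ≤ q
    q≤p+d : q ≤ p + + d

module _ (d : ℕ) .{{_ : NonZero d}} {a b : ℤ} (S : Sandwich d a b) where
  open Sandwich S

  private
    j : ℤ
    j = k /ℕ 3

    lift-0 : ∀ k D → k * 0ℤ ≡ 0ℤ + 0ℤ * D
    lift-0 = solve-∀

    lift-d : ∀ r → k ≡ r + j * + 3 → k * + d ≡ r * + d + j * (+ 3 * + d)
    lift-d r eq = trans (cong (_* + d) eq) (expand r j (+ d))
      where
      expand : ∀ r j d → (r + j * + 3) * d ≡ r * d + j * (+ 3 * d)
      expand = solve-∀

    lift-other : ∀ r a p u → k ≡ r + j * + 3 → k * (a + + d) ≡ p + u * (+ 3 * + d) →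
      k * a ≡ (+ 3 - r) * + d + p + (u - j - + 1) * (+ 3 * + d)
    lift-other r a p u eq lift = begin
      k * a                                        ≡⟨ expand k a (+ d) ⟩
      k * (a + + d) - k * + d                      ≡⟨ cong₂ _-_ lift (lift-d r eq) ⟩
      p + u * (+ 3 * + d) - (r * + d + j * (+ 3 * + d)) ≡⟨ collect p u r j (+ d) ⟩
      (+ 3 - r) * + d + p + (u - j - + 1) * (+ 3 * + d) ∎
      where
      open ≡-Reasoning
      expand : ∀ k a d → k * a ≡ k * (a + d) - k * d
      expand = solve-∀
      collect : ∀ p u r j d → p + u * (+ 3 * d) - (r * d + j * (+ 3 * d)) ≡ (+ 3 - r) * d + p + (u - j - + 1) * (+ 3 * d)
      collect = solve-∀

    ring₁ : ∀ d → 0ℤ + d ≡ + 1 * d + 0ℤ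
    ring₁ = solve-∀
    ring₂ : ∀ d p → + 1 * d + d ≡ + 2 * d + p + (0ℤ - p)
    ring₂ = solve-∀
    ring₃ : ∀ c d p q → c * d + p + d ≡ c * d + q + (p + d - q)
    ring₃ = solve-∀
    ring₄ : ∀ d q → + 2 * d + q ≡ 0ℤ + + 2 * d + q
    ring₄ = solve-∀
    ring₅ : ∀ d p → 0ℤ + d ≡ + 1 * d + p + (0ℤ - p)
    ring₅ = solve-∀
    ring₆ : ∀ d q → + 1 * d + q + d ≡ + 2 * d + q
    ring₆ = solve-∀

    case₁ : k ≡ + 1 + j * + 3 → Tricolourable (quad 0ℤ (+ d) a b)
    case₁ eq = gaps⇒tricolourable d refl k
      (quad 0ℤ (+ 1 * + d) (+ 2 * + d + p) (+ 2 * + d + q)) (quad 0ℤ j (u - j - + 1) (v - j - + 1))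
      (λ where
        0F → lift-0 k (+ 3 * + d)
        1F → lift-d (+ 1) eq
        2F → lift-other (+ 1) a p u eq lift-a
        3F → lift-other (+ 1) b q v eq lift-b)
      (≤-by ℤ.≤-refl (ring₁ (+ d)))
      (≤-by (nonneg p≤0) (ring₂ (+ d) p))
      (≤-by (nonneg q≤p+d) (ring₃ (+ 2) (+ d) p q))
      (≤-by 0≤q (ring₄ (+ d) q))

    case₂ : k ≡ + 2 + j * + 3 → Tricolourable (quad 0ℤ (+ d) a b)
    case₂ eq = tricolourable-reindex {quad 0ℤ (+ d) a b} {quad 0ℤ a b (+ d)} (λ where 0F → 0F; 1F → 2F; 2F → 3F; 3F → 1F)
      (λ where 0F → refl; 1F → refl; 2F → refl; 3F → refl)
      (gaps⇒tricolourable d refl k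
        (quad 0ℤ (+ 1 * + d + p) (+ 1 * + d + q) (+ 2 * + d)) (quad 0ℤ (u - j - + 1) (v - j - + 1) j)
        (λ where
          0F → lift-0 k (+ 3 * + d)
          1F → lift-other (+ 2) a p u eq lift-a
          2F → lift-other (+ 2) b q v eq lift-b
          3F → lift-d (+ 2) eq)
        (≤-by (nonneg p≤0) (ring₅ (+ d) p))
        (≤-by (nonneg q≤p+d) (ring₃ (+ 1) (+ d) p q))
        (≤-by 0≤q (ring₆ (+ d) q))
        (≤-by ℤ.≤-refl (ring₁′ (+ d))))
      where
      ring₁′ : ∀ d → + 2 * d ≡ 0ℤ + + 2 * d + 0ℤ
      ring₁′ = solve-∀

  sandwich⇒tricolourable : Tricolourable (quad 0ℤ (+ d) a b)
  sandwich⇒tricolourable with k %ℕ 3 | a≡a%ℕn+[a/ℕn]*n k 3 | n%ℕd<d k 3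
  ... | 0 | eq | _ = contradiction (divides j (trans eq (ℤ.+-identityˡ (j * + 3)))) 3∤k
  ... | 1 | eq | _ = case₁ eq
  ... | 2 | eq | _ = case₂ eq
  ... | suc (suc (suc _)) | _ | ℕ.s≤s (ℕ.s≤s (ℕ.s≤s ()))

vanish : ∀ c {l r} → l ≡ r → c * (l - r) ≡ 0ℤ
vanish c l≡r = trans (cong (c *_) (ℤ.i≡j⇒i-j≡0 l≡r)) (ℤ.*-zeroʳ c)

≡-via : ∀ {x y l r} c → l ≡ r → x - y ≡ c * (l - r) → x ≡ y
≡-via c l≡r eq = ≡-by (trans eq (vanish c l≡r))

≡-via₂ : ∀ {x y l r l′ r′} c c′ → l ≡ r → l′ ≡ r′ → x - y ≡ c * (l - r) + c′ * (l′ - r′) → x ≡ y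
≡-via₂ c c′ l≡r l′≡r′ eq = ≡-by (trans eq (cong₂ _+_ (vanish c l≡r) (vanish c′ l′≡r′)))

+≤ : ∀ {m n} → m ℕ.≤ n → 0ℤ ≤ + n - + m
+≤ m≤n = nonneg (+≤+ m≤n)

module _ (d : ℕ) .{{_ : NonZero d}} (b u w : ℤ) (22≤d : 22 ℕ.≤ d) (bezout : u * b + w * + d ≡ + 1) where

  private
    r : ℕ
    r = (+ 2 * + d + + 7 * b) %ℕ 12

    t k : ℤ
    t = (+ 2 * + d + + 7 * b) /ℕ 12
    k = + 7 + + 12 * (- u * t)

    points lifts : Quad
    points = quad 0ℤ (+ 2 * (+ 2 * + d - + r)) (+ 7 * + d) (+ 9 * + d - + r)
    lifts  = quad 0ℤ (+ 2 * (- t * w)) (- u * t) (- u * t - t * w)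

    division : + 2 * + d + + 7 * b ≡ + r + t * + 12
    division = a≡a%ℕn+[a/ℕn]*n (+ 2 * + d + + 7 * b) 12

    r≤11 : 0ℤ ≤ + 11 - + r
    r≤11 = +≤ (ℕ.s≤s⁻¹ (n%ℕd<d (+ 2 * + d + + 7 * b) 12))

    instance
      width≢0 : NonZero (4 ℕ.* d)
      width≢0 = ℕ.m*n≢0 4 d

    lift : ∀ i → k * quad 0ℤ (+ 2 * - b) (+ d) (+ d - b) i ≡ points i + lifts i * (+ 3 * (+ 4 * + d))
    lift = λ where
        0F → ring₀ k (+ d)
        1F → ≡-via₂ (+ 24 * t) (- + 2) bezout division (ring₁ u b t w (+ d) (+ r))
        2F → ring₂ (+ d) u t
        3F → ≡-via₂ (+ 12 * t) (- + 1) bezout division (ring₃ u b t w (+ d) (+ r))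
      where
      ring₀ : ∀ k d → k * 0ℤ ≡ 0ℤ + 0ℤ * (+ 3 * (+ 4 * d))
      ring₀ = solve-∀
      ring₁ : ∀ u b t w d r →
        (+ 7 + + 12 * (- u * t)) * (+ 2 * - b) - (+ 2 * (+ 2 * d - r) + + 2 * (- t * w) * (+ 3 * (+ 4 * d)))
        ≡ + 24 * t * (u * b + w * d - + 1) + - + 2 * (+ 2 * d + + 7 * b - (r + t * + 12))
      ring₁ = solve-∀
      ring₂ : ∀ d u t → (+ 7 + + 12 * (- u * t)) * d ≡ + 7 * d + - u * t * (+ 3 * (+ 4 * d))
      ring₂ = solve-∀
      ring₃ : ∀ u b t w d r →
        (+ 7 + + 12 * (- u * t)) * (d - b) - (+ 9 * d - r + (- u * t - t * w) * (+ 3 * (+ 4 * d)))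
        ≡ + 12 * t * (u * b + w * d - + 1) + - + 1 * (+ 2 * d + + 7 * b - (r + t * + 12))
      ring₃ = solve-∀

  -- The multiplier places the set, reflected by x ↦ d - x, near 0, 1/3, 7/12, 3/4 on the circle.
  a≡2b+d⇒tricolourable : Tricolourable (quad 0ℤ (+ d) (+ 2 * b + + d) b)
  a≡2b+d⇒tricolourable = tricolourable-pull {quad 0ℤ (+ d) (+ 2 * b + + d) b} {quad 0ℤ (+ 2 * - b) (+ d) (+ d - b)}
    (- + 1) (+ d) (λ where 0F → 1F; 1F → 2F; 2F → 0F; 3F → 3F)
    (λ where
      0F → affine₀ (+ d)
      1F → affine₁ b (+ d)
      2F → affine₂ (+ d)
      3F → affine₃ b (+ d))
    (gaps⇒tricolourable (4 ℕ.* d) (sym (ℤ.pos-* 4 d)) k points lifts lift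
      (≤-by (pos r ⊕ pos r) (gap₁ (+ d) (+ r)))
      (≤-by (+≤ 22≤d ⊕ r≤11 ⊕ r≤11) (gap₂ (+ d) (+ r)))
      (≤-by (pos d ⊕ pos d ⊕ pos r) (gap₃ (+ d) (+ r)))
      (≤-by (+≤ 22≤d ⊕ r≤11 ⊕ pos 11) (gap₀ (+ d) (+ r))))
    where
    affine₀ : ∀ d → 0ℤ ≡ - + 1 * d + d
    affine₀ = solve-∀
    affine₁ : ∀ b d → + 2 * - b ≡ - + 1 * (+ 2 * b + d) + d
    affine₁ = solve-∀
    affine₂ : ∀ d → d ≡ - + 1 * 0ℤ + d
    affine₂ = solve-∀
    affine₃ : ∀ b d → d - b ≡ - + 1 * b + d
    affine₃ = solve-∀
    gap₁ : ∀ d r → 0ℤ + + 4 * d ≡ + 2 * (+ 2 * d - r) + (r + r)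
    gap₁ = solve-∀
    gap₂ : ∀ d r → + 2 * (+ 2 * d - r) + + 4 * d ≡ + 7 * d + (d - + 22 + (+ 11 - r) + (+ 11 - r))
    gap₂ = solve-∀
    gap₃ : ∀ d r → + 7 * d + + 4 * d ≡ + 9 * d - r + (d + d + r)
    gap₃ = solve-∀
    gap₀ : ∀ d r → + 9 * d - r ≡ 0ℤ + + 2 * (+ 4 * d) + (d - + 22 + (+ 11 - r) + + 11)
    gap₀ = solve-∀

module _ (e : ℕ) .{{_ : NonZero e}} (b u w : ℤ) (14≤e : 14 ℕ.≤ e) (bezout : u * b + w * + e ≡ + 1) where

  private
    r : ℕ
    r = (+ 11 * + e - + 3 * b) %ℕ 15

    t k : ℤ
    t = (+ 11 * + e - + 3 * b) /ℕ 15
    k = + 3 + + 15 * (u * t)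

    points lifts : Quad
    points = quad 0ℤ (+ 5 * + e - + r) (+ 6 * + e) (+ 11 * + e - + r)
    lifts  = quad 0ℤ (- t * w + + 3 * u * t + + 1) (+ 2 * u * t) (- t * w)

    division : + 11 * + e - + 3 * b ≡ + r + t * + 15
    division = a≡a%ℕn+[a/ℕn]*n (+ 11 * + e - + 3 * b) 15

    r≤14 : 0ℤ ≤ + 14 - + r
    r≤14 = +≤ (ℕ.s≤s⁻¹ (n%ℕd<d (+ 11 * + e - + 3 * b) 15))

    instance
      width≢0 : NonZero (5 ℕ.* e)
      width≢0 = ℕ.m*n≢0 5 e

    lift : ∀ i → k * quad 0ℤ (b + + 3 * + e) (+ 2 * + e) b i ≡ points i + lifts i * (+ 3 * (+ 5 * + e))
    lift = λ where
        0F → ring₀ k (+ e)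
        1F → ≡-via₂ (+ 15 * t) (- + 1) bezout division (ring₁ u b t w (+ e) (+ r))
        2F → ring₂ (+ e) u t
        3F → ≡-via₂ (+ 15 * t) (- + 1) bezout division (ring₃ u b t w (+ e) (+ r))
      where
      ring₀ : ∀ k e → k * 0ℤ ≡ 0ℤ + 0ℤ * (+ 3 * (+ 5 * e))
      ring₀ = solve-∀
      ring₁ : ∀ u b t w e r →
        (+ 3 + + 15 * (u * t)) * (b + + 3 * e) - (+ 5 * e - r + (- t * w + + 3 * u * t + + 1) * (+ 3 * (+ 5 * e)))
        ≡ + 15 * t * (u * b + w * e - + 1) + - + 1 * (+ 11 * e - + 3 * b - (r + t * + 15))
      ring₁ = solve-∀
      ring₂ : ∀ e u t → (+ 3 + + 15 * (u * t)) * (+ 2 * e) ≡ + 6 * e + + 2 * u * t * (+ 3 * (+ 5 * e))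
      ring₂ = solve-∀
      ring₃ : ∀ u b t w e r →
        (+ 3 + + 15 * (u * t)) * b - (+ 11 * e - r + - t * w * (+ 3 * (+ 5 * e)))
        ≡ + 15 * t * (u * b + w * e - + 1) + - + 1 * (+ 11 * e - + 3 * b - (r + t * + 15))
      ring₃ = solve-∀

  -- The multiplier places the set near 0, 1/3, 2/5, 11/15 on the circle.
  a≡b+3e⇒tricolourable : Tricolourable (quad 0ℤ (+ 2 * + e) (b + + 3 * + e) b)
  a≡b+3e⇒tricolourable = tricolourable-reindex {quad 0ℤ (+ 2 * + e) (b + + 3 * + e) b} {quad 0ℤ (b + + 3 * + e) (+ 2 * + e) b}
    (λ where 0F → 0F; 1F → 2F; 2F → 1F; 3F → 3F)
    (λ where 0F → refl; 1F → refl; 2F → refl; 3F → refl)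
    (gaps⇒tricolourable (5 ℕ.* e) (sym (ℤ.pos-* 5 e)) k points lifts lift
      (≤-by (pos r) (gap₁ (+ e) (+ r)))
      (≤-by (pos e ⊕ pos e ⊕ pos e ⊕ +≤ 14≤e ⊕ r≤14) (gap₂ (+ e) (+ r)))
      (≤-by (pos r) (gap₃ (+ e) (+ r)))
      (≤-by (+≤ 14≤e ⊕ r≤14) (gap₀ (+ e) (+ r))))
    where
    gap₁ : ∀ e r → 0ℤ + + 5 * e ≡ + 5 * e - r + r
    gap₁ = solve-∀
    gap₂ : ∀ e r → + 5 * e - r + + 5 * e ≡ + 6 * e + (e + e + e + (e - + 14) + (+ 14 - r))
    gap₂ = solve-∀
    gap₃ : ∀ e r → + 6 * e + + 5 * e ≡ + 11 * e - r + r
    gap₃ = solve-∀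
    gap₀ : ∀ e r → + 11 * e - r ≡ 0ℤ + + 2 * (+ 5 * e) + (e - + 14 + (+ 14 - r))
    gap₀ = solve-∀

1≢3* : ∀ h → ¬ (+ 1 ≡ h * + 3)
1≢3* h eq with ∣⇒∣ᵤ (divides h eq)
... | 3∣1 with ℕ.∣1⇒≡1 3∣1
... | ()

square≡1[3] : ∀ {a} → ¬ (+ 3 ∣ a) → ∃[ m ] a * a ≡ + 1 + m * + 3
square≡1[3] {a} 3∤a with a %ℕ 3 | a≡a%ℕn+[a/ℕn]*n a 3 | n%ℕd<d a 3
... | 0 | eq | _ = contradiction (divides (a /ℕ 3) (trans eq (ℤ.+-identityˡ (a /ℕ 3 * + 3)))) 3∤a
... | 1 | eq | _ = (+ 2 + + 3 * q) * q , trans (cong (λ a → a * a) eq) (ring q)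
  where
  q = a /ℕ 3
  ring : ∀ q → (+ 1 + q * + 3) * (+ 1 + q * + 3) ≡ + 1 + (+ 2 + + 3 * q) * q * + 3
  ring = solve-∀
... | 2 | eq | _ = + 1 + (+ 4 + + 3 * q) * q , trans (cong (λ a → a * a) eq) (ring q)
  where
  q = a /ℕ 3
  ring : ∀ q → (+ 2 + q * + 3) * (+ 2 + q * + 3) ≡ + 1 + (+ 1 + (+ 4 + + 3 * q) * q) * + 3
  ring = solve-∀
... | suc (suc (suc _)) | _ | ℕ.s≤s (ℕ.s≤s (ℕ.s≤s ()))

3∣*⇒3∣ : ∀ {a} p → ¬ (+ 3 ∣ a) → + 3 ∣ p * a → + 3 ∣ p
3∣*⇒3∣ {a} p 3∤a (divides q eq) with m , a² ← square≡1[3] 3∤a =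
  divides (q * a - p * m) (≡-via₂ a (- p) eq a² (ring p a q m))
  where
  ring : ∀ p a q m → p - (q * a - p * m) * + 3 ≡ a * (p * a - q * + 3) + - p * (a * a - (+ 1 + m * + 3))
  ring = solve-∀

module _ where
  open ℕ.≤-Reasoning

  private
    slack : ∀ {m q d} s t → 51 ℕ.≤ d → m ℕ.≤ s ℕ.* 51 ℕ.+ q → m ℕ.+ 3 ℕ.* (t ℕ.* d) ℕ.≤ (3 ℕ.* t ℕ.+ s) ℕ.* d ℕ.+ q
    slack {m} {q} {d} s t 51≤d m≤ = begin
      m ℕ.+ 3 ℕ.* (t ℕ.* d)              ≤⟨ ℕ.+-monoˡ-≤ (3 ℕ.* (t ℕ.* d)) (ℕ.≤-trans m≤ (ℕ.+-monoˡ-≤ q (ℕ.*-monoʳ-≤ s 51≤d))) ⟩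
      s ℕ.* d ℕ.+ q ℕ.+ 3 ℕ.* (t ℕ.* d)      ≡⟨ ring s d q t ⟩
      (3 ℕ.* t ℕ.+ s) ℕ.* d ℕ.+ q          ∎
      where
      ring : ∀ s d q t → s ℕ.* d ℕ.+ q ℕ.+ 3 ℕ.* (t ℕ.* d) ≡ (3 ℕ.* t ℕ.+ s) ℕ.* d ℕ.+ q
      ring = solveℕ-∀

    slack₁ : ∀ {m q d} s → 51 ℕ.≤ d → m ℕ.≤ s ℕ.* 51 ℕ.+ 2 ℕ.* q → m ℕ.+ 3 ℕ.* d ℕ.≤ (3 ℕ.+ s) ℕ.* d ℕ.+ 2 ℕ.* q
    slack₁ {m} {q} {d} s 51≤d m≤ = begin
      m ℕ.+ 3 ℕ.* d                    ≡⟨ cong (λ e → m ℕ.+ 3 ℕ.* e) (sym (ℕ.*-identityˡ d)) ⟩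
      m ℕ.+ 3 ℕ.* (1 ℕ.* d)              ≤⟨ slack {m} {2 ℕ.* q} {d} s 1 51≤d m≤ ⟩
      (3 ℕ.+ s) ℕ.* d ℕ.+ 2 ℕ.* q          ∎

    linear : ∀ {m q d} t → 51 ℕ.≤ d → m ℕ.≤ 3 ℕ.* t ℕ.* 51 ℕ.+ q → m ℕ.≤ 3 ℕ.* (t ℕ.* d) ℕ.+ q
    linear {m} {q} {d} t 51≤d m≤ = ℕ.≤-trans m≤ (ℕ.+-monoˡ-≤ q
      (ℕ.≤-trans (ℕ.*-monoʳ-≤ (3 ℕ.* t) 51≤d) (ℕ.≤-reflexive (ℕ.*-assoc 3 t d))))

    twice : ∀ {q d} → q ℕ.* q ℕ.≤ 3 ℕ.* d → 2 ℕ.* (q ℕ.* q) ℕ.≤ 6 ℕ.* d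
    twice {q} {d} q²≤3d = ℕ.≤-trans (ℕ.*-monoʳ-≤ 2 q²≤3d) (ℕ.≤-reflexive (sym (ℕ.*-assoc 2 3 d)))

    slack-large : ∀ {q d} s t → 6 ℕ.≤ s → q ℕ.* q ℕ.≤ 3 ℕ.* d → 2 ℕ.* (q ℕ.* q) ℕ.+ 3 ℕ.* (t ℕ.* d) ℕ.≤ (3 ℕ.* t ℕ.+ s) ℕ.* d ℕ.+ q
    slack-large {q} {d} s t 6≤s q²≤3d = begin
      2 ℕ.* (q ℕ.* q) ℕ.+ 3 ℕ.* (t ℕ.* d)    ≤⟨ ℕ.+-monoˡ-≤ (3 ℕ.* (t ℕ.* d)) (ℕ.≤-trans (twice {q} {d} q²≤3d) (ℕ.*-monoˡ-≤ d 6≤s)) ⟩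
      s ℕ.* d ℕ.+ 3 ℕ.* (t ℕ.* d)          ≡⟨ cong (λ x → s ℕ.* d ℕ.+ x) (sym (ℕ.*-assoc 3 t d)) ⟩
      s ℕ.* d ℕ.+ 3 ℕ.* t ℕ.* d            ≡⟨ ℕ.*-distribʳ-+ d s (3 ℕ.* t) ⟨
      (s ℕ.+ 3 ℕ.* t) ℕ.* d              ≡⟨ cong (ℕ._* d) (ℕ.+-comm s (3 ℕ.* t)) ⟩
      (3 ℕ.* t ℕ.+ s) ℕ.* d              ≤⟨ ℕ.m≤m+n _ q ⟩
      (3 ℕ.* t ℕ.+ s) ℕ.* d ℕ.+ q          ∎

  record LevelBound (ℓ q d : ℕ) : Set where
    field
      below : 2 ℕ.* (q ℕ.* q) ℕ.≤ 3 ℕ.* (ℓ ℕ.* d) ℕ.+ q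
      above : 2 ℕ.* (q ℕ.* q) ℕ.+ 3 ℕ.* (ℓ ℕ.* d) ℕ.≤ q ℕ.* d ℕ.+ q

  -- Level 1 serves small q; level 2 is needed once q² is comparable to 3d.
  levelBound : ∀ q d → 4 ℕ.≤ q → 51 ℕ.≤ d → q ℕ.* q ℕ.≤ 3 ℕ.* d → LevelBound 1 q d ⊎ LevelBound 2 q d
  levelBound 0 d () 51≤d q²≤3d
  levelBound 1 d (ℕ.s≤s ()) 51≤d q²≤3d
  levelBound 2 d (ℕ.s≤s (ℕ.s≤s ())) 51≤d q²≤3d
  levelBound 3 d (ℕ.s≤s (ℕ.s≤s (ℕ.s≤s ()))) 51≤d q²≤3d
  levelBound 4 d _ 51≤d q²≤3d = inj₁ record
    { below = linear {d = d} 1 51≤d (ℕ.m≤m+n 32 125) ; above = slack {d = d} 1 1 51≤d (ℕ.m≤m+n 32 23) }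
  levelBound 5 d _ 51≤d q²≤3d = inj₁ record
    { below = linear {d = d} 1 51≤d (ℕ.m≤m+n 50 108) ; above = slack {d = d} 2 1 51≤d (ℕ.m≤m+n 50 57) }
  levelBound 6 d _ 51≤d q²≤3d = inj₁ record
    { below = linear {d = d} 1 51≤d (ℕ.m≤m+n 72 87) ; above = slack {d = d} 3 1 51≤d (ℕ.m≤m+n 72 87) }
  levelBound 7 d _ 51≤d q²≤3d = inj₁ record
    { below = linear {d = d} 1 51≤d (ℕ.m≤m+n 98 62) ; above = slack {d = d} 4 1 51≤d (ℕ.m≤m+n 98 113) }
  levelBound 8 d _ 51≤d q²≤3d = inj₁ record
    { below = linear {d = d} 1 51≤d (ℕ.m≤m+n 128 33) ; above = slack {d = d} 5 1 51≤d (ℕ.m≤m+n 128 135) }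
  levelBound 9 d _ 51≤d q²≤3d = inj₂ record
    { below = linear {d = d} 2 51≤d (ℕ.m≤m+n 162 153) ; above = slack {d = d} 3 2 51≤d (ℕ.m≤m+n 162 0) }
  levelBound 10 d _ 51≤d q²≤3d = inj₂ record
    { below = linear {d = d} 2 51≤d (ℕ.m≤m+n 200 116) ; above = slack {d = d} 4 2 51≤d (ℕ.m≤m+n 200 14) }
  levelBound 11 d _ 51≤d q²≤3d = inj₂ record
    { below = linear {d = d} 2 51≤d (ℕ.m≤m+n 242 75) ; above = slack {d = d} 5 2 51≤d (ℕ.m≤m+n 242 24) }
  levelBound q@(suc (suc (suc (suc (suc (suc (suc (suc (suc (suc (suc (suc (s))))))))))))) d _ _ q²≤3d = inj₂ record
    { below = ℕ.≤-trans (twice {q} {d} q²≤3d) (ℕ.≤-trans (ℕ.≤-reflexive (ℕ.*-assoc 3 2 d)) (ℕ.m≤m+n _ q))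
    ; above = slack-large {q} {d} (6 ℕ.+ s) 2 (ℕ.m≤m+n 6 s) q²≤3d }

  levelBound₁ : ∀ q d → 6 ℕ.≤ q → 51 ℕ.≤ d → q ℕ.* q ℕ.≤ 3 ℕ.* d → 2 ℕ.* (q ℕ.* q) ℕ.+ 3 ℕ.* d ℕ.≤ q ℕ.* d ℕ.+ 2 ℕ.* q
  levelBound₁ 6 d _ 51≤d _ = slack₁ {q = 6} {d} 3 51≤d (ℕ.m≤m+n 72 93)
  levelBound₁ 7 d _ 51≤d _ = slack₁ {q = 7} {d} 4 51≤d (ℕ.m≤m+n 98 120)
  levelBound₁ 8 d _ 51≤d _ = slack₁ {q = 8} {d} 5 51≤d (ℕ.m≤m+n 128 143)
  levelBound₁ q@(suc (suc (suc (suc (suc (suc (suc (suc (suc (s)))))))))) d _ _ q²≤3d = begin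
    2 ℕ.* (q ℕ.* q) ℕ.+ 3 ℕ.* d        ≡⟨ cong (λ e → 2 ℕ.* (q ℕ.* q) ℕ.+ 3 ℕ.* e) (sym (ℕ.*-identityˡ d)) ⟩
    2 ℕ.* (q ℕ.* q) ℕ.+ 3 ℕ.* (1 ℕ.* d)  ≤⟨ slack-large {q} {d} (6 ℕ.+ s) 1 (ℕ.m≤m+n 6 s) q²≤3d ⟩
    q ℕ.* d ℕ.+ q                  ≤⟨ ℕ.+-monoʳ-≤ (q ℕ.* d) (ℕ.m≤m+n q (q ℕ.+ 0)) ⟩
    q ℕ.* d ℕ.+ 2 ℕ.* q              ∎
  levelBound₁ 0 d () _ _
  levelBound₁ 1 d (ℕ.s≤s ()) _ _
  levelBound₁ 2 d (ℕ.s≤s (ℕ.s≤s ())) _ _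
  levelBound₁ 3 d (ℕ.s≤s (ℕ.s≤s (ℕ.s≤s ()))) _ _
  levelBound₁ 4 d (ℕ.s≤s (ℕ.s≤s (ℕ.s≤s (ℕ.s≤s ())))) _ _
  levelBound₁ 5 d (ℕ.s≤s (ℕ.s≤s (ℕ.s≤s (ℕ.s≤s (ℕ.s≤s ()))))) _ _

  double≤ : ∀ q d → 51 ℕ.≤ d → q ℕ.* q ℕ.≤ 3 ℕ.* d → 2 ℕ.* q ℕ.≤ d
  double≤ q d 51≤d q²≤3d with q ℕ.≤? 6
  ... | yes q≤6 = ℕ.≤-trans (ℕ.*-monoʳ-≤ 2 q≤6) (ℕ.≤-trans (ℕ.m≤m+n 12 39) 51≤d)
  ... | no q≰6 = ℕ.*-cancelˡ-≤ 3 (begin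
    3 ℕ.* (2 ℕ.* q)   ≡⟨ ℕ.*-assoc 3 2 q ⟨
    6 ℕ.* q         ≤⟨ ℕ.*-monoˡ-≤ q (ℕ.<⇒≤ (ℕ.≰⇒> q≰6)) ⟩
    q ℕ.* q         ≤⟨ q²≤3d ⟩
    3 ℕ.* d         ∎)

nonneg-cancel : ∀ q .{{_ : NonZero q}} {z} → 0ℤ ≤ + q * z → 0ℤ ≤ z
nonneg-cancel (suc q) {z} 0≤qz = ℤ.*-cancelˡ-≤-pos 0ℤ z (+ suc q) (subst (_≤ + suc q * z) (sym (ℤ.*-zeroʳ (+ suc q))) 0≤qz)

record Coprime₃ (x y z : ℤ) : Set where
  constructor coprime₃
  field
    u v w : ℤ
    bezout : u * x + v * y + w * z ≡ + 1

record Relation (d : ℕ) (a b P Q : ℤ) : Set where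
  constructor relation
  field
    R : ℤ
    equation : P * (a + + d) + Q * (b + + d) ≡ R * (+ 3 * + d)
    coprime : Coprime₃ P Q R

-- The short relations whose lines may miss the region of the sandwich condition.
data Exceptional : ℤ → ℤ → Set where
  [0,3]  : Exceptional (+ 0) (+ 3)
  [3,3]  : Exceptional (+ 3) (+ 3)
  [-3,3] : Exceptional (- + 3) (+ 3)
  [-1,1] : Exceptional (- + 1) (+ 1)
  [-1,2] : Exceptional (- + 1) (+ 2)
  [-2,2] : Exceptional (- + 2) (+ 2)

module Lattice
  (d : ℕ) (51≤d : 51 ℕ.≤ d) {a b : ℤ}
  (3∤A : ¬ (+ 3 ∣ a + + d)) (3∤B : ¬ (+ 3 ∣ b + + d))
  (coprime : Coprime₃ (a + + d) (b + + d) (+ 3 * + d))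
  (P : ℤ) (Q : ℕ) .{{_ : NonZero Q}} (rel : Relation d a b P (+ Q))
  (Q²≤3d : Q ℕ.* Q ℕ.≤ 3 ℕ.* d)
  where

  open Relation rel using (R; equation)
  open Coprime₃ coprime
  open Coprime₃ (Relation.coprime rel) using () renaming (u to x; v to y; w to k₁; bezout to bezout′)

  private
    A B N : ℤ
    A = a + + d
    B = b + + d
    N = + 3 * + d

    kₕ uₕ vₕ : ℤ
    kₕ = u * + Q - v * P
    uₕ = - (+ Q * w + v * R)
    vₕ = u * R + P * w

    3∤k : ∀ k p m → k * A ≡ p + m * N → ¬ (+ 3 ∣ p) → ¬ (+ 3 ∣ k)
    3∤k k p m eq 3∤p (divides j k≡) = 3∤p (divides (j * A - m * + d)
      (≡-via₂ (- + 1) A eq k≡ (ring k p m A (+ d) j)))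
      where
      ring : ∀ k p m A d j → p - (j * A - m * d) * + 3 ≡ - + 1 * (k * A - (p + m * (+ 3 * d))) + A * (k - j * + 3)
      ring = solve-∀

    -- The lattice of all (p , q) with (p , q) ≡ k (A , B) modulo N contains (Q , - P), which lies on the
    -- line P p + Q q = 0, and each line P p + Q q = ℓ N contains a translate of its multiples.
    module Level (ℓ : ℤ) (j : ℤ) where
      k p q m n : ℤ
      k = ℓ * k₁ + j * kₕ
      p = ℓ * (k₁ * A + x * N) + j * + Q
      q = ℓ * (k₁ * B + y * N) - j * P
      m = j * uₕ - ℓ * x
      n = j * vₕ - ℓ * y

      lift-p : k * A ≡ p + m * N
      lift-p = ≡-via₂ (j * + Q) (- j * v) bezout equation (ring A B N P (+ Q) R x k₁ u v w ℓ j)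
        where
        ring : ∀ A B N P Q R x k₁ u v w ℓ j →
          (ℓ * k₁ + j * (u * Q - v * P)) * A - (ℓ * (k₁ * A + x * N) + j * Q + (j * (- (Q * w + v * R)) - ℓ * x) * N)
          ≡ j * Q * (u * A + v * B + w * N - + 1) + - j * v * (P * A + Q * B - R * N)
        ring = solve-∀

      3∤p⇒3∤k : ¬ (+ 3 ∣ p) → ¬ (+ 3 ∣ k)
      3∤p⇒3∤k = 3∤k k p m lift-p

      lift-q : k * B ≡ q + n * N
      lift-q = ≡-via₂ (- j * P) (j * u) bezout equation (ring A B N P (+ Q) R y k₁ u v w ℓ j)
        where
        ring : ∀ A B N P Q R y k₁ u v w ℓ j →
          (ℓ * k₁ + j * (u * Q - v * P)) * B - (ℓ * (k₁ * B + y * N) - j * P + (j * (u * R + P * w) - ℓ * y) * N)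
          ≡ - j * P * (u * A + v * B + w * N - + 1) + j * u * (P * A + Q * B - R * N)
        ring = solve-∀

      level : P * p + + Q * q ≡ ℓ * N
      level = ≡-via₂ (ℓ * k₁) (ℓ * N) equation bezout′ (ring A B N P (+ Q) R x y k₁ ℓ j)
        where
        ring : ∀ A B N P Q R x y k₁ ℓ j →
          P * (ℓ * (k₁ * A + x * N) + j * Q) + Q * (ℓ * (k₁ * B + y * N) - j * P) - ℓ * N
          ≡ ℓ * k₁ * (P * A + Q * B - R * N) + ℓ * N * (x * P + y * Q + k₁ * R - + 1)
        ring = solve-∀

      sandwich : ¬ (+ 3 ∣ k) → p ≤ 0ℤ → 0ℤ ≤ ℓ * N - P * p → 0ℤ ≤ + Q * + d + + Q * p - (ℓ * N - P * p) →
        Sandwich d a b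
      sandwich 3∤k p≤0 low high = record
        { k = k ; p = p ; q = q ; u = m ; v = n
        ; 3∤k = 3∤k ; lift-a = lift-p ; lift-b = lift-q ; p≤0 = p≤0
        ; 0≤q = nonneg-cancel Q (subst (0ℤ ≤_) (≡-via (- + 1) level (ring₁ P p (+ Q) q (ℓ * N))) low)
        ; q≤p+d = ℤ.0≤i-j⇒j≤i (nonneg-cancel Q
            (subst (0ℤ ≤_) (≡-via (+ 1) level (ring₂ P p (+ Q) q (ℓ * N) (+ d))) high))
        }
        where
        ring₁ : ∀ P p Q q L → L - P * p - Q * q ≡ - + 1 * (P * p + Q * q - L)
        ring₁ = solve-∀
        ring₂ : ∀ P p Q q L d → Q * d + Q * p - (L - P * p) - Q * (p + d - q) ≡ + 1 * (P * p + Q * q - L)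
        ring₂ = solve-∀

    module Window (ℓ : ℤ) where
      z j : ℤ
      z = - (ℓ * (k₁ * A + x * N))
      j = z /ℕ Q

      r : ℕ
      r = z %ℕ Q

      r<Q : r ℕ.< Q
      r<Q = n%ℕd<d z Q

      near : Level.p ℓ j ≡ - + r
      near = ≡-via (- + 1) (a≡a%ℕn+[a/ℕn]*n z Q) (ring (ℓ * (k₁ * A + x * N)) j (+ Q) (+ r))
        where
        ring : ∀ z j Q r → z + j * Q - - r ≡ - + 1 * (- z - (r + j * Q))
        ring = solve-∀

      far : Level.p ℓ (j - + 1) ≡ - (+ r + + Q)
      far = ≡-via (- + 1) (a≡a%ℕn+[a/ℕn]*n z Q) (ring (ℓ * (k₁ * A + x * N)) j (+ Q) (+ r))
        where
        ring : ∀ z j Q r → z + (j - + 1) * Q - - (r + Q) ≡ - + 1 * (- z - (r + j * Q))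
        ring = solve-∀

    3∣P : + 3 ∣ + Q → + 3 ∣ P
    3∣P (divides t Q≡) = 3∣*⇒3∣ P 3∤A (divides (R * + d - t * B) (≡-via₂ (+ 1) (- B) equation Q≡ (ring P (+ Q) A B R (+ d) t)))
      where
      ring : ∀ P Q A B R d t → P * A - (R * d - t * B) * + 3 ≡ + 1 * (P * A + Q * B - R * (+ 3 * d)) + - B * (Q - t * + 3)
      ring = solve-∀

    3∤k-multiple : ∀ ℓ m → ℓ * ℓ ≡ + 1 + m * + 3 → + 3 ∣ + Q → ∀ j → ¬ (+ 3 ∣ Level.k ℓ j)
    3∤k-multiple ℓ m ℓ² 3∣Q j 3∣k = absurd (3∣P 3∣Q) 3∣Q 3∣k
      where
      absurd : + 3 ∣ P → + 3 ∣ + Q → + 3 ∣ Level.k ℓ j → ⊥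
      absurd (divides s P≡) (divides t Q≡) (divides i k≡) = 1≢3* (x * s + y * t + R * c) (trans (sym bezout′) eq)
        where
        c : ℤ
        c = ℓ * i - m * k₁ - ℓ * j * u * t + ℓ * j * v * s
        k₁≡ : k₁ ≡ c * + 3
        k₁≡ = ≡-by (trans (ring ℓ k₁ u v (+ Q) P m i j s t)
          (cong₂ _+_ (cong₂ _+_ (vanish (- k₁) ℓ²) (vanish ℓ k≡)) (cong₂ _+_ (vanish (- ℓ * j * u) Q≡) (vanish (ℓ * j * v) P≡))))
          where
          ring : ∀ ℓ k₁ u v Q P m i j s t → k₁ - (ℓ * i - m * k₁ - ℓ * j * u * t + ℓ * j * v * s) * + 3
            ≡ - k₁ * (ℓ * ℓ - (+ 1 + m * + 3)) + ℓ * (ℓ * k₁ + j * (u * Q - v * P) - i * + 3)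
              + (- ℓ * j * u * (Q - t * + 3) + ℓ * j * v * (P - s * + 3))
          ring = solve-∀
        eq : x * P + y * + Q + k₁ * R ≡ (x * s + y * t + R * c) * + 3
        eq = trans (cong₂ (λ P k → x * P + y * + Q + k * R) P≡ k₁≡) (trans (cong (λ Q → x * (s * + 3) + y * Q + c * + 3 * R) Q≡)
          (ring x y s t R c))
          where
          ring : ∀ x y s t R c → x * (s * + 3) + y * (t * + 3) + c * + 3 * R ≡ (x * s + y * t + R * c) * + 3
          ring = solve-∀

    module _ (p′ : ℕ) (P≡ : P ≡ - + p′) (p′≤Q : p′ ℕ.≤ Q) (ℓ : ℕ) (m : ℤ) (ℓ² : + ℓ * + ℓ ≡ + 1 + m * + 3)
             (bound : LevelBound ℓ Q d) where
      open Window (+ ℓ)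

      private
        cast : ∀ c e → + (c ℕ.* (ℓ ℕ.* e)) ≡ + c * (+ ℓ * + e)
        cast c e = trans (ℤ.pos-* c (ℓ ℕ.* e)) (cong (λ z → + c * z) (ℤ.pos-* ℓ e))
        cast² : + (2 ℕ.* (Q ℕ.* Q)) ≡ + 2 * (+ Q * + Q)
        cast² = trans (ℤ.pos-* 2 (Q ℕ.* Q)) (cong (λ z → + 2 * z) (ℤ.pos-* Q Q))

        below : 0ℤ ≤ + 3 * (+ ℓ * + d) + + Q - + 2 * (+ Q * + Q)
        below = subst (0ℤ ≤_) (cong₂ (λ l r → l + + Q - r) (cast 3 d) cast²) (+≤ (LevelBound.below bound))

        above : 0ℤ ≤ + Q * + d + + Q - (+ 2 * (+ Q * + Q) + + 3 * (+ ℓ * + d))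
        above = subst (0ℤ ≤_) (cong₂ (λ l r → l + + Q - r) (ℤ.pos-* Q d) (cong₂ _+_ cast² (cast 3 d)))
          (+≤ (LevelBound.above bound))

        sandwich-at : ∀ j X → Level.p (+ ℓ) j ≡ - X → 0ℤ ≤ X → 0ℤ ≤ + 2 * + Q - + 1 - X →
          ¬ (+ 3 ∣ Level.k (+ ℓ) j) → Sandwich d a b
        sandwich-at j X p≡ 0≤X X≤ 3∤k = Level.sandwich (+ ℓ) j 3∤k (subst (_≤ 0ℤ) (sym p≡) (ℤ.neg-mono-≤ 0≤X))
          (subst (0ℤ ≤_) (trans (ring₁ (+ ℓ) (+ d) (+ Q) (+ p′) X) (cong₂ (λ P p → + ℓ * N - P * p) (sym P≡) (sym p≡)))
            (below ⊕ pos Q ⊗ X≤ ⊕ +≤ p′≤Q ⊗ 0≤X))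
          (subst (0ℤ ≤_) (trans (ring₂ (+ ℓ) (+ d) (+ Q) (+ p′) X)
              (cong₂ (λ P p → + Q * + d + + Q * p - (+ ℓ * N - P * p)) (sym P≡) (sym p≡)))
            (above ⊕ X≤ ⊗ +≤ p′≤Q ⊕ pos p′ ⊗ (X≤ ⊕ 0≤X)))
          where
          ring₁ : ∀ ℓ d Q p X → + 3 * (ℓ * d) + Q - + 2 * (Q * Q) + Q * (+ 2 * Q - + 1 - X) + (Q - p) * X
            ≡ ℓ * (+ 3 * d) - - p * - X
          ring₁ = solve-∀
          ring₂ : ∀ ℓ d Q p X → Q * d + Q - (+ 2 * (Q * Q) + + 3 * (ℓ * d)) + (+ 2 * Q - + 1 - X) * (Q - p) +
            p * (+ 2 * Q - + 1 - X + X) ≡ Q * d + Q * - X - (ℓ * (+ 3 * d) - - p * - X)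
          ring₂ = solve-∀

        r≤ : 0ℤ ≤ + 2 * + Q - + 1 - + r
        r≤ = subst (0ℤ ≤_) (ring (+ Q) (+ r)) (+≤ r<Q ⊕ pos Q)
          where
          ring : ∀ Q r → Q - (+ 1 + r) + Q ≡ + 2 * Q - + 1 - r
          ring = solve-∀

        r+Q≤ : 0ℤ ≤ + 2 * + Q - + 1 - (+ r + + Q)
        r+Q≤ = subst (0ℤ ≤_) (ring (+ Q) (+ r)) (+≤ r<Q)
          where
          ring : ∀ Q r → Q - (+ 1 + r) ≡ + 2 * Q - + 1 - (r + Q)
          ring = solve-∀

      negative⇒sandwich : Sandwich d a b
      negative⇒sandwich with + 3 ∣? + Q
      ... | yes 3∣Q = sandwich-at j (+ r) near (pos r) r≤ (3∤k-multiple (+ ℓ) m ℓ² 3∣Q j)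
      ... | no 3∤Q with + 3 ∣? Level.p (+ ℓ) j
      ... | no 3∤p = sandwich-at j (+ r) near (pos r) r≤ (Level.3∤p⇒3∤k (+ ℓ) j 3∤p)
      ... | yes 3∣p = sandwich-at (j - + 1) (+ r + + Q) far (pos r ⊕ pos Q) r+Q≤
        (Level.3∤p⇒3∤k (+ ℓ) (j - + 1) λ 3∣p′ →
          3∤Q (subst (+ 3 ∣_) (trans (cong₂ _-_ near far) (ring (+ r) (+ Q))) (∣m∣n⇒∣m-n 3∣p 3∣p′)))
        where
        ring : ∀ r Q → - r - - (r + Q) ≡ Q
        ring = solve-∀

    module _ (p′ : ℕ) (P≡ : P ≡ + p′) (p′≤Q : p′ ℕ.≤ Q) where

      private
        0≤P : 0ℤ ≤ P
        0≤P = subst (0ℤ ≤_) (sym P≡) (pos p′)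
        P≤Q : 0ℤ ≤ + Q - P
        P≤Q = subst (λ P → 0ℤ ≤ + Q - P) (sym P≡) (+≤ p′≤Q)

      positive-unit⇒sandwich : ¬ (+ 3 ∣ + Q) → Sandwich d a b
      positive-unit⇒sandwich 3∤Q = Level.sandwich 0ℤ (- + 1)
        (Level.3∤p⇒3∤k 0ℤ (- + 1) λ 3∣p → 3∤Q (subst (+ 3 ∣_) (trans (cong (-_) p≡) (ℤ.neg-involutive (+ Q))) (∣m⇒∣-m 3∣p)))
        (subst (_≤ 0ℤ) (sym p≡) (ℤ.neg-mono-≤ (pos Q)))
        (subst (0ℤ ≤_) (trans (ring₁ P (+ Q) N) (cong (λ p → 0ℤ * N - P * p) (sym p≡))) (0≤P ⊗ pos Q))
        (subst (0ℤ ≤_) (trans (ring₂ P (+ Q) (+ d) N) (cong (λ p → + Q * + d + + Q * p - (0ℤ * N - P * p)) (sym p≡)))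
          (pos Q ⊗ 2Q≤d ⊕ pos Q ⊗ P≤Q))
        where
        p : ℤ
        p = Level.p 0ℤ (- + 1)
        p≡ : p ≡ - + Q
        p≡ = ring (k₁ * A + x * N) (+ Q)
          where
          ring : ∀ z Q → 0ℤ * z + - + 1 * Q ≡ - Q
          ring = solve-∀
        2Q≤d : 0ℤ ≤ + d - + 2 * + Q
        2Q≤d = subst (λ z → 0ℤ ≤ + d - z) (ℤ.pos-* 2 Q) (+≤ (double≤ Q d 51≤d Q²≤3d))
        ring₁ : ∀ P Q N → P * Q ≡ 0ℤ * N - P * - Q
        ring₁ = solve-∀
        ring₂ : ∀ P Q d N → Q * (d - + 2 * Q) + Q * (Q - P) ≡ Q * d + Q * - Q - (0ℤ * N - P * - Q)
        ring₂ = solve-∀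

      positive-multiple⇒sandwich : + 3 ∣ + Q → 6 ℕ.≤ Q → Sandwich d a b
      positive-multiple⇒sandwich 3∣Q 6≤Q = Level.sandwich (+ 1) j (3∤k-multiple (+ 1) 0ℤ refl 3∣Q j)
        (subst (_≤ 0ℤ) (sym near) (ℤ.neg-mono-≤ (pos r)))
        (subst (0ℤ ≤_) (trans (ring₁ P (+ d) (+ r)) (cong (λ p → + 1 * N - P * p) (sym near))) (pos 3 ⊗ pos d ⊕ 0≤P ⊗ pos r))
        (subst (0ℤ ≤_) (trans (ring₂ P (+ Q) (+ d) (+ r)) (cong (λ p → + Q * + d + + Q * p - (+ 1 * N - P * p)) (sym near)))
          (bound ⊕ +≤ r<Q ⊗ (pos Q ⊕ pos Q) ⊕ P≤Q ⊗ pos r))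
        where
        open Window (+ 1)
        bound : 0ℤ ≤ + Q * + d + + 2 * + Q - (+ 2 * (+ Q * + Q) + + 3 * + d)
        bound = subst (0ℤ ≤_) (cong₂ _-_ (cong₂ _+_ (ℤ.pos-* Q d) (ℤ.pos-* 2 Q))
            (cong₂ _+_ (trans (ℤ.pos-* 2 (Q ℕ.* Q)) (cong (λ z → + 2 * z) (ℤ.pos-* Q Q))) (ℤ.pos-* 3 d)))
          (+≤ (levelBound₁ Q d 6≤Q 51≤d Q²≤3d))
        ring₁ : ∀ P d r → + 3 * d + P * r ≡ + 1 * (+ 3 * d) - P * - r
        ring₁ = solve-∀
        ring₂ : ∀ P Q d r → Q * d + + 2 * Q - (+ 2 * (Q * Q) + + 3 * d) + (Q - (+ 1 + r)) * (Q + Q) + (Q - P) * r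
          ≡ Q * d + Q * - r - (+ 1 * (+ 3 * d) - P * - r)
        ring₂ = solve-∀

  private
    multiples-of-3 : ∀ p → p ℕ.≤ 3 → + 3 ∣ + p → p ≡ 0 ⊎ p ≡ 3
    multiples-of-3 0 _ _ = inj₁ refl
    multiples-of-3 1 _ 3∣1 with ℕ.∣⇒≤ (∣⇒∣ᵤ 3∣1)
    ... | ℕ.s≤s ()
    multiples-of-3 2 _ 3∣2 with ℕ.∣⇒≤ (∣⇒∣ᵤ 3∣2)
    ... | ℕ.s≤s (ℕ.s≤s ())
    multiples-of-3 3 _ _ = inj₂ refl
    multiples-of-3 (suc (suc (suc (suc p)))) (ℕ.s≤s (ℕ.s≤s (ℕ.s≤s ()))) _

    3∣⇒3∨≥6 : ∀ q .{{_ : NonZero q}} → + 3 ∣ + q → q ≡ 3 ⊎ 6 ℕ.≤ q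
    3∣⇒3∨≥6 q 3∣q with ∣⇒∣ᵤ 3∣q
    ... | ℕ.divides 1 eq = inj₁ eq
    ... | ℕ.divides (suc (suc n)) eq = inj₂ (subst (6 ℕ.≤_) (sym eq) (ℕ.m≤m+n 6 (n ℕ.* 3)))
    3∣⇒3∨≥6 (suc q) 3∣q | ℕ.divides 0 ()

    small-negative : ∀ p q → suc p ℕ.≤ q → q ℕ.≤ 3 → (+ 3 ∣ + q → + 3 ∣ -[1+ p ]) → Exceptional -[1+ p ] (+ q)
    small-negative 0 1 _ _ _ = [-1,1]
    small-negative 0 2 _ _ _ = [-1,2]
    small-negative 1 2 _ _ _ = [-2,2]
    small-negative 2 3 _ _ _ = [-3,3]
    small-negative 0 3 _ _ 3∣p with ℕ.∣⇒≤ (∣⇒∣ᵤ (3∣p (divides (+ 1) refl)))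
    ... | ℕ.s≤s ()
    small-negative 1 3 _ _ 3∣p with ℕ.∣⇒≤ (∣⇒∣ᵤ (3∣p (divides (+ 1) refl)))
    ... | ℕ.s≤s (ℕ.s≤s ())
    small-negative (suc p) 1 (ℕ.s≤s ()) _ _
    small-negative (suc (suc p)) 2 (ℕ.s≤s (ℕ.s≤s ())) _ _
    small-negative (suc (suc (suc p))) 3 (ℕ.s≤s (ℕ.s≤s (ℕ.s≤s ()))) _ _
    small-negative _ (suc (suc (suc (suc q)))) _ (ℕ.s≤s (ℕ.s≤s (ℕ.s≤s ()))) _

  sandwich-or-exceptional : ∣ P ∣ ℕ.≤ Q → Sandwich d a b ⊎ Exceptional P (+ Q)
  sandwich-or-exceptional = go P refl
    where
    Outcome : ℤ → Set
    Outcome P′ = Sandwich d a b ⊎ Exceptional P′ (+ Q)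

    multiple : ∀ p → P ≡ + p → p ℕ.≤ Q → + 3 ∣ + Q → Q ≡ 3 ⊎ 6 ℕ.≤ Q → Outcome (+ p)
    multiple p P≡ p≤Q 3∣Q (inj₂ 6≤Q) = inj₁ (positive-multiple⇒sandwich p P≡ p≤Q 3∣Q 6≤Q)
    multiple p P≡ p≤Q 3∣Q (inj₁ Q≡3) = inj₂ (subst (λ q → Exceptional (+ p) (+ q)) (sym Q≡3)
      (exceptional (multiples-of-3 p (subst (p ℕ.≤_) Q≡3 p≤Q) (subst (+ 3 ∣_) P≡ (3∣P 3∣Q)))))
      where
      exceptional : ∀ {p} → p ≡ 0 ⊎ p ≡ 3 → Exceptional (+ p) (+ 3)
      exceptional (inj₁ refl) = [0,3]
      exceptional (inj₂ refl) = [3,3]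

    nonnegative : ∀ p → P ≡ + p → p ℕ.≤ Q → Dec (+ 3 ∣ + Q) → Outcome (+ p)
    nonnegative p P≡ p≤Q (no 3∤Q) = inj₁ (positive-unit⇒sandwich p P≡ p≤Q 3∤Q)
    nonnegative p P≡ p≤Q (yes 3∣Q) = multiple p P≡ p≤Q 3∣Q (3∣⇒3∨≥6 Q 3∣Q)

    large : ∀ p → P ≡ -[1+ p ] → suc p ℕ.≤ Q → LevelBound 1 Q d ⊎ LevelBound 2 Q d → Sandwich d a b
    large p P≡ p<Q (inj₁ bound) = negative⇒sandwich (suc p) P≡ p<Q 1 0ℤ refl bound
    large p P≡ p<Q (inj₂ bound) = negative⇒sandwich (suc p) P≡ p<Q 2 (+ 1) refl bound

    negative : ∀ p → P ≡ -[1+ p ] → suc p ℕ.≤ Q → Dec (Q ℕ.≤ 3) → Outcome -[1+ p ]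
    negative p P≡ p<Q (yes Q≤3) = inj₂ (small-negative p Q p<Q Q≤3 λ 3∣Q → subst (+ 3 ∣_) P≡ (3∣P 3∣Q))
    negative p P≡ p<Q (no Q≰3) = inj₁ (large p P≡ p<Q (levelBound Q d (ℕ.≰⇒> Q≰3) 51≤d Q²≤3d))

    go : ∀ P′ → P ≡ P′ → ∣ P′ ∣ ℕ.≤ Q → Outcome P′
    go (+ p) P≡ p≤Q = nonnegative p P≡ p≤Q (+ 3 ∣? + Q)
    go -[1+ p ] P≡ p<Q = negative p P≡ p<Q (Q ℕ.≤? 3)

record Gcd₂ (x y : ℤ) : Set where
  field
    g : ℕ
    x′ y′ u v : ℤ
    x≡ : x ≡ x′ * + g
    y≡ : y ≡ y′ * + g
    bezout : u * x + v * y ≡ + g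

private
  gcd-ℕ : ∀ m n → Gcd₂ (+ m) (+ n)
  gcd-ℕ m n with Bézout.lemma m n
  ... | Bézout.result g gcd (Bézout.+- x y eq) = record
    { g = g ; x′ = + ℕ.quotient (GCD.gcd∣m gcd) ; y′ = + ℕ.quotient (GCD.gcd∣n gcd) ; u = + x ; v = - + y
    ; x≡ = trans (cong (+_) (ℕ._∣_.equality (GCD.gcd∣m gcd))) (ℤ.pos-* (ℕ.quotient (GCD.gcd∣m gcd)) g)
    ; y≡ = trans (cong (+_) (ℕ._∣_.equality (GCD.gcd∣n gcd))) (ℤ.pos-* (ℕ.quotient (GCD.gcd∣n gcd)) g)
    ; bezout = ≡-via (- + 1) (trans (cong (λ z → + g + z) (sym (ℤ.pos-* y n))) (trans (cong (+_) eq) (ℤ.pos-* x m)))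
        (ring (+ x) (+ m) (+ y) (+ n) (+ g))
    }
    where
    ring : ∀ x m y n g → x * m + - y * n - g ≡ - + 1 * (g + y * n - x * m)
    ring = solve-∀
  ... | Bézout.result g gcd (Bézout.-+ x y eq) = record
    { g = g ; x′ = + ℕ.quotient (GCD.gcd∣m gcd) ; y′ = + ℕ.quotient (GCD.gcd∣n gcd) ; u = - + x ; v = + y
    ; x≡ = trans (cong (+_) (ℕ._∣_.equality (GCD.gcd∣m gcd))) (ℤ.pos-* (ℕ.quotient (GCD.gcd∣m gcd)) g)
    ; y≡ = trans (cong (+_) (ℕ._∣_.equality (GCD.gcd∣n gcd))) (ℤ.pos-* (ℕ.quotient (GCD.gcd∣n gcd)) g)
    ; bezout = ≡-via (- + 1) (trans (cong (λ z → + g + z) (sym (ℤ.pos-* x m))) (trans (cong (+_) eq) (ℤ.pos-* y n)))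
        (ring (+ x) (+ m) (+ y) (+ n) (+ g))
    }
    where
    ring : ∀ x m y n g → - x * m + y * n - g ≡ - + 1 * (g + x * m - y * n)
    ring = solve-∀

  signed : ∀ x → ∃[ σ ] (+ ∣ x ∣ ≡ σ * x) × (x ≡ σ * + ∣ x ∣)
  signed (+ n) = + 1 , sym (ℤ.*-identityˡ (+ n)) , sym (ℤ.*-identityˡ (+ n))
  signed -[1+ n ] = - + 1 , sym (ℤ.-1*i≡-i -[1+ n ]) , sym (ℤ.-1*i≡-i (+ suc n))

gcd₂ : ∀ x y → Gcd₂ x y
gcd₂ x y with signed x | signed y | gcd-ℕ ∣ x ∣ ∣ y ∣
... | σ , ∣x∣≡ , x≡∣x∣ | τ , ∣y∣≡ , y≡∣y∣ | G = record
  { g = g ; x′ = σ * x′ ; y′ = τ * y′ ; u = u * σ ; v = v * τ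
  ; x≡ = trans x≡∣x∣ (trans (cong (σ *_) x≡) (sym (ℤ.*-assoc σ x′ (+ g))))
  ; y≡ = trans y≡∣y∣ (trans (cong (τ *_) y≡) (sym (ℤ.*-assoc τ y′ (+ g))))
  ; bezout = trans (cong₂ _+_ (trans (ℤ.*-assoc u σ x) (cong (u *_) (sym ∣x∣≡)))
                              (trans (ℤ.*-assoc v τ y) (cong (v *_) (sym ∣y∣≡)))) bezout
  }
  where open Gcd₂ G

record Gcd₃ (x y z : ℤ) : Set where
  field
    g : ℕ
    x′ y′ z′ u v w : ℤ
    x≡ : x ≡ x′ * + g
    y≡ : y ≡ y′ * + g
    z≡ : z ≡ z′ * + g
    bezout : u * x + v * y + w * z ≡ + g

  coprime-quotients : .{{_ : NonZero g}} → Coprime₃ x′ y′ z′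
  coprime-quotients = coprime₃ u v w (ℤ.*-cancelʳ-≡ (u * x′ + v * y′ + w * z′) (+ 1) (+ g) (begin
    (u * x′ + v * y′ + w * z′) * + g                     ≡⟨ ring u v w x′ y′ z′ (+ g) ⟩
    u * (x′ * + g) + v * (y′ * + g) + w * (z′ * + g)     ≡⟨ cong₂ _+_ (cong₂ (λ x y → u * x + v * y) x≡ y≡) (cong (w *_) z≡) ⟨
    u * x + v * y + w * z                                ≡⟨ bezout ⟩
    + g                                                  ≡⟨ ℤ.*-identityˡ (+ g) ⟨
    + 1 * + g                                            ∎))
    where
    open ≡-Reasoning
    ring : ∀ u v w x y z g → (u * x + v * y + w * z) * g ≡ u * (x * g) + v * (y * g) + w * (z * g)
    ring = solve-∀

gcd₃ : ∀ x y z → Gcd₃ x y z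
gcd₃ x y z = record
  { g = H.g ; x′ = G.x′ * H.x′ ; y′ = G.y′ * H.x′ ; z′ = H.y′ ; u = H.u * G.u ; v = H.u * G.v ; w = H.v
  ; x≡ = trans G.x≡ (trans (cong (G.x′ *_) H.x≡) (sym (ℤ.*-assoc G.x′ H.x′ (+ H.g))))
  ; y≡ = trans G.y≡ (trans (cong (G.y′ *_) H.x≡) (sym (ℤ.*-assoc G.y′ H.x′ (+ H.g))))
  ; z≡ = H.y≡
  ; bezout = trans (cong (_+ H.v * z) (trans (ring H.u G.u G.v x y) (cong (H.u *_) G.bezout))) H.bezout
  }
  where
  module G = Gcd₂ (gcd₂ x y)
  module H = Gcd₂ (gcd₂ (+ G.g) z)
  ring : ∀ t u v x y → t * u * x + t * v * y ≡ t * (u * x + v * y)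
  ring = solve-∀

private
  isqrt : ∀ n → ∃[ s ] s ℕ.* s ℕ.≤ n × n ℕ.< suc s ℕ.* suc s
  isqrt zero = 0 , ℕ.z≤n , ℕ.s≤s ℕ.z≤n
  isqrt (suc n) with isqrt n
  ... | s , s²≤n , n<[s+1]² with suc n ℕ.<? suc s ℕ.* suc s
  ... | yes small = s , ℕ.m≤n⇒m≤1+n s²≤n , small
  ... | no large = suc s , ℕ.≮⇒≥ large , ℕ.<-≤-trans (ℕ.s≤s n<[s+1]²)
    (ℕ.*-mono-< {suc s} {suc (suc s)} ℕ.≤-refl ℕ.≤-refl)

  ∣-∣≤ : ∀ {s} i j → i ℕ.≤ s → j ℕ.≤ s → ∣ + i - + j ∣ ℕ.≤ s
  ∣-∣≤ {s} i j i≤s j≤s = ℕ.≤-trans (ℕ.≤-reflexive (cong ∣_∣ (ℤ.m-n≡m⊖n i j)))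
    (ℕ.≤-trans (ℤ.∣m⊝n∣≤m⊔n i j) (ℕ.⊔-lub i≤s j≤s))

thue : ∀ N .{{_ : NonZero N}} A B → ∃[ P ] ∃[ Q ] ∃[ R ]
  P * A + Q * B ≡ R * + N × ∣ P ∣ ℕ.* ∣ P ∣ ℕ.≤ N × ∣ Q ∣ ℕ.* ∣ Q ∣ ℕ.≤ N × ¬ (P ≡ 0ℤ × Q ≡ 0ℤ)
thue N A B with isqrt N
... | s , s²≤N , N<m = result
  where
  rowᶠ colᶠ : Fin (suc s ℕ.* suc s) → Fin (suc s)
  rowᶠ k = proj₁ (remQuot {suc s} (suc s) k)
  colᶠ k = proj₂ (remQuot {suc s} (suc s) k)

  row col : Fin (suc s ℕ.* suc s) → ℕ
  row k = toℕ (rowᶠ k)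
  col k = toℕ (colᶠ k)

  rebuild : ∀ k → combine (rowᶠ k) (colᶠ k) ≡ k
  rebuild = combine-remQuot {suc s} (suc s)

  separate : ∀ i j → row i ≡ row j → col i ≡ col j → i ≡ j
  separate i j row≡ col≡ = trans (sym (rebuild i))
    (trans (cong₂ (combine {suc s} {suc s}) {rowᶠ i} {rowᶠ j} {colᶠ i} {colᶠ j} (toℕ-injective row≡) (toℕ-injective col≡)) (rebuild j))

  row≤ : ∀ k → row k ℕ.≤ s
  row≤ k = ℕ.s≤s⁻¹ (toℕ<n (rowᶠ k))

  col≤ : ∀ k → col k ℕ.≤ s
  col≤ k = ℕ.s≤s⁻¹ (toℕ<n (colᶠ k))

  form : Fin (suc s ℕ.* suc s) → ℤ
  form k = + row k * A + + col k * B

  residue : Fin (suc s ℕ.* suc s) → Fin N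
  residue k = fromℕ< (n%ℕd<d (form k) N)

  square≤ : ∀ {t} → t ℕ.≤ s → t ℕ.* t ℕ.≤ N
  square≤ t≤s = ℕ.≤-trans (ℕ.*-mono-≤ t≤s t≤s) s²≤N

  result : ∃[ P ] ∃[ Q ] ∃[ R ]
    P * A + Q * B ≡ R * + N × ∣ P ∣ ℕ.* ∣ P ∣ ℕ.≤ N × ∣ Q ∣ ℕ.* ∣ Q ∣ ℕ.≤ N × ¬ (P ≡ 0ℤ × Q ≡ 0ℤ)
  result with pigeonhole N<m residue
  ... | i , j , i<j , collision =
    + row i - + row j , + col i - + col j , form i /ℕ N - form j /ℕ N ,
    equation ,
    square≤ (∣-∣≤ (row i) (row j) (row≤ i) (row≤ j)) ,
    square≤ (∣-∣≤ (col i) (col j) (col≤ i) (col≤ j)) ,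
    λ { (P≡0 , Q≡0) → Fin.<⇒≢ i<j (separate i j (ℤ.+-injective (≡-by P≡0)) (ℤ.+-injective (≡-by Q≡0))) }
    where
    open ≡-Reasoning
    same : form i %ℕ N ≡ form j %ℕ N
    same = trans (sym (toℕ-fromℕ< (n%ℕd<d (form i) N))) (trans (cong toℕ collision) (toℕ-fromℕ< (n%ℕd<d (form j) N)))
    equation : (+ row i - + row j) * A + (+ col i - + col j) * B ≡ (form i /ℕ N - form j /ℕ N) * + N
    equation = begin
      (+ row i - + row j) * A + (+ col i - + col j) * B     ≡⟨ split (+ row i) (+ row j) (+ col i) (+ col j) A B ⟩
      form i - form j                                       ≡⟨ cong₂ _-_ (a≡a%ℕn+[a/ℕn]*n (form i) N) (a≡a%ℕn+[a/ℕn]*n (form j) N) ⟩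
      + (form i %ℕ N) + form i /ℕ N * + N - (+ (form j %ℕ N) + form j /ℕ N * + N)
        ≡⟨ cong (λ r → + r + form i /ℕ N * + N - (+ (form j %ℕ N) + form j /ℕ N * + N)) same ⟩
      + (form j %ℕ N) + form i /ℕ N * + N - (+ (form j %ℕ N) + form j /ℕ N * + N)
        ≡⟨ cancel (+ (form j %ℕ N)) (form i /ℕ N) (form j /ℕ N) (+ N) ⟩
      (form i /ℕ N - form j /ℕ N) * + N                     ∎
      where
      split : ∀ r r′ c c′ A B → (r - r′) * A + (c - c′) * B ≡ r * A + c * B - (r′ * A + c′ * B)
      split = solve-∀
      cancel : ∀ r x y N → r + x * N - (r + y * N) ≡ (x - y) * N
      cancel = solve-∀

record ShortRelation (d : ℕ) (a b : ℤ) : Set where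
  field
    P Q : ℤ
    rel : Relation d a b P Q
    ∣P∣² : ∣ P ∣ ℕ.* ∣ P ∣ ℕ.≤ 3 ℕ.* d
    ∣Q∣² : ∣ Q ∣ ℕ.* ∣ Q ∣ ℕ.≤ 3 ℕ.* d

private
  shrink : ∀ {N} x y g .{{_ : NonZero g}} → x ≡ y * + g → ∣ x ∣ ℕ.* ∣ x ∣ ℕ.≤ N → ∣ y ∣ ℕ.* ∣ y ∣ ℕ.≤ N
  shrink x y g x≡yg x²≤N = ℕ.≤-trans (ℕ.*-mono-≤ ∣y∣≤∣x∣ ∣y∣≤∣x∣) x²≤N
    where
    ∣y∣≤∣x∣ : ∣ y ∣ ℕ.≤ ∣ x ∣
    ∣y∣≤∣x∣ = ℕ.≤-trans (ℕ.m≤m*n ∣ y ∣ g) (ℕ.≤-reflexive (sym (trans (cong ∣_∣ x≡yg) (ℤ.abs-* y (+ g)))))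

private
  primitive-part : ∀ {d a b P Q R} → Gcd₃ P Q R → P * (a + + d) + Q * (b + + d) ≡ R * + (3 ℕ.* d) →
    ∣ P ∣ ℕ.* ∣ P ∣ ℕ.≤ 3 ℕ.* d → ∣ Q ∣ ℕ.* ∣ Q ∣ ℕ.≤ 3 ℕ.* d → ¬ (P ≡ 0ℤ × Q ≡ 0ℤ) → ShortRelation d a b
  primitive-part {d} {a} {b} {P} {Q} {R} G equation P² Q² nonzero = go (g ℕ.≟ 0)
    where
    open Gcd₃ G renaming (x′ to P′; y′ to Q′; z′ to R′; x≡ to P≡; y≡ to Q≡; z≡ to R≡)
    open ≡-Reasoning
    ring₁ : ∀ P Q A B g → (P * A + Q * B) * g ≡ P * g * A + Q * g * B
    ring₁ = solve-∀
    ring₂ : ∀ R g N → R * g * N ≡ R * N * g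
    ring₂ = solve-∀
    go : Dec (g ≡ 0) → ShortRelation d a b
    go (yes g≡0) = contradiction (zero-of P P′ P≡ , zero-of Q Q′ Q≡) nonzero
      where
      zero-of : ∀ x y → x ≡ y * + g → x ≡ 0ℤ
      zero-of x y x≡ = trans x≡ (trans (cong (λ g → y * + g) g≡0) (ℤ.*-zeroʳ y))
    go (no g≢0) = record
      { P = P′ ; Q = Q′
      ; rel = relation R′ (ℤ.*-cancelʳ-≡ (P′ * (a + + d) + Q′ * (b + + d)) (R′ * (+ 3 * + d)) (+ g) (begin
          (P′ * (a + + d) + Q′ * (b + + d)) * + g        ≡⟨ ring₁ P′ Q′ (a + + d) (b + + d) (+ g) ⟩
          P′ * + g * (a + + d) + Q′ * + g * (b + + d)    ≡⟨ cong₂ (λ P Q → P * (a + + d) + Q * (b + + d)) P≡ Q≡ ⟨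
          P * (a + + d) + Q * (b + + d)                  ≡⟨ equation ⟩
          R * + (3 ℕ.* d)                                ≡⟨ cong₂ _*_ R≡ (ℤ.pos-* 3 d) ⟩
          R′ * + g * (+ 3 * + d)                         ≡⟨ ring₂ R′ (+ g) (+ 3 * + d) ⟩
          R′ * (+ 3 * + d) * + g                         ∎)) coprime-quotients
      ; ∣P∣² = shrink P P′ g P≡ P²
      ; ∣Q∣² = shrink Q Q′ g Q≡ Q²
      }
      where
      instance
        g-nonzero : NonZero g
        g-nonzero = ℕ.≢-nonZero g≢0

shortRelation : ∀ d .{{_ : NonZero d}} a b → ShortRelation d a b
shortRelation d a b =
  let P , Q , R , equation , P² , Q² , nonzero = thue (3 ℕ.* d) {{ℕ.m*n≢0 3 d}} (a + + d) (b + + d) in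
  primitive-part (gcd₃ P Q R) equation P² Q² nonzero

relation-neg : ∀ {d a b P Q} → Relation d a b P Q → Relation d a b (- P) (- Q)
relation-neg {d} {a} {b} {P} {Q} (relation R equation (coprime₃ u v w bezout)) = relation (- R)
  (≡-via (- + 1) equation (ring₁ P Q R (a + + d) (b + + d) (+ 3 * + d)))
  (coprime₃ (- u) (- v) (- w) (trans (ring₂ P Q R u v w) bezout))
  where
  ring₁ : ∀ P Q R A B N → - P * A + - Q * B - - R * N ≡ - + 1 * (P * A + Q * B - R * N)
  ring₁ = solve-∀
  ring₂ : ∀ P Q R u v w → - u * - P + - v * - Q + - w * - R ≡ u * P + v * Q + w * R
  ring₂ = solve-∀

relation-swap : ∀ {d a b P Q} → Relation d a b P Q → Relation d b a Q P
relation-swap {d} {a} {b} {P} {Q} (relation R equation (coprime₃ u v w bezout)) = relation R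
  (trans (ℤ.+-comm (Q * (b + + d)) (P * (a + + d))) equation)
  (coprime₃ v u w (trans (cong (_+ w * R) (ℤ.+-comm (v * Q) (u * P))) bezout))

relation-reflect : ∀ {d a b P Q} → Relation d a b P Q → Relation d (+ d - b) (+ d - a) Q P
relation-reflect {d} {a} {b} {P} {Q} (relation R equation (coprime₃ u v w bezout)) = relation (P + Q - R)
  (≡-via (- + 1) equation (ring₁ P Q R a b (+ d)))
  (coprime₃ (v + w) (u + w) (- w) (trans (ring₂ P Q R u v w) bezout))
  where
  ring₁ : ∀ P Q R a b d → Q * (d - b + d) + P * (d - a + d) - (P + Q - R) * (+ 3 * d) ≡ - + 1 * (P * (a + d) + Q * (b + d) - R * (+ 3 * d))
  ring₁ = solve-∀
  ring₂ : ∀ P Q R u v w → (v + w) * Q + (u + w) * P + - w * (P + Q - R) ≡ u * P + v * Q + w * R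
  ring₂ = solve-∀

Column : Set
Column = Fin 3 × Fin 3

entry : ℕ → Column → Fin 3
entry zero    = proj₁
entry (suc _) = proj₂

parity-step : ∀ q c → entry ((q + + 1) %ℕ 2) c ≡ entry (q %ℕ 2) (swap c)
parity-step q c with q %ℕ 2 | a≡a%ℕn+[a/ℕn]*n q 2 | n%ℕd<d q 2
... | 0 | q≡ | _ = cong (λ r → entry r c) (%ℕ-unique 2 (q + + 1) (q /ℕ 2) {1} ℕ.≤-refl (trans (cong (_+ + 1) q≡) (ring (q /ℕ 2))))
  where
  ring : ∀ h → + 0 + h * + 2 + + 1 ≡ + 1 + h * + 2
  ring = solve-∀
... | 1 | q≡ | _ = cong (λ r → entry r c) (%ℕ-unique 2 (q + + 1) (q /ℕ 2 + + 1) {0} (ℕ.s≤s ℕ.z≤n) (trans (cong (_+ + 1) q≡) (ring (q /ℕ 2))))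
  where
  ring : ∀ h → + 1 + h * + 2 + + 1 ≡ + 0 + (h + + 1) * + 2
  ring = solve-∀
... | suc (suc _) | _ | ℕ.s≤s (ℕ.s≤s ())

parity-shift : ∀ q t c → entry ((q + t * + 2) %ℕ 2) c ≡ entry (q %ℕ 2) c
parity-shift q t c = cong (λ r → entry r c) (%ℕ-unique 2 (q + t * + 2) (q /ℕ 2 + t) (n%ℕd<d q 2)
  (trans (cong (_+ t * + 2) (a≡a%ℕn+[a/ℕn]*n q 2)) (ring (+ (q %ℕ 2)) (q /ℕ 2) t)))
  where
  ring : ∀ r h t → r + h * + 2 + t * + 2 ≡ r + (h + t) * + 2
  ring = solve-∀

window : ℕ → Column → Column → Column → Fin 4 → Fin 3
window e c₀ c₁ c₂ 0F = entry e c₁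
window e c₀ c₁ c₂ 1F = entry e (swap c₁)
window e c₀ c₁ c₂ 2F = entry e c₂
window e c₀ c₁ c₂ 3F = entry e (swap c₀)

Rainbow : Column → Column → Column → Set
Rainbow c₀ c₁ c₂ = ∀ (e : Fin 2) (c : Fin 3) → ∃[ i ] window (toℕ e) c₀ c₁ c₂ i ≡ c

rainbow? : ∀ c₀ c₁ c₂ → Dec (Rainbow c₀ c₁ c₂)
rainbow? c₀ c₁ c₂ = all? λ e → all? λ c → any? λ i → window (toℕ e) c₀ c₁ c₂ i ≟ᶠ c

-- A colouring of ℤ/2d, written as the columns (χ i , χ (i + d)); going once around a cycle of length d swaps a column.
record Ladder (d : ℕ) : Set where
  field
    column : ℕ → Column
    rainbow : ∀ i → Rainbow (column i) (column (suc i)) (column (suc (suc i)))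
    wrap₀ : column d ≡ swap (column 0)
    wrap₁ : column (suc d) ≡ swap (column 1)

module _ {d : ℕ} .{{_ : NonZero d}} (1<d : 1 ℕ.< d) (L : Ladder d) where
  open Ladder L

  private
    colour : ℤ → Fin 3
    colour v = entry ((v /ℕ d) %ℕ 2) (column (v %ℕ d))

    colour-inner : ∀ v q {i} → i ℕ.< d → v ≡ + i + q * + d → colour v ≡ entry (q %ℕ 2) (column i)
    colour-inner v q i<d v≡ = cong₂ (λ q i → entry (q %ℕ 2) (column i)) (/ℕ-unique d v q i<d v≡) (%ℕ-unique d v q i<d v≡)

    next-row : ∀ i q d → i + d + q * d ≡ i + (q + + 1) * d
    next-row = solve-∀

    colour-at : ∀ v q i → i ℕ.≤ suc d → v ≡ + i + q * + d → colour v ≡ entry (q %ℕ 2) (column i)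
    colour-at v q i i≤1+d v≡ with i ℕ.<? d
    ... | yes i<d = colour-inner v q i<d v≡
    ... | no i≮d with i ℕ.≟ d
    ... | yes refl = trans (colour-inner v (q + + 1) {0} (ℕ.<-trans (ℕ.s≤s ℕ.z≤n) 1<d) (trans v≡ (next-row 0ℤ q (+ d))))
      (trans (parity-step q (column 0)) (cong (entry (q %ℕ 2)) (sym wrap₀)))
    ... | no i≢d with ℕ.≤-antisym i≤1+d (ℕ.≤∧≢⇒< (ℕ.≮⇒≥ i≮d) (λ d≡i → i≢d (sym d≡i)))
    ... | refl = trans (colour-inner v (q + + 1) {1} 1<d (trans v≡ (next-row (+ 1) q (+ d))))
      (trans (parity-step q (column 1)) (cong (entry (q %ℕ 2)) (sym wrap₁)))

  ladder⇒tricolourable : ∀ {a b k} (s t r : ℤ) → k * a ≡ + 1 + r * (+ 2 * + d) → k * + d ≡ + d + s * (+ 2 * + d) →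
    k * b ≡ + d - + 1 + t * (+ 2 * + d) → Tricolourable (quad 0ℤ (+ d) a b)
  ladder⇒tricolourable {a} {b} {k} s t r lift-a lift-d lift-b = (λ n → colour (k * n)) , λ n c →
    let v = k * n - + 1
        i = v %ℕ d
        q = v /ℕ d
        e = fromℕ< (n%ℕd<d q 2)
        j , window≡c = rainbow i e c
    in j , trans (at n v i q refl (n%ℕd<d v d) (a≡a%ℕn+[a/ℕn]*n v d) j)
      (trans (cong (λ e → window e (column i) (column (suc i)) (column (suc (suc i))) j) (sym (toℕ-fromℕ< (n%ℕd<d q 2)))) window≡c)
    where
    at : ∀ n v i q → v ≡ k * n - + 1 → i ℕ.< d → v ≡ + i + q * + d → ∀ j →
      colour (k * (n + quad 0ℤ (+ d) a b j)) ≡ window (q %ℕ 2) (column i) (column (suc i)) (column (suc (suc i))) j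
    at n v i q v≡ i<d split 0F = colour-at (k * (n + 0ℤ)) q (suc i) (ℕ.m≤n⇒m≤1+n i<d)
      (≡-via₂ (- + 1) (+ 1) v≡ split (ring k n v (+ i) q (+ d)))
      where
      ring : ∀ k n v i q d → k * (n + 0ℤ) - (+ 1 + i + q * d) ≡ - + 1 * (v - (k * n - + 1)) + + 1 * (v - (i + q * d))
      ring = solve-∀
    at n v i q v≡ i<d split 1F = trans
      (colour-at (k * (n + + d)) (q + + 1 + s * + 2) (suc i) (ℕ.m≤n⇒m≤1+n i<d)
        (≡-via₂ (- + 1) (+ 1) v≡ split (trans (cong (λ z → z - (+ 1 + + i + (q + + 1 + s * + 2) * + d)) (trans (ℤ.*-distribˡ-+ k n (+ d)) (cong (λ z → k * n + z) lift-d)))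
          (ring (k * n) v (+ i) q (+ d) s))))
      (trans (parity-shift (q + + 1) s (column (suc i))) (parity-step q (column (suc i))))
      where
      ring : ∀ kn v i q d s → kn + (d + s * (+ 2 * d)) - (+ 1 + i + (q + + 1 + s * + 2) * d) ≡ - + 1 * (v - (kn - + 1)) + + 1 * (v - (i + q * d))
      ring = solve-∀
    at n v i q v≡ i<d split 2F = trans
      (colour-at (k * (n + a)) (q + r * + 2) (suc (suc i)) (ℕ.s≤s i<d)
        (≡-via₂ (- + 1) (+ 1) v≡ split (trans (cong (λ z → z - (+ 2 + + i + (q + r * + 2) * + d)) (trans (ℤ.*-distribˡ-+ k n a) (cong (λ z → k * n + z) lift-a)))
          (ring (k * n) v (+ i) q (+ d) r))))
      (parity-shift q r (column (suc (suc i))))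
      where
      ring : ∀ kn v i q d s → kn + (+ 1 + s * (+ 2 * d)) - (+ 2 + i + (q + s * + 2) * d) ≡ - + 1 * (v - (kn - + 1)) + + 1 * (v - (i + q * d))
      ring = solve-∀
    at n v i q v≡ i<d split 3F = trans
      (colour-at (k * (n + b)) (q + + 1 + t * + 2) i (ℕ.m≤n⇒m≤1+n (ℕ.<⇒≤ i<d))
        (≡-via₂ (- + 1) (+ 1) v≡ split (trans (cong (λ z → z - (+ i + (q + + 1 + t * + 2) * + d)) (trans (ℤ.*-distribˡ-+ k n b) (cong (λ z → k * n + z) lift-b)))
          (ring (k * n) v (+ i) q (+ d) t))))
      (trans (parity-shift (q + + 1) t (column i)) (parity-step q (column i)))
      where
      ring : ∀ kn v i q d s → kn + (d - + 1 + s * (+ 2 * d)) - (i + (q + + 1 + s * + 2) * d) ≡ - + 1 * (v - (kn - + 1)) + + 1 * (v - (i + q * d))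
      ring = solve-∀

private
  alternate : ℕ → Column
  alternate 0 = 2F , 1F
  alternate 1 = 0F , 0F
  alternate (suc (suc n)) = alternate n

  alternate-rainbow : ∀ i → Rainbow (alternate i) (alternate (suc i)) (alternate (suc (suc i)))
  alternate-rainbow 0 = from-yes (rainbow? (2F , 1F) (0F , 0F) (2F , 1F))
  alternate-rainbow 1 = from-yes (rainbow? (0F , 0F) (2F , 1F) (0F , 0F))
  alternate-rainbow (suc (suc i)) = alternate-rainbow i

  alternate-even : ∀ t → alternate (t ℕ.* 2) ≡ (2F , 1F)
  alternate-even zero = refl
  alternate-even (suc t) = alternate-even t

  alternate-odd : ∀ t → alternate (suc (t ℕ.* 2)) ≡ (0F , 0F)
  alternate-odd zero = refl
  alternate-odd (suc t) = alternate-odd t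

odd-ladder : ∀ t → Ladder (3 ℕ.+ t ℕ.* 2)
odd-ladder t = record { column = column ; rainbow = rainbow ; wrap₀ = alternate-odd t ; wrap₁ = alternate-even t }
  where
  column : ℕ → Column
  column 0 = 0F , 0F
  column 1 = 1F , 2F
  column (suc (suc n)) = alternate n
  rainbow : ∀ i → Rainbow (column i) (column (suc i)) (column (suc (suc i)))
  rainbow 0 = from-yes (rainbow? (column 0) (column 1) (column 2))
  rainbow 1 = from-yes (rainbow? (column 1) (column 2) (column 3))
  rainbow (suc (suc i)) = alternate-rainbow i

even-ladder : ∀ t → Ladder (6 ℕ.+ t ℕ.* 2)
even-ladder t = record { column = column ; rainbow = rainbow ; wrap₀ = alternate-odd t ; wrap₁ = alternate-even t }
  where
  column : ℕ → Column
  column 0 = 0F , 0F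
  column 1 = 1F , 2F
  column 2 = 0F , 1F
  column 3 = 2F , 2F
  column 4 = 0F , 1F
  column (suc (suc (suc (suc (suc n))))) = alternate n
  rainbow : ∀ i → Rainbow (column i) (column (suc i)) (column (suc (suc i)))
  rainbow 0 = from-yes (rainbow? (column 0) (column 1) (column 2))
  rainbow 1 = from-yes (rainbow? (column 1) (column 2) (column 3))
  rainbow 2 = from-yes (rainbow? (column 2) (column 3) (column 4))
  rainbow 3 = from-yes (rainbow? (column 3) (column 4) (column 5))
  rainbow 4 = from-yes (rainbow? (column 4) (column 5) (column 6))
  rainbow (suc (suc (suc (suc (suc i))))) = alternate-rainbow i

ladder : ∀ d → 5 ℕ.≤ d → Ladder d
ladder d 5≤d with d ℕ.% 2 | ℕ.m≡m%n+[m/n]*n d 2 | ℕ.m%n<n d 2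
... | 0 | d≡ | _ = subst Ladder (sym d≡) (go (d ℕ./ 2) (subst (5 ℕ.≤_) d≡ 5≤d))
  where
  go : ∀ h → 5 ℕ.≤ h ℕ.* 2 → Ladder (h ℕ.* 2)
  go (suc (suc (suc h))) _ = even-ladder h
  go 0 ()
  go 1 (ℕ.s≤s (ℕ.s≤s ()))
  go 2 (ℕ.s≤s (ℕ.s≤s (ℕ.s≤s (ℕ.s≤s ()))))
... | 1 | d≡ | _ = subst Ladder (sym d≡) (go (d ℕ./ 2) (subst (5 ℕ.≤_) d≡ 5≤d))
  where
  go : ∀ h → 5 ℕ.≤ suc (h ℕ.* 2) → Ladder (suc (h ℕ.* 2))
  go (suc h) _ = odd-ladder h
  go 0 (ℕ.s≤s ())
... | suc (suc _) | _ | ℕ.s≤s (ℕ.s≤s ())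

tricolourable-swap : ∀ {d a b} → Tricolourable (quad 0ℤ d b a) → Tricolourable (quad 0ℤ d a b)
tricolourable-swap {d} {a} {b} = tricolourable-reindex {quad 0ℤ d a b} {quad 0ℤ d b a}
  (λ where 0F → 0F; 1F → 1F; 2F → 3F; 3F → 2F)
  (λ where 0F → refl; 1F → refl; 2F → refl; 3F → refl)

tricolourable-reflect : ∀ {d a b} → Tricolourable (quad 0ℤ d (d - b) (d - a)) → Tricolourable (quad 0ℤ d a b)
tricolourable-reflect {d} {a} {b} = tricolourable-pull {quad 0ℤ d a b} {quad 0ℤ d (d - b) (d - a)} (- + 1) d
  (λ where 0F → 1F; 1F → 0F; 2F → 3F; 3F → 2F)
  (λ where 0F → ring₀ d; 1F → ring₁ d; 2F → ring₂ d b; 3F → ring₂ d a)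
  where
  ring₀ : ∀ d → 0ℤ ≡ - + 1 * d + d
  ring₀ = solve-∀
  ring₁ : ∀ d → d ≡ - + 1 * 0ℤ + d
  ring₁ = solve-∀
  ring₂ : ∀ d b → d - b ≡ - + 1 * b + d
  ring₂ = solve-∀

parity : ∀ x → (∃[ h ] x ≡ h * + 2) ⊎ (∃[ h ] x ≡ + 1 + h * + 2)
parity x with x %ℕ 2 | a≡a%ℕn+[a/ℕn]*n x 2 | n%ℕd<d x 2
... | 0 | eq | _ = inj₁ (x /ℕ 2 , trans eq (ℤ.+-identityˡ (x /ℕ 2 * + 2)))
... | 1 | eq | _ = inj₂ (x /ℕ 2 , eq)
... | suc (suc _) | _ | ℕ.s≤s (ℕ.s≤s ())

1≢2* : ∀ h → ¬ (+ 1 ≡ h * + 2)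
1≢2* h eq with ∣⇒∣ᵤ (divides h eq)
... | 2∣1 with ℕ.∣1⇒≡1 2∣1
... | ()

module _ (d : ℕ) .{{_ : NonZero d}} (5≤d : 5 ℕ.≤ d) where

  private
    via-even : ∀ {a b} u w → a + b ≡ - + d → u * a + w * + 2 * + d ≡ + 1 → Tricolourable (quad 0ℤ (+ d) a b)
    via-even {a} {b} u w sum bezout with parity u
    ... | inj₁ (h , u≡) = contradiction (≡-via₂ (- + 1) a bezout u≡ (ring a u w (+ d) h)) (1≢2* (h * a + w * + d))
      where
      ring : ∀ a u w d h → + 1 - (h * a + w * d) * + 2 ≡ - + 1 * (u * a + w * + 2 * d - + 1) + a * (u - h * + 2)
      ring = solve-∀
    ... | inj₂ (s , u≡) = ladder⇒tricolourable (ℕ.<-≤-trans (ℕ.s≤s (ℕ.s≤s ℕ.z≤n)) 5≤d) (ladder d 5≤d) {k = u} s (w - s - + 1) (- w)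
      (≡-via (+ 1) bezout (ring₁ u a w (+ d)))
      (trans (cong (_* + d) u≡) (ring₂ s (+ d)))
      (≡-by (trans (ring₃ u a b w (+ d) s) (cong₂ _+_ (cong₂ _+_ (vanish u sum) (vanish (- + 1) bezout)) (vanish (- + d) u≡))))
      where
      ring₃ : ∀ u a b w d s → u * b - (d - + 1 + (w - s - + 1) * (+ 2 * d)) ≡
        u * (a + b - - d) + - + 1 * (u * a + w * + 2 * d - + 1) + - d * (u - (+ 1 + s * + 2))
      ring₃ = solve-∀
      ring₁ : ∀ u a w d → u * a - (+ 1 + - w * (+ 2 * d)) ≡ + 1 * (u * a + w * + 2 * d - + 1)
      ring₁ = solve-∀
      ring₂ : ∀ s d → (+ 1 + s * + 2) * d ≡ d + s * (+ 2 * d)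
      ring₂ = solve-∀

    via-odd : ∀ {a b} h u w → a ≡ + 1 + h * + 2 → a + b ≡ - + d → u * a + w * + d ≡ + 1 → Tricolourable (quad 0ℤ (+ d) a b)
    via-odd {a} {b} h u w a≡ sum bezout with parity w
    ... | inj₁ (w′ , w≡) = via-even u w′ sum (trans (cong (λ w → u * a + w * + d) (sym w≡)) bezout)
    ... | inj₂ (w′ , w≡) = via-even (u + + d) (w′ - h) sum (≡-by (trans (ring u a w (+ d) w′ h)
      (cong₂ _+_ (cong₂ _+_ (vanish (+ 1) bezout) (vanish (- + d) w≡)) (vanish (+ d) a≡))))
      where
      ring : ∀ u a w d w′ h → (u + d) * a + (w′ - h) * + 2 * d - + 1 ≡
        + 1 * (u * a + w * d - + 1) + - d * (w - (+ 1 + w′ * + 2)) + d * (a - (+ 1 + h * + 2))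
      ring = solve-∀

  -- One of a, b is odd, and a unit multiple modulo 2d carries the set to {0, 1, d, d - 1}.
  a+b≡-d⇒tricolourable : ∀ {a b} → a + b ≡ - + d → Coprime₃ a b (+ d) → Tricolourable (quad 0ℤ (+ d) a b)
  a+b≡-d⇒tricolourable {a} {b} sum (coprime₃ u v w bezout) with parity a | parity b
  ... | inj₂ (h , a≡) | _ = via-odd h (u - v) (w - v) a≡ sum (≡-via₂ (+ 1) (- v) bezout sum (ring a b u v w (+ d)))
    where
    ring : ∀ a b u v w d → (u - v) * a + (w - v) * d - + 1 ≡ + 1 * (u * a + v * b + w * d - + 1) + - v * (a + b - - d)
    ring = solve-∀
  ... | inj₁ _ | inj₂ (h , b≡) = tricolourable-swap (via-odd h (v - u) (w - u) b≡ (trans (ℤ.+-comm b a) sum)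
    (≡-via₂ (+ 1) (- u) bezout sum (ring a b u v w (+ d))))
    where
    ring : ∀ a b u v w d → (v - u) * b + (w - u) * d - + 1 ≡ + 1 * (u * a + v * b + w * d - + 1) + - u * (a + b - - d)
    ring = solve-∀
  ... | inj₁ (h , a≡) | inj₁ (h′ , b≡) = contradiction
    (≡-by (trans (ring a b u v w (+ d) h h′)
      (cong₂ _+_ (cong₂ _+_ (vanish (- + 1) bezout) (vanish w sum)) (cong₂ _+_ (vanish (u - w) a≡) (vanish (v - w) b≡)))))
    (1≢2* ((u - w) * h + (v - w) * h′))
    where
    ring : ∀ a b u v w d h h′ → + 1 - ((u - w) * h + (v - w) * h′) * + 2 ≡
      - + 1 * (u * a + v * b + w * d - + 1) + w * (a + b - - d) + ((u - w) * (a - h * + 2) + (v - w) * (b - h′ * + 2))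
    ring = solve-∀

module _ where
  private
    table : ℕ → Fin 3
    table 3 = 1F
    table 6 = 1F
    table 7 = 1F
    table 8 = 1F
    table 9 = 2F
    table 10 = 2F
    table 11 = 1F
    table 12 = 2F
    table 13 = 2F
    table 14 = 2F
    table _ = 0F

    offset : Fin 4 → ℕ
    offset 0F = 0
    offset 1F = 8
    offset 2F = 6
    offset 3F = 14

    carry : Quad
    carry = quad 0ℤ 0ℤ 0ℤ (- + 1)

    offset≡ : ∀ i → quad 0ℤ (+ 8) (+ 6) (- + 1) i ≡ + offset i + carry i * + 15
    offset≡ 0F = refl
    offset≡ 1F = refl
    offset≡ 2F = refl
    offset≡ 3F = refl

    table-rainbow : ∀ (r : Fin 15) (c : Fin 3) → ∃[ i ] table ((toℕ r ℕ.+ offset i) ℕ.% 15) ≡ c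
    table-rainbow = from-yes (all? λ (r : Fin 15) → all? λ c → any? λ i → table ((toℕ r ℕ.+ offset i) ℕ.% 15) ≟ᶠ c)

  -- No multiplier works here; the table was found by search.
  sporadic-tricolourable : Tricolourable (quad 0ℤ (+ 8) (+ 6) (- + 1))
  sporadic-tricolourable = (λ n → table (n %ℕ 15)) , λ n c →
    let r = fromℕ< (n%ℕd<d n 15)
        i , table≡c = table-rainbow r c
        m = toℕ r ℕ.+ offset i
    in i , trans (cong table (%ℕ-unique 15 (n + quad 0ℤ (+ 8) (+ 6) (- + 1) i) (n /ℕ 15 + + (m ℕ./ 15) + carry i) {m ℕ.% 15} (ℕ.m%n<n m 15)
         (lift n i (toℕ r) (toℕ-fromℕ< (n%ℕd<d n 15))))) table≡c
    where
    lift : ∀ n i r → r ≡ n %ℕ 15 → n + quad 0ℤ (+ 8) (+ 6) (- + 1) i ≡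
      + ((r ℕ.+ offset i) ℕ.% 15) + (n /ℕ 15 + + ((r ℕ.+ offset i) ℕ./ 15) + carry i) * + 15
    lift n i r refl = begin
      n + quad 0ℤ (+ 8) (+ 6) (- + 1) i                             ≡⟨ cong₂ _+_ (a≡a%ℕn+[a/ℕn]*n n 15) (offset≡ i) ⟩
      + r + n /ℕ 15 * + 15 + (+ offset i + carry i * + 15)          ≡⟨ ring₁ (+ r) (n /ℕ 15) (+ offset i) (carry i) ⟩
      + (r ℕ.+ offset i) + (n /ℕ 15 + carry i) * + 15
        ≡⟨ cong (_+ (n /ℕ 15 + carry i) * + 15) (trans (cong (+_) (ℕ.m≡m%n+[m/n]*n m 15)) (cong (λ z → + (m ℕ.% 15) + z) (ℤ.pos-* (m ℕ./ 15) 15))) ⟩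
      + (m ℕ.% 15) + + (m ℕ./ 15) * + 15 + (n /ℕ 15 + carry i) * + 15  ≡⟨ ring₂ (+ (m ℕ.% 15)) (+ (m ℕ./ 15)) (n /ℕ 15) (carry i) ⟩
      + (m ℕ.% 15) + (n /ℕ 15 + + (m ℕ./ 15) + carry i) * + 15      ∎
      where
      open ≡-Reasoning
      m = r ℕ.+ offset i
      ring₁ : ∀ r q o t → r + q * + 15 + (o + t * + 15) ≡ r + o + (q + t) * + 15
      ring₁ = solve-∀
      ring₂ : ∀ r x q t → r + x * + 15 + (q + t) * + 15 ≡ r + (q + x + t) * + 15
      ring₂ = solve-∀

trichotomy : ∀ t → t ≡ 0ℤ ⊎ 0ℤ ≤ t - + 1 ⊎ 0ℤ ≤ - + 1 - t
trichotomy (+ 0) = inj₁ refl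
trichotomy +[1+ n ] = inj₂ (inj₁ (pos n))
trichotomy -[1+ n ] = inj₂ (inj₂ (subst (0ℤ ≤_) (ring (+ n)) (pos n)))
  where
  ring : ∀ n → n ≡ - + 1 - - (+ 1 + n)
  ring = solve-∀

negative-absurd : ∀ {x} → x ≡ - + 1 → ¬ (0ℤ ≤ x)
negative-absurd refl ()

positive : ∀ {z} → 0ℤ ≤ z → z ≢ 0ℤ → 0ℤ ≤ z - + 1
positive {z} 0≤z z≢0 with trichotomy z
... | inj₁ z≡0 = contradiction z≡0 z≢0
... | inj₂ (inj₁ 1≤z) = 1≤z
... | inj₂ (inj₂ z<0) = contradiction (0≤z ⊕ z<0) (negative-absurd (ring z))
  where
  ring : ∀ z → z + (- + 1 - z) ≡ - + 1
  ring = solve-∀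

pinch : ∀ (d : ℕ) c t z → z ≡ (c + t * + 3) * + d → 0ℤ ≤ z - (c - + 3) * + d - + 1 → 0ℤ ≤ (c + + 3) * + d - z - + 1 → t ≡ 0ℤ
pinch d c t z refl low high with trichotomy t
... | inj₁ t≡0 = t≡0
... | inj₂ (inj₁ 1≤t) = contradiction (high ⊕ 1≤t ⊗ pos d ⊗ pos 3) (negative-absurd (ring c t (+ d)))
  where
  ring : ∀ c t d → (c + + 3) * d - (c + t * + 3) * d - + 1 + (t - + 1) * d * + 3 ≡ - + 1
  ring = solve-∀
... | inj₂ (inj₂ t<0) = contradiction (low ⊕ t<0 ⊗ pos d ⊗ pos 3) (negative-absurd (ring c t (+ d)))
  where
  ring : ∀ c t d → (c + t * + 3) * d - (c - + 3) * d - + 1 + (- + 1 - t) * d * + 3 ≡ - + 1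
  ring = solve-∀

3∤2d : ∀ {d} → ¬ (+ 3 ∣ d) → ¬ (+ 3 ∣ + 2 * d)
3∤2d {d} 3∤d 3∣2d = 3∤d (subst (+ 3 ∣_) (ring d) (∣m∣n⇒∣m-n (divides d (ℤ.*-comm (+ 3) d)) 3∣2d))
  where
  ring : ∀ d → + 3 * d - + 2 * d ≡ d
  ring = solve-∀

coprime-shift : ∀ {a b d} → ¬ (+ 3 ∣ a + d) → Coprime₃ a b d → Coprime₃ (a + d) (b + d) (+ 3 * d)
coprime-shift {a} {b} {d} 3∤A (coprime₃ u v w bezout) with square≡1[3] 3∤A
... | m , A² = coprime₃ (u + (w - u - v) * d * (a + d)) v (- (w - u - v) * m)
  (≡-via₂ (+ 1) ((w - u - v) * d) bezout A² (ring a b d u v w m))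
  where
  ring : ∀ a b d u v w m → (u + (w - u - v) * d * (a + d)) * (a + d) + v * (b + d) + - (w - u - v) * m * (+ 3 * d) - + 1
    ≡ + 1 * (u * a + v * b + w * d - + 1) + (w - u - v) * d * ((a + d) * (a + d) - (+ 1 + m * + 3))
  ring = solve-∀

-- The residue classes mod 3 are {0, a} and {d, b}, and no difference between the classes exceeds d.
record Split (d : ℕ) (a b : ℤ) : Set where
  field
    3∤d : ¬ (+ 3 ∣ + d)
    3∣a : + 3 ∣ a
    3∣b-d : + 3 ∣ b - + d
    0≤a : 0ℤ ≤ a
    a≤2d : 0ℤ ≤ + 2 * + d - a
    -d≤b : 0ℤ ≤ b + + d
    b≤d : 0ℤ ≤ + d - b
    b-a≤d : 0ℤ ≤ + d - (b - a)
    a-b≤d : 0ℤ ≤ + d - (a - b)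
    a≢0 : a ≢ 0ℤ
    b≢d : b ≢ + d
    coprime : Coprime₃ a b (+ d)

-- The residue classes mod 3 are {0} and {d, a, b}, and no difference between the classes exceeds d.
record Lone (d : ℕ) (a b : ℤ) : Set where
  field
    3∤d : ¬ (+ 3 ∣ + d)
    3∣a-d : + 3 ∣ a - + d
    3∣b-d : + 3 ∣ b - + d
    -d≤a : 0ℤ ≤ a + + d
    a≤d : 0ℤ ≤ + d - a
    -d≤b : 0ℤ ≤ b + + d
    b≤d : 0ℤ ≤ + d - b
    a≢d : a ≢ + d
    b≢d : b ≢ + d
    a≢b : a ≢ b
    coprime : Coprime₃ a b (+ d)

split-reflect : ∀ {d a b} → Split d a b → Split d (+ d - b) (+ d - a)
split-reflect {d} {a} {b} S = record
  { 3∤d = 3∤d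
  ; 3∣a = subst (+ 3 ∣_) (ring₁ b (+ d)) (∣m⇒∣-m 3∣b-d)
  ; 3∣b-d = subst (+ 3 ∣_) (ring₂ a (+ d)) (∣m⇒∣-m 3∣a)
  ; 0≤a = b≤d
  ; a≤2d = subst (0ℤ ≤_) (ring₃ b (+ d)) -d≤b
  ; -d≤b = subst (0ℤ ≤_) (ring₄ a (+ d)) a≤2d
  ; b≤d = subst (0ℤ ≤_) (ring₅ a (+ d)) 0≤a
  ; b-a≤d = subst (0ℤ ≤_) (ring₆ a b (+ d)) b-a≤d
  ; a-b≤d = subst (0ℤ ≤_) (ring₇ a b (+ d)) a-b≤d
  ; a≢0 = λ d-b≡0 → b≢d (sym (≡-by d-b≡0))
  ; b≢d = λ d-a≡d → a≢0 (≡-via (- + 1) d-a≡d (ring₈ a (+ d)))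
  ; coprime = let open Coprime₃ coprime in coprime₃ (- v) (- u) (u + v + w) (trans (ring₉ a b (+ d) u v w) bezout)
  }
  where
  open Split S
  ring₁ : ∀ b d → - (b - d) ≡ d - b
  ring₁ = solve-∀
  ring₂ : ∀ a d → - a ≡ d - a - d
  ring₂ = solve-∀
  ring₃ : ∀ b d → b + d ≡ + 2 * d - (d - b)
  ring₃ = solve-∀
  ring₄ : ∀ a d → + 2 * d - a ≡ d - a + d
  ring₄ = solve-∀
  ring₅ : ∀ a d → a ≡ d - (d - a)
  ring₅ = solve-∀
  ring₆ : ∀ a b d → d - (b - a) ≡ d - (d - a - (d - b))
  ring₆ = solve-∀
  ring₇ : ∀ a b d → d - (a - b) ≡ d - (d - b - (d - a))
  ring₇ = solve-∀
  ring₈ : ∀ a d → a - 0ℤ ≡ - + 1 * (d - a - d)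
  ring₈ = solve-∀
  ring₉ : ∀ a b d u v w → - v * (d - b) + - u * (d - a) + (u + v + w) * d ≡ u * a + v * b + w * d
  ring₉ = solve-∀

lone-swap : ∀ {d a b} → Lone d a b → Lone d b a
lone-swap {d} {a} {b} L = record
  { 3∤d = 3∤d ; 3∣a-d = 3∣b-d ; 3∣b-d = 3∣a-d ; -d≤a = -d≤b ; a≤d = b≤d ; -d≤b = -d≤a ; b≤d = a≤d
  ; a≢d = b≢d ; b≢d = a≢d ; a≢b = λ b≡a → a≢b (sym b≡a)
  ; coprime = let open Coprime₃ coprime in coprime₃ v u w (trans (cong (_+ w * + d) (ℤ.+-comm (v * b) (u * a))) bezout)
  }
  where open Lone L

module _ {d : ℕ} {a b : ℤ} (51≤d : 51 ℕ.≤ d) where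
  private
    instance
      d≢0 : NonZero d
      d≢0 = ℕ.>-nonZero (ℕ.<-≤-trans (ℕ.s≤s ℕ.z≤n) 51≤d)

    0≤d-1 : 0ℤ ≤ + d - + 1
    0≤d-1 = +≤ (ℕ.≤-trans (ℕ.s≤s ℕ.z≤n) 51≤d)

    no-[0,3] : ¬ (+ 3 ∣ + d) → + 3 ∣ b - + d → 0ℤ ≤ b + + d → 0ℤ ≤ + d - b → b ≢ + d → ¬ Relation d a b (+ 0) (+ 3)
    no-[0,3] 3∤d 3∣b-d -d≤b b≤d b≢d (relation R equation _) = contradiction (b≡d (3∣*⇒3∣ (R - + 2) 3∤d (subst (+ 3 ∣_) b-d≡ 3∣b-d))) b≢d
      where
      b≡ : b ≡ (R - + 1) * + d
      b≡ = ℤ.*-cancelˡ-≡ (+ 3) b ((R - + 1) * + d) (≡-via (+ 1) equation (ring a b R (+ d)))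
        where
        ring : ∀ a b R d → + 3 * b - + 3 * ((R - + 1) * d) ≡ + 1 * (+ 0 * (a + d) + + 3 * (b + d) - R * (+ 3 * d))
        ring = solve-∀
      b-d≡ : b - + d ≡ (R - + 2) * + d
      b-d≡ = ≡-via (+ 1) b≡ (ring b R (+ d))
        where
        ring : ∀ b R d → b - d - (R - + 2) * d ≡ + 1 * (b - (R - + 1) * d)
        ring = solve-∀
      b≡d : + 3 ∣ R - + 2 → b ≡ + d
      b≡d (divides t R≡) = trans b≡1+3t (trans (cong (λ t → (+ 1 + t * + 3) * + d) t≡0) (ℤ.*-identityˡ (+ d)))
        where
        b≡1+3t : b ≡ (+ 1 + t * + 3) * + d
        b≡1+3t = ≡-via₂ (+ 1) (+ d) b≡ R≡ (ring b R (+ d) t)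
          where
          ring : ∀ b R d t → b - (+ 1 + t * + 3) * d ≡ + 1 * (b - (R - + 1) * d) + d * (R - + 2 - t * + 3)
          ring = solve-∀
        t≡0 : t ≡ 0ℤ
        t≡0 = pinch d (+ 1) t b b≡1+3t
          (subst (0ℤ ≤_) (ring₁ b (+ d)) (-d≤b ⊕ 0≤d-1))
          (subst (0ℤ ≤_) (ring₂ b (+ d)) (b≤d ⊕ pos d ⊕ pos d ⊕ 0≤d-1))
          where
          ring₁ : ∀ b d → b + d + (d - + 1) ≡ b - (+ 1 - + 3) * d - + 1
          ring₁ = solve-∀
          ring₂ : ∀ b d → d - b + d + d + (d - + 1) ≡ (+ 1 + + 3) * d - b - + 1
          ring₂ = solve-∀

  split-exceptional : ∀ {P Q} → Split d a b → Relation d a b P Q → Exceptional P Q → Tricolourable (quad 0ℤ (+ d) a b)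
  split-exceptional S rel [0,3] = contradiction rel (no-[0,3] 3∤d 3∣b-d -d≤b b≤d b≢d)
    where open Split S
  split-exceptional S (relation R equation (coprime₃ x y k bezout)) [3,3] =
    contradiction (R≡3 (3∣*⇒3∣ (R - + 3) 3∤d (subst (+ 3 ∣_) sum-d≡ (∣m∣n⇒∣m+n 3∣a 3∣b-d)))) R≢3
    where
    open Split S
    sum-d≡ : a + (b - + d) ≡ (R - + 3) * + d
    sum-d≡ = ℤ.*-cancelˡ-≡ (+ 3) _ _ (≡-via (+ 1) equation (ring a b R (+ d)))
      where
      ring : ∀ a b R d → + 3 * (a + (b - d)) - + 3 * ((R - + 3) * d) ≡ + 1 * (+ 3 * (a + d) + + 3 * (b + d) - R * (+ 3 * d))
      ring = solve-∀
    R≡3 : + 3 ∣ R - + 3 → R - + 3 ≡ 0ℤ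
    R≡3 (divides t R≡) = trans R≡ (cong (_* + 3) t≡0)
      where
      t≡0 : t ≡ 0ℤ
      t≡0 = pinch d 0ℤ t (a + (b - + d)) (trans sum-d≡ (cong (_* + d) (trans R≡ (sym (ℤ.+-identityˡ (t * + 3))))))
        (subst (0ℤ ≤_) (ring₁ a b (+ d)) (0≤a ⊕ -d≤b ⊕ 0≤d-1))
        (subst (0ℤ ≤_) (ring₂ a b (+ d)) (a≤2d ⊕ b≤d ⊕ 0≤d-1))
        where
        ring₁ : ∀ a b d → a + (b + d) + (d - + 1) ≡ a + (b - d) - (0ℤ - + 3) * d - + 1
        ring₁ = solve-∀
        ring₂ : ∀ a b d → + 2 * d - a + (d - b) + (d - + 1) ≡ (0ℤ + + 3) * d - (a + (b - d)) - + 1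
        ring₂ = solve-∀
    R≢3 : ¬ (R - + 3 ≡ 0ℤ)
    R≢3 R-3≡0 = 1≢3* (x + y + k) (≡-via₂ (- + 1) k bezout R-3≡0 (ring x y k R))
      where
      ring : ∀ x y k R → + 1 - (x + y + k) * + 3 ≡ - + 1 * (x * + 3 + y * + 3 + k * R - + 1) + k * (R - + 3 - 0ℤ)
      ring = solve-∀
  split-exceptional S (relation R equation _) [-3,3] = contradiction a≡0 a≢0
    where
    open Split S
    R≡ : + 3 ∣ R - + 1
    R≡ = 3∣*⇒3∣ (R - + 1) 3∤d (subst (+ 3 ∣_) (ℤ.*-cancelˡ-≡ (+ 3) _ _ (≡-via (+ 1) equation (ring a b R (+ d)))) (∣m∣n⇒∣m-n 3∣b-d 3∣a))
      where
      ring : ∀ a b R d → + 3 * (b - d - a) - + 3 * ((R - + 1) * d) ≡ + 1 * (- + 3 * (a + d) + + 3 * (b + d) - R * (+ 3 * d))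
      ring = solve-∀
    t : ℤ
    t = _∣_.quotient R≡
    b-a≡ : b - a ≡ (+ 1 + t * + 3) * + d
    b-a≡ = ℤ.*-cancelˡ-≡ (+ 3) _ _ (≡-via₂ (+ 1) (+ 3 * + d) equation (_∣_.equality R≡) (ring a b R (+ d) t))
      where
      ring : ∀ a b R d t → + 3 * (b - a) - + 3 * ((+ 1 + t * + 3) * d)
        ≡ + 1 * (- + 3 * (a + d) + + 3 * (b + d) - R * (+ 3 * d)) + + 3 * d * (R - + 1 - t * + 3)
      ring = solve-∀
    t≡0 : t ≡ 0ℤ
    t≡0 = pinch d (+ 1) t (b - a) b-a≡
      (subst (0ℤ ≤_) (ring₁ a b (+ d)) (a-b≤d ⊕ 0≤d-1))
      (subst (0ℤ ≤_) (ring₂ a b (+ d)) (b-a≤d ⊕ pos d ⊕ pos d ⊕ 0≤d-1))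
      where
      ring₁ : ∀ a b d → d - (a - b) + (d - + 1) ≡ b - a - (+ 1 - + 3) * d - + 1
      ring₁ = solve-∀
      ring₂ : ∀ a b d → d - (b - a) + d + d + (d - + 1) ≡ (+ 1 + + 3) * d - (b - a) - + 1
      ring₂ = solve-∀
    a≡0 : a ≡ 0ℤ
    a≡0 = ℤ.≤-antisym (≤-by b≤d (≡-via₂ (+ 1) (+ 3 * + d) b-a≡ t≡0 (ring a b (+ d) t))) 0≤a
      where
      ring : ∀ a b d t → 0ℤ - (a + (d - b)) ≡ + 1 * (b - a - (+ 1 + t * + 3) * d) + + 3 * d * (t - 0ℤ)
      ring = solve-∀
  split-exceptional S (relation R equation _) [-1,1] = contradiction 3∣d (Split.3∤d S)
    where
    open Split S
    3∣d : + 3 ∣ + d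
    3∣d = subst (+ 3 ∣_) (≡-via (- + 1) equation (ring a b R (+ d))) (∣m∣n⇒∣m-n (divides (R * + d) (ring′ R (+ d))) (∣m∣n⇒∣m-n 3∣b-d 3∣a))
      where
      ring : ∀ a b R d → R * (+ 3 * d) - (b - d - a) - d ≡ - + 1 * (- + 1 * (a + d) + + 1 * (b + d) - R * (+ 3 * d))
      ring = solve-∀
      ring′ : ∀ R d → R * (+ 3 * d) ≡ R * d * + 3
      ring′ = solve-∀
  split-exceptional S (relation R equation _) [-2,2] = contradiction 3∣2d (3∤2d (Split.3∤d S))
    where
    open Split S
    3∣2d : + 3 ∣ + 2 * + d
    3∣2d = subst (+ 3 ∣_) (≡-via (- + 1) equation (ring a b R (+ d)))
      (∣m∣n⇒∣m-n (divides (R * + d) (ring′ R (+ d))) (∣n⇒∣m*n (+ 2) (∣m∣n⇒∣m-n 3∣b-d 3∣a)))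
      where
      ring : ∀ a b R d → R * (+ 3 * d) - + 2 * (b - d - a) - + 2 * d ≡ - + 1 * (- + 2 * (a + d) + + 2 * (b + d) - R * (+ 3 * d))
      ring = solve-∀
      ring′ : ∀ R d → R * (+ 3 * d) ≡ R * d * + 3
      ring′ = solve-∀
  split-exceptional S (relation R equation _) [-1,2] = subst (λ a → Tricolourable (quad 0ℤ (+ d) a b)) (sym a≡)
    (a≡2b+d⇒tricolourable d b (+ 2 * u + v) (u + w) (ℕ.≤-trans (ℕ.m≤m+n 22 29) 51≤d) (≡-via₂ (+ 1) (- u) bezout a≡ (ring a b (+ d) u v w)))
    where
    open Split S
    open Coprime₃ coprime
    R≡0 : R ≡ 0ℤ
    R≡0 = pinch d 0ℤ R (+ 2 * b - a + + d) (≡-via (+ 1) equation (ring₀ a b R (+ d)))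
      (subst (0ℤ ≤_) (ring₁ a b (+ d)) (a-b≤d ⊕ -d≤b ⊕ pos d ⊕ 0≤d-1))
      (subst (0ℤ ≤_) (ring₂ a b (+ d)) (b-a≤d ⊕ positive b≤d (λ d-b≡0 → b≢d (sym (≡-by d-b≡0)))))
      where
      ring₀ : ∀ a b R d → + 2 * b - a + d - (0ℤ + R * + 3) * d ≡ + 1 * (- + 1 * (a + d) + + 2 * (b + d) - R * (+ 3 * d))
      ring₀ = solve-∀
      ring₁ : ∀ a b d → d - (a - b) + (b + d) + d + (d - + 1) ≡ + 2 * b - a + d - (0ℤ - + 3) * d - + 1
      ring₁ = solve-∀
      ring₂ : ∀ a b d → d - (b - a) + (d - b - + 1) ≡ (0ℤ + + 3) * d - (+ 2 * b - a + d) - + 1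
      ring₂ = solve-∀
    a≡ : a ≡ + 2 * b + + d
    a≡ = ≡-via₂ (- + 1) (- + 3 * + d) equation R≡0 (ring′ a b R (+ d))
      where
      ring′ : ∀ a b R d → a - (+ 2 * b + d) ≡ - + 1 * (- + 1 * (a + d) + + 2 * (b + d) - R * (+ 3 * d)) + - + 3 * d * (R - 0ℤ)
      ring′ = solve-∀
    ring : ∀ a b d u v w → (+ 2 * u + v) * b + (u + w) * d - + 1 ≡ + 1 * (u * a + v * b + w * d - + 1) + - u * (a - (+ 2 * b + d))
    ring = solve-∀

  doubled-difference⇒tricolourable : Coprime₃ a b (+ d) → + 2 * (a - b) ≡ + 3 * + d → Tricolourable (quad 0ℤ (+ d) a b)
  doubled-difference⇒tricolourable (coprime₃ u v w bezout) gap with toNat (nonneg-cancel 2 (subst (0ℤ ≤_) d≡ (pos d)))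
    where
    d≡ : + d ≡ + 2 * (a - b - + d)
    d≡ = ≡-via (- + 1) gap (ring a b (+ d))
      where
      ring : ∀ a b d → d - + 2 * (a - b - d) ≡ - + 1 * (+ 2 * (a - b) - + 3 * d)
      ring = solve-∀
  ... | e , e≡ = subst₂ (λ d a → Tricolourable (quad 0ℤ d a b)) (sym d≡) (sym a≡)
    (a≡b+3e⇒tricolourable e {{ℕ.>-nonZero (ℕ.<-≤-trans (ℕ.s≤s ℕ.z≤n) 14≤e)}} b (u + v) (+ 3 * u + + 2 * w) 14≤e
      (≡-by (trans (ring₃ a b u v w (+ d) (+ e)) (cong₂ _+_ (cong₂ _+_ (vanish (+ 1) bezout) (vanish (- u) a≡)) (vanish (- w) d≡)))))
    where
    d≡ : + d ≡ + 2 * + e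
    d≡ = ≡-via₂ (- + 1) (+ 2) gap e≡ (ring₁ a b (+ d) (+ e))
      where
      ring₁ : ∀ a b d e → d - + 2 * e ≡ - + 1 * (+ 2 * (a - b) - + 3 * d) + + 2 * (a - b - d - e)
      ring₁ = solve-∀
    a≡ : a ≡ b + + 3 * + e
    a≡ = ≡-via₂ (- + 1) (+ 3) gap e≡ (ring₂ a b (+ d) (+ e))
      where
      ring₂ : ∀ a b d e → a - (b + + 3 * e) ≡ - + 1 * (+ 2 * (a - b) - + 3 * d) + + 3 * (a - b - d - e)
      ring₂ = solve-∀
    14≤e : 14 ℕ.≤ e
    14≤e = ℤ.drop‿+≤+ (ℤ.0≤i-j⇒j≤i (nonneg-cancel 2 (subst (0ℤ ≤_) (≡-via (+ 1) d≡ (ring (+ d) (+ e))) (+≤ 51≤d ⊕ pos 23))))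
      where
      ring : ∀ d e → d - + 51 + + 23 - + 2 * (e - + 14) ≡ + 1 * (d - + 2 * e)
      ring = solve-∀
    ring₃ : ∀ a b u v w d e → (u + v) * b + (+ 3 * u + + 2 * w) * e - + 1 ≡
      + 1 * (u * a + v * b + w * d - + 1) + - u * (a - (b + + 3 * e)) + - w * (d - + 2 * e)
    ring₃ = solve-∀

  lone-difference : Lone d a b → ∀ t → ¬ (b - a ≡ (0ℤ + t * + 3) * + d)
  lone-difference L t b-a≡ = a≢b (sym (≡-by (trans b-a≡ (cong (λ t → (0ℤ + t * + 3) * + d) t≡0))))
    where
    open Lone L
    t≡0 : t ≡ 0ℤ
    t≡0 = pinch d 0ℤ t (b - a) b-a≡
      (subst (0ℤ ≤_) (ring₁ a b (+ d)) (-d≤b ⊕ a≤d ⊕ 0≤d-1))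
      (subst (0ℤ ≤_) (ring₁ b a (+ d)) (-d≤a ⊕ b≤d ⊕ 0≤d-1) ▹ ring₂ a b (+ d))
      where
      infixl 1 _▹_
      _▹_ : ∀ {x y} → 0ℤ ≤ x → x ≡ y → 0ℤ ≤ y
      p ▹ q = subst (0ℤ ≤_) q p
      ring₁ : ∀ a b d → b + d + (d - a) + (d - + 1) ≡ b - a - (0ℤ - + 3) * d - + 1
      ring₁ = solve-∀
      ring₂ : ∀ a b d → a - b - (0ℤ - + 3) * d - + 1 ≡ (0ℤ + + 3) * d - (b - a) - + 1
      ring₂ = solve-∀

  lone-exceptional : ∀ {P Q} → Lone d a b → Relation d a b P Q → Exceptional P Q →
    Tricolourable (quad 0ℤ (+ d) a b) ⊎ (+ 2 * (b - a) ≡ + 3 * + d)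
  lone-exceptional L rel [0,3] = contradiction rel (no-[0,3] 3∤d 3∣b-d -d≤b b≤d b≢d)
    where open Lone L
  lone-exceptional L (relation R equation _) [3,3] = inj₁ (a+b≡-d⇒tricolourable d (ℕ.≤-trans (ℕ.m≤m+n 5 46) 51≤d)
      (trans sum≡ (trans (cong (λ t → (- + 1 + t * + 3) * + d) t≡0) (ℤ.-1*i≡-i (+ d)))) coprime)
    where
    open Lone L
    3∣R : + 3 ∣ R - + 4
    3∣R = 3∣*⇒3∣ (R - + 4) 3∤d (subst (+ 3 ∣_) (ℤ.*-cancelˡ-≡ (+ 3) _ _ (≡-via (+ 1) equation (ring a b R (+ d)))) (∣m∣n⇒∣m+n 3∣a-d 3∣b-d))
      where
      ring : ∀ a b R d → + 3 * (a - d + (b - d)) - + 3 * ((R - + 4) * d) ≡ + 1 * (+ 3 * (a + d) + + 3 * (b + d) - R * (+ 3 * d))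
      ring = solve-∀
    t : ℤ
    t = _∣_.quotient 3∣R + + 1
    sum≡ : a + b ≡ (- + 1 + t * + 3) * + d
    sum≡ = ℤ.*-cancelˡ-≡ (+ 3) _ _ (≡-via₂ (+ 1) (+ 3 * + d) equation (_∣_.equality 3∣R) (ring a b R (+ d) (_∣_.quotient 3∣R)))
      where
      ring : ∀ a b R d t → + 3 * (a + b) - + 3 * ((- + 1 + (t + + 1) * + 3) * d)
        ≡ + 1 * (+ 3 * (a + d) + + 3 * (b + d) - R * (+ 3 * d)) + + 3 * d * (R - + 4 - t * + 3)
      ring = solve-∀
    t≡0 : t ≡ 0ℤ
    t≡0 = pinch d (- + 1) t (a + b) sum≡
      (subst (0ℤ ≤_) (ring₁ a b (+ d)) (-d≤a ⊕ -d≤b ⊕ pos d ⊕ 0≤d-1))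
      (subst (0ℤ ≤_) (ring₂ a b (+ d)) (a≤d ⊕ positive b≤d (λ d-b≡0 → b≢d (sym (≡-by d-b≡0)))))
      where
      ring₁ : ∀ a b d → a + d + (b + d) + d + (d - + 1) ≡ a + b - (- + 1 - + 3) * d - + 1
      ring₁ = solve-∀
      ring₂ : ∀ a b d → d - a + (d - b - + 1) ≡ (- + 1 + + 3) * d - (a + b) - + 1
      ring₂ = solve-∀
  lone-exceptional L (relation R equation _) [-3,3] = contradiction b-a≡ (lone-difference L (_∣_.quotient 3∣R))
    where
    open Lone L
    3∣R : + 3 ∣ R
    3∣R = 3∣*⇒3∣ R 3∤d (subst (+ 3 ∣_) (ℤ.*-cancelˡ-≡ (+ 3) _ _ (≡-via (+ 1) equation (ring a b R (+ d)))) (∣m∣n⇒∣m-n 3∣b-d 3∣a-d))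
      where
      ring : ∀ a b R d → + 3 * (b - d - (a - d)) - + 3 * (R * d) ≡ + 1 * (- + 3 * (a + d) + + 3 * (b + d) - R * (+ 3 * d))
      ring = solve-∀
    b-a≡ : b - a ≡ (0ℤ + _∣_.quotient 3∣R * + 3) * + d
    b-a≡ = ℤ.*-cancelˡ-≡ (+ 3) _ _ (≡-via₂ (+ 1) (+ 3 * + d) equation (_∣_.equality 3∣R) (ring a b R (+ d) (_∣_.quotient 3∣R)))
      where
      ring : ∀ a b R d t → + 3 * (b - a) - + 3 * ((0ℤ + t * + 3) * d)
        ≡ + 1 * (- + 3 * (a + d) + + 3 * (b + d) - R * (+ 3 * d)) + + 3 * d * (R - t * + 3)
      ring = solve-∀
  lone-exceptional L (relation R equation _) [-1,1] = contradiction (≡-via (+ 1) equation (ring a b R (+ d))) (lone-difference L R)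
    where
    ring : ∀ a b R d → b - a - (0ℤ + R * + 3) * d ≡ + 1 * (- + 1 * (a + d) + + 1 * (b + d) - R * (+ 3 * d))
    ring = solve-∀
  lone-exceptional L (relation R equation _) [-1,2] = contradiction 3∣2d (3∤2d 3∤d)
    where
    open Lone L
    3∣2d : + 3 ∣ + 2 * + d
    3∣2d = subst (+ 3 ∣_) (≡-via (- + 1) equation (ring a b R (+ d)))
      (∣m∣n⇒∣m-n (divides (R * + d) (ring′ R (+ d))) (∣m∣n⇒∣m-n (∣n⇒∣m*n (+ 2) 3∣b-d) 3∣a-d))
      where
      ring : ∀ a b R d → R * (+ 3 * d) - (+ 2 * (b - d) - (a - d)) - + 2 * d ≡ - + 1 * (- + 1 * (a + d) + + 2 * (b + d) - R * (+ 3 * d))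
      ring = solve-∀
      ring′ : ∀ R d → R * (+ 3 * d) ≡ R * d * + 3
      ring′ = solve-∀
  lone-exceptional L (relation R equation _) [-2,2] with trichotomy R
  ... | inj₁ R≡0 = contradiction (≡-by (ℤ.*-cancelˡ-≡ (+ 2) _ _ (≡-via₂ (+ 1) (+ 3 * + d) equation R≡0 (ring a b R (+ d))))) (λ b≡a → Lone.a≢b L (sym b≡a))
    where
    ring : ∀ a b R d → + 2 * (b - a) - + 2 * 0ℤ ≡ + 1 * (- + 2 * (a + d) + + 2 * (b + d) - R * (+ 3 * d)) + + 3 * d * (R - 0ℤ)
    ring = solve-∀
  ... | inj₂ (inj₁ 1≤R) with trichotomy (R - + 1)
  ... | inj₁ R≡1 = inj₂ (≡-via₂ (+ 1) (+ 3 * + d) equation R≡1 (ring a b R (+ d)))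
    where
    ring : ∀ a b R d → + 2 * (b - a) - + 3 * d ≡ + 1 * (- + 2 * (a + d) + + 2 * (b + d) - R * (+ 3 * d)) + + 3 * d * (R - + 1 - 0ℤ)
    ring = solve-∀
  ... | inj₂ (inj₁ 2≤R) = contradiction (b≤d ⊕ -d≤a ⊕ (b≤d ⊕ -d≤a) ⊕ 2≤R ⊗ pos d ⊗ pos 3 ⊕ 0≤d-1 ⊕ pos d)
      (negative-absurd (≡-via (- + 1) equation (ring a b R (+ d))))
    where
    open Lone L
    ring : ∀ a b R d → d - b + (a + d) + (d - b + (a + d)) + (R - + 1 - + 1) * d * + 3 + (d - + 1) + d - - + 1
      ≡ - + 1 * (- + 2 * (a + d) + + 2 * (b + d) - R * (+ 3 * d))
    ring = solve-∀
  ... | inj₂ (inj₂ R<1) = contradiction (1≤R ⊕ R<1) (negative-absurd (ring R))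
    where
    ring : ∀ R → R - + 1 + (- + 1 - (R - + 1)) ≡ - + 1
    ring = solve-∀
  lone-exceptional L (relation R equation _) [-2,2] | inj₂ (inj₂ R≤-1) with trichotomy (R + + 1)
  ... | inj₁ R≡-1 = inj₁ (doubled-difference⇒tricolourable (Lone.coprime L) (≡-via₂ (- + 1) (- + 3 * + d) equation R≡-1 (ring a b R (+ d))))
    where
    ring : ∀ a b R d → + 2 * (a - b) - + 3 * d ≡ - + 1 * (- + 2 * (a + d) + + 2 * (b + d) - R * (+ 3 * d)) + - + 3 * d * (R + + 1 - 0ℤ)
    ring = solve-∀
  ... | inj₂ (inj₁ 0≤R) = contradiction (R≤-1 ⊕ 0≤R) (negative-absurd (ring R))
    where
    ring : ∀ R → - + 1 - R + (R + + 1 - + 1) ≡ - + 1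
    ring = solve-∀
  ... | inj₂ (inj₂ R≤-2) = contradiction (a≤d ⊕ -d≤b ⊕ (a≤d ⊕ -d≤b) ⊕ R≤-2 ⊗ pos d ⊗ pos 3 ⊕ 0≤d-1 ⊕ pos d)
      (negative-absurd (≡-via (+ 1) equation (ring a b R (+ d))))
    where
    open Lone L
    ring : ∀ a b R d → d - a + (b + d) + (d - a + (b + d)) + (- + 1 - (R + + 1)) * d * + 3 + (d - + 1) + d - - + 1
      ≡ + 1 * (- + 2 * (a + d) + + 2 * (b + d) - R * (+ 3 * d))
    ring = solve-∀

private
  zero-relation : ∀ {d a b} .{{_ : NonZero d}} → ¬ Relation d a b 0ℤ 0ℤ
  zero-relation {d} {a} {b} (relation R equation (coprime₃ u v w bezout)) = contradiction bezout 0≢1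
    where
    R≡0 : R ≡ 0ℤ
    R≡0 = ℤ.*-cancelʳ-≡ R 0ℤ (+ d) (ℤ.*-cancelˡ-≡ (+ 3) (R * + d) (0ℤ * + d) (≡-via (- + 1) equation (ring a b R (+ d))))
      where
      ring : ∀ a b R d → + 3 * (R * d) - + 3 * (0ℤ * d) ≡ - + 1 * (0ℤ * (a + d) + 0ℤ * (b + d) - R * (+ 3 * d))
      ring = solve-∀
    0≢1 : u * 0ℤ + v * 0ℤ + w * R ≢ + 1
    0≢1 eq with trans (sym eq) (≡-via {y = 0ℤ} w R≡0 (ring u v w R))
      where
      ring : ∀ u v w R → u * 0ℤ + v * 0ℤ + w * R - 0ℤ ≡ w * (R - 0ℤ)
      ring = solve-∀
    ... | ()

  Outcome : ℕ → ℤ → ℤ → Set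
  Outcome d a b = Sandwich d a b ⊎ (∃[ P ] ∃[ Q ] Relation d a b P Q × Exceptional P Q)

  outcome : ∀ {d a b P Q} → Relation d a b P Q → Sandwich d a b ⊎ Exceptional P Q → Outcome d a b
  outcome rel (inj₁ sandwich) = inj₁ sandwich
  outcome {P = P} {Q} rel (inj₂ exceptional) = inj₂ (P , Q , rel , exceptional)

  short⇒exceptional : ∀ {d a b} → 51 ℕ.≤ d → ¬ (+ 3 ∣ a + + d) → ¬ (+ 3 ∣ b + + d) → Coprime₃ a b (+ d) →
    ∀ P Q → Relation d a b P Q → ∣ P ∣ ℕ.≤ ∣ Q ∣ → ∣ Q ∣ ℕ.* ∣ Q ∣ ℕ.≤ 3 ℕ.* d → Outcome d a b
  short⇒exceptional {d} {a} {b} 51≤d 3∤A 3∤B coprime P (+ 0) rel P≤Q _ =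
    contradiction (subst (λ P → Relation d a b P 0ℤ) (ℤ.∣i∣≡0⇒i≡0 {P} (ℕ.n≤0⇒n≡0 P≤Q)) rel)
      (zero-relation {{ℕ.>-nonZero (ℕ.<-≤-trans (ℕ.s≤s ℕ.z≤n) 51≤d)}})
  short⇒exceptional {d} {a} {b} 51≤d 3∤A 3∤B coprime P +[1+ q ] rel P≤Q Q²≤3d = outcome rel
    (Lattice.sandwich-or-exceptional d 51≤d {a} {b} 3∤A 3∤B (coprime-shift {a} {b} {+ d} 3∤A coprime) P (suc q) rel Q²≤3d P≤Q)
  short⇒exceptional {d} {a} {b} 51≤d 3∤A 3∤B coprime P -[1+ q ] rel P≤Q Q²≤3d = outcome (relation-neg rel)
    (Lattice.sandwich-or-exceptional d 51≤d {a} {b} 3∤A 3∤B (coprime-shift {a} {b} {+ d} 3∤A coprime) (- P) (suc q) (relation-neg rel) Q²≤3d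
      (ℕ.≤-trans (ℕ.≤-reflexive (ℤ.∣-i∣≡∣i∣ P)) P≤Q))

  unit-same : ∀ {a d} → ¬ (+ 3 ∣ d) → + 3 ∣ a - d → ¬ (+ 3 ∣ a + d)
  unit-same {a} {d} 3∤d 3∣a-d 3∣a+d = 3∤2d 3∤d (subst (+ 3 ∣_) (ring a d) (∣m∣n⇒∣m-n 3∣a+d 3∣a-d))
    where
    ring : ∀ a d → a + d - (a - d) ≡ + 2 * d
    ring = solve-∀

  unit-zero : ∀ {a d} → ¬ (+ 3 ∣ d) → + 3 ∣ a → ¬ (+ 3 ∣ a + d)
  unit-zero 3∤d 3∣a 3∣a+d = 3∤d (∣m+n∣m⇒∣n 3∣a+d 3∣a)

  split-oriented : ∀ {d a b} → 51 ℕ.≤ d → Split d a b → ∀ P Q → Relation d a b P Q →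
    ∣ P ∣ ℕ.≤ ∣ Q ∣ → ∣ Q ∣ ℕ.* ∣ Q ∣ ℕ.≤ 3 ℕ.* d → Tricolourable (quad 0ℤ (+ d) a b)
  split-oriented {d} {a} {b} 51≤d S P Q rel P≤Q Q²≤3d =
    coloured (short⇒exceptional {d} {a} {b} 51≤d (unit-zero 3∤d 3∣a) (unit-same {b} 3∤d 3∣b-d) coprime P Q rel P≤Q Q²≤3d)
    where
    open Split S
    coloured : Outcome d a b → Tricolourable (quad 0ℤ (+ d) a b)
    coloured (inj₁ sandwich) = sandwich⇒tricolourable d {{ℕ.>-nonZero (ℕ.<-≤-trans (ℕ.s≤s ℕ.z≤n) 51≤d)}} sandwich
    coloured (inj₂ (P , Q , rel , exceptional)) = split-exceptional 51≤d S rel exceptional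

  lone-oriented : ∀ {d a b} → 51 ℕ.≤ d → Lone d a b → ∀ P Q → Relation d a b P Q →
    ∣ P ∣ ℕ.≤ ∣ Q ∣ → ∣ Q ∣ ℕ.* ∣ Q ∣ ℕ.≤ 3 ℕ.* d → Tricolourable (quad 0ℤ (+ d) a b)
  lone-oriented {d} {a} {b} 51≤d L P Q rel P≤Q Q²≤3d =
    coloured (short⇒exceptional {d} {a} {b} 51≤d (unit-same {a} 3∤d 3∣a-d) (unit-same {b} 3∤d 3∣b-d) coprime P Q rel P≤Q Q²≤3d)
    where
    open Lone L
    resolve : Tricolourable (quad 0ℤ (+ d) a b) ⊎ (+ 2 * (b - a) ≡ + 3 * + d) → Tricolourable (quad 0ℤ (+ d) a b)
    resolve (inj₁ done) = done
    resolve (inj₂ gap) = tricolourable-swap (doubled-difference⇒tricolourable 51≤d (Lone.coprime (lone-swap L)) gap)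
    coloured : Outcome d a b → Tricolourable (quad 0ℤ (+ d) a b)
    coloured (inj₁ sandwich) = sandwich⇒tricolourable d {{ℕ.>-nonZero (ℕ.<-≤-trans (ℕ.s≤s ℕ.z≤n) 51≤d)}} sandwich
    coloured (inj₂ (P , Q , rel , exceptional)) = resolve (lone-exceptional 51≤d L rel exceptional)

split-large : ∀ {d a b} → 51 ℕ.≤ d → Split d a b → Tricolourable (quad 0ℤ (+ d) a b)
split-large {d} {a} {b} 51≤d S = orient (shortRelation d {{ℕ.>-nonZero (ℕ.<-≤-trans (ℕ.s≤s ℕ.z≤n) 51≤d)}} a b)
  where
  orient : ShortRelation d a b → Tricolourable (quad 0ℤ (+ d) a b)
  orient record { P = P ; Q = Q ; rel = rel ; ∣P∣² = ∣P∣² ; ∣Q∣² = ∣Q∣² } with ℕ.≤-total ∣ P ∣ ∣ Q ∣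
  ... | inj₁ P≤Q = split-oriented 51≤d S P Q rel P≤Q ∣Q∣²
  ... | inj₂ Q≤P = tricolourable-reflect (split-oriented 51≤d (split-reflect S) Q P (relation-reflect rel) Q≤P ∣P∣²)

lone-large : ∀ {d a b} → 51 ℕ.≤ d → Lone d a b → Tricolourable (quad 0ℤ (+ d) a b)
lone-large {d} {a} {b} 51≤d L = orient (shortRelation d {{ℕ.>-nonZero (ℕ.<-≤-trans (ℕ.s≤s ℕ.z≤n) 51≤d)}} a b)
  where
  orient : ShortRelation d a b → Tricolourable (quad 0ℤ (+ d) a b)
  orient record { P = P ; Q = Q ; rel = rel ; ∣P∣² = ∣P∣² ; ∣Q∣² = ∣Q∣² } with ℕ.≤-total ∣ P ∣ ∣ Q ∣
  ... | inj₁ P≤Q = lone-oriented 51≤d L P Q rel P≤Q ∣Q∣²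
  ... | inj₂ Q≤P = tricolourable-swap (lone-oriented 51≤d (lone-swap L) Q P (relation-swap rel) Q≤P ∣P∣²)

private
  split-∧ : ∀ {x y} → T (x ∧ y) → T x × T y
  split-∧ = Equivalence.to T-∧

  split-∨ : ∀ {x y} → T (x ∨ y) → T x ⊎ T y
  split-∨ = Equivalence.to T-∨

anyBelow : ℕ → (ℕ → Bool) → Bool
anyBelow zero    f = false
anyBelow (suc n) f = f n ∨ anyBelow n f

anyBelow⇒∃ : ∀ n f → T (anyBelow n f) → ∃[ k ] T (f k)
anyBelow⇒∃ (suc n) f t with split-∨ {f n} t
... | inj₁ fn = n , fn
... | inj₂ rest = anyBelow⇒∃ n f rest

allBelow : ℕ → (ℕ → Bool) → Bool
allBelow zero    f = true
allBelow (suc n) f = f n ∧ allBelow n f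

allBelow⇒∀ : ∀ n f → T (allBelow n f) → ∀ {k} → k ℕ.< n → T (f k)
allBelow⇒∀ (suc n) f t {k} k<1+n with split-∧ {f n} t | k ℕ.≟ n
... | fn , _    | yes refl = fn
... | _  , rest | no k≢n = allBelow⇒∀ n f rest (ℕ.≤∧≢⇒< (ℕ.s≤s⁻¹ k<1+n) k≢n)

allBelow³⇒∀ : ∀ l m n (f : ℕ → ℕ → ℕ → Bool) → T (allBelow l λ i → allBelow m λ j → allBelow n (f i j)) →
  ∀ {i j k} → i ℕ.< l → j ℕ.< m → k ℕ.< n → T (f i j k)
allBelow³⇒∀ l m n f t {i} {j} i<l j<m = allBelow⇒∀ n (f i j)
  (allBelow⇒∀ m (λ j → allBelow n (f i j)) (allBelow⇒∀ l (λ i → allBelow m λ j → allBelow n (f i j)) t i<l) j<m)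

multiplierTest : (N : ℕ) .{{_ : NonZero N}} (d A B k : ℕ) → Bool
multiplierTest N d A B k = not (k ℕ.% 3 ℕ.≡ᵇ 0) ∧ (N ℕ.+ k ℕ.* B ℕ.% N ℕ.≤ᵇ k ℕ.* A ℕ.% N ℕ.+ d)

sandwichTest : (d : ℕ) .{{_ : NonZero d}} → ℤ → ℤ → Bool
sandwichTest d@(suc _) a b = go (3 ℕ.* d) ((a + + d) %ℕ (3 ℕ.* d)) ((b + + d) %ℕ (3 ℕ.* d))
  where
  go : (N A B : ℕ) .{{_ : NonZero N}} → Bool
  go N A B = anyBelow N (multiplierTest N d A B)

sandwichTest⇒sandwich : ∀ d .{{_ : NonZero d}} {a b} → T (sandwichTest d a b) → Sandwich d a b
sandwichTest⇒sandwich d@(suc _) {a} {b} t = result (anyBelow⇒∃ N (multiplierTest N d A B) t)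
  where
  N A B : ℕ
  N = 3 ℕ.* d
  A = (a + + d) %ℕ N
  B = (b + + d) %ℕ N

  lift : ∀ c k m → + k * c ≡ + (k ℕ.* (c %ℕ N) ℕ.% N) - m * + N + (+ (k ℕ.* (c %ℕ N) ℕ./ N) + + k * (c /ℕ N) + m) * (+ 3 * + d)
  lift c k m = begin
    + k * c                                           ≡⟨ cong (+ k *_) (a≡a%ℕn+[a/ℕn]*n c N) ⟩
    + k * (+ r + c /ℕ N * + N)                        ≡⟨ ring₁ (+ k) (+ r) (c /ℕ N) (+ N) ⟩
    + k * + r + + k * (c /ℕ N) * + N                  ≡⟨ cong (_+ + k * (c /ℕ N) * + N) kr≡ ⟩
    + (k ℕ.* r ℕ.% N) + + (k ℕ.* r ℕ./ N) * + N + + k * (c /ℕ N) * + N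
      ≡⟨ ring₂ (+ (k ℕ.* r ℕ.% N)) (+ (k ℕ.* r ℕ./ N)) (+ k * (c /ℕ N)) (+ N) m ⟩
    + (k ℕ.* r ℕ.% N) - m * + N + (+ (k ℕ.* r ℕ./ N) + + k * (c /ℕ N) + m) * + N
      ≡⟨ cong (λ n → + (k ℕ.* r ℕ.% N) - m * + N + (+ (k ℕ.* r ℕ./ N) + + k * (c /ℕ N) + m) * n) (ℤ.pos-* 3 d) ⟩
    + (k ℕ.* r ℕ.% N) - m * + N + (+ (k ℕ.* r ℕ./ N) + + k * (c /ℕ N) + m) * (+ 3 * + d) ∎
    where
    open ≡-Reasoning
    r = c %ℕ N
    kr≡ : + k * + r ≡ + (k ℕ.* r ℕ.% N) + + (k ℕ.* r ℕ./ N) * + N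
    kr≡ = trans (sym (ℤ.pos-* k r)) (trans (cong (+_) (ℕ.m≡m%n+[m/n]*n (k ℕ.* r) N))
      (cong (λ z → + (k ℕ.* r ℕ.% N) + z) (ℤ.pos-* (k ℕ.* r ℕ./ N) N)))
    ring₁ : ∀ k r q N → k * (r + q * N) ≡ k * r + k * q * N
    ring₁ = solve-∀
    ring₂ : ∀ s x y N m → s + x * N + y * N ≡ s - m * N + (x + y + m) * N
    ring₂ = solve-∀

  result : ∃[ k ] T (multiplierTest N d A B k) → Sandwich d a b
  result (k , test) with split-∧ {not (k ℕ.% 3 ℕ.≡ᵇ 0)} test
  ... | unit , close = record
    { k = + k ; p = + (k ℕ.* A ℕ.% N) - + 1 * + N ; q = + (k ℕ.* B ℕ.% N) - 0ℤ * + N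
    ; u = + (k ℕ.* A ℕ./ N) + + k * ((a + + d) /ℕ N) + + 1
    ; v = + (k ℕ.* B ℕ./ N) + + k * ((b + + d) /ℕ N) + 0ℤ
    ; 3∤k = λ 3∣k → not-zero (ℕ.n∣m⇒m%n≡0 k 3 (∣⇒∣ᵤ 3∣k)) unit
    ; lift-a = lift (a + + d) k (+ 1)
    ; lift-b = lift (b + + d) k 0ℤ
    ; p≤0 = ≤-by (+≤ (ℕ.<⇒≤ (ℕ.m%n<n (k ℕ.* A) N))) (ring₁ (+ (k ℕ.* A ℕ.% N)) (+ N))
    ; 0≤q = ≤-by (pos (k ℕ.* B ℕ.% N)) (ring₂ (+ (k ℕ.* B ℕ.% N)) (+ N))
    ; q≤p+d = ≤-by (+≤ {N ℕ.+ k ℕ.* B ℕ.% N} {k ℕ.* A ℕ.% N ℕ.+ d} (ℕ.≤ᵇ⇒≤ _ _ close)) (ring₃ (+ (k ℕ.* A ℕ.% N)) (+ (k ℕ.* B ℕ.% N)) (+ N) (+ d))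
    }
    where
    not-zero : ∀ {r} → r ≡ 0 → ¬ T (not (r ℕ.≡ᵇ 0))
    not-zero refl ()
    ring₁ : ∀ r N → 0ℤ ≡ r - + 1 * N + (N - r)
    ring₁ = solve-∀
    ring₂ : ∀ r N → r - 0ℤ * N ≡ 0ℤ + r
    ring₂ = solve-∀
    ring₃ : ∀ r s N d → r - + 1 * N + d ≡ s - 0ℤ * N + (r + d - (N + s))
    ring₃ = solve-∀

pairTest : Quad → Vec (Fin 4) 4 → Bool
pairTest s (i ∷ j ∷ k ∷ l ∷ []) with s j - s i
... | +[1+ d ] = sandwichTest (suc d) (s k - s i) (s l - s i)
... | _        = false

pairTest⇒tricolourable : ∀ s σ → T (pairTest s σ) → Tricolourable s
pairTest⇒tricolourable s (i ∷ j ∷ k ∷ l ∷ []) t with s j - s i in eq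
... | +[1+ d ] = tricolourable-pull {s} {quad 0ℤ (+ suc d) (s k - s i) (s l - s i)} (+ 1) (- s i)
  (λ where 0F → i; 1F → j; 2F → k; 3F → l)
  (λ where
    0F → ring₁ (s i)
    1F → trans (sym eq) (ring₂ (s i) (s j))
    2F → ring₂ (s i) (s k)
    3F → ring₂ (s i) (s l))
  (sandwich⇒tricolourable (suc d) (sandwichTest⇒sandwich (suc d) t))
  where
  ring₁ : ∀ x → 0ℤ ≡ + 1 * x + - x
  ring₁ = solve-∀
  ring₂ : ∀ x y → y - x ≡ + 1 * y + - x
  ring₂ = solve-∀

anyPair : Quad → List (Vec (Fin 4) 4) → Bool
anyPair s [] = false
anyPair s (σ ∷ σs) = pairTest s σ ∨ anyPair s σs

anyPair⇒tricolourable : ∀ s σs → T (anyPair s σs) → Tricolourable s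
anyPair⇒tricolourable s (σ ∷ σs) t with split-∨ {pairTest s σ} t
... | inj₁ t′ = pairTest⇒tricolourable s σ t′
... | inj₂ t′ = anyPair⇒tricolourable s σs t′

pairings : List (Vec (Fin 4) 4)
pairings =
  (0F ∷ 1F ∷ 2F ∷ 3F ∷ []) ∷ (0F ∷ 2F ∷ 1F ∷ 3F ∷ []) ∷ (2F ∷ 0F ∷ 1F ∷ 3F ∷ []) ∷ (0F ∷ 3F ∷ 1F ∷ 2F ∷ []) ∷
  (3F ∷ 0F ∷ 1F ∷ 2F ∷ []) ∷ (1F ∷ 2F ∷ 0F ∷ 3F ∷ []) ∷ (2F ∷ 1F ∷ 0F ∷ 3F ∷ []) ∷ (1F ∷ 3F ∷ 0F ∷ 2F ∷ []) ∷
  (3F ∷ 1F ∷ 0F ∷ 2F ∷ []) ∷ (2F ∷ 3F ∷ 0F ∷ 1F ∷ []) ∷ (3F ∷ 2F ∷ 0F ∷ 1F ∷ []) ∷ []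

sporadicTest : ℕ → ℤ → ℤ → Bool
sporadicTest d a b = ⌊ a ℤ.≟ - + 6 * b ⌋ ∧ ⌊ + d ℤ.≟ - + 8 * b ⌋

-- The cell (t , s) stands for a = 3(t + 1) and b = d - 3(s + 1); in loneTest, for a = d - 3(t + 1) and b = d - 3(s + 1).
splitTest : (d t s : ℕ) → Bool
splitTest d t s = go (+ (3 ℕ.* suc t)) (+ d - + (3 ℕ.* suc s))
  where
  go : ℤ → ℤ → Bool
  go a b = anyPair (quad 0ℤ (+ d) a b) pairings ∨ sporadicTest d a b ∨ sporadicTest d (+ d - b) (+ d - a)

loneTest : (d t s : ℕ) → Bool
loneTest d t s = go (+ d - + (3 ℕ.* suc t)) (+ d - + (3 ℕ.* suc s))
  where
  go : ℤ → ℤ → Bool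
  go a b = anyPair (quad 0ℤ (+ d) a b) pairings ∨ (⌊ a + b ℤ.≟ - + d ⌋ ∧ (5 ℕ.≤ᵇ d))

splitGuard loneGuard : (d t s : ℕ) → Bool
splitGuard d t s = not (d ℕ.% 3 ℕ.≡ᵇ 0) ∧ (3 ℕ.* (suc t ℕ.+ suc s) ℕ.≤ᵇ 2 ℕ.* d)
loneGuard  d t s = not (d ℕ.% 3 ℕ.≡ᵇ 0) ∧ (t ℕ.<ᵇ s) ∧ (3 ℕ.* suc s ℕ.≤ᵇ 2 ℕ.* d)

_⇒_ : Bool → Bool → Bool
true  ⇒ y = y
false ⇒ _ = true

modus-ponens : ∀ {x y} → T (x ⇒ y) → T x → T y
modus-ponens {true} y _ = y

sporadicTest⇒tricolourable : ∀ {d a b} .{{_ : NonZero d}} → Coprime₃ a b (+ d) → T (sporadicTest d a b) → Tricolourable (quad 0ℤ (+ d) a b)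
sporadicTest⇒tricolourable {d} {a} {b} (coprime₃ u v w bezout) t with split-∧ {⌊ a ℤ.≟ - + 6 * b ⌋} t
... | a-test , d-test = go b (toWitness a-test) (toWitness d-test) unit
  where
  unit : b ∣ + 1
  unit = divides (v - + 6 * u - + 8 * w) (≡-by (trans (ring u v w a b (+ d))
    (cong₂ _+_ (cong₂ _+_ (vanish (- + 1) bezout) (vanish u (toWitness a-test))) (vanish w (toWitness d-test)))))
    where
    ring : ∀ u v w a b d → + 1 - (v - + 6 * u - + 8 * w) * b ≡
      - + 1 * (u * a + v * b + w * d - + 1) + u * (a - - + 6 * b) + w * (d - - + 8 * b)
    ring = solve-∀
  go : ∀ {d a} b .{{_ : NonZero d}} → a ≡ - + 6 * b → + d ≡ - + 8 * b → b ∣ + 1 → Tricolourable (quad 0ℤ (+ d) a b)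
  go -[1+ 0 ] refl refl _ = sporadic-tricolourable
  go (+ 0) refl refl _ = contradiction refl (ℕ.≢-nonZero⁻¹ 0)
  go +[1+ _ ] refl () _
  go -[1+ suc n ] refl _ b∣1 with ℕ.∣1⇒≡1 (∣⇒∣ᵤ b∣1)
  ... | ()

splitTest⇒tricolourable : ∀ {d a b} .{{_ : NonZero d}} t s → a ≡ + (3 ℕ.* suc t) → b ≡ + d - + (3 ℕ.* suc s) →
  Split d a b → T (splitTest d t s) → Tricolourable (quad 0ℤ (+ d) a b)
splitTest⇒tricolourable {d} {a} {b} t s refl refl S test with split-∨ {anyPair (quad 0ℤ (+ d) a b) pairings} test
... | inj₁ pairs = anyPair⇒tricolourable (quad 0ℤ (+ d) a b) pairings pairs
... | inj₂ special with split-∨ {sporadicTest d a b} special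
... | inj₁ direct = sporadicTest⇒tricolourable (Split.coprime S) direct
... | inj₂ mirror = tricolourable-reflect (sporadicTest⇒tricolourable (Split.coprime (split-reflect S)) mirror)

loneTest⇒tricolourable : ∀ {d a b} .{{_ : NonZero d}} t s → a ≡ + d - + (3 ℕ.* suc t) → b ≡ + d - + (3 ℕ.* suc s) →
  Lone d a b → T (loneTest d t s) → Tricolourable (quad 0ℤ (+ d) a b)
loneTest⇒tricolourable {d} {a} {b} t s refl refl L test with split-∨ {anyPair (quad 0ℤ (+ d) a b) pairings} test
... | inj₁ pairs = anyPair⇒tricolourable (quad 0ℤ (+ d) a b) pairings pairs
... | inj₂ zero-sum with split-∧ {⌊ a + b ℤ.≟ - + d ⌋} zero-sum
... | sum , 5≤d = a+b≡-d⇒tricolourable d (ℕ.≤ᵇ⇒≤ 5 d 5≤d) (toWitness sum) (Lone.coprime L)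

private
  positive-multiple : ∀ {x} → + 3 ∣ x → 0ℤ ≤ x → x ≢ 0ℤ → ∃[ t ] x ≡ + (3 ℕ.* suc t)
  positive-multiple (divides (+ 0) eq) _ x≢0 = contradiction eq x≢0
  positive-multiple (divides +[1+ t ] eq) _ _ = t , trans eq (trans (ℤ.*-comm +[1+ t ] (+ 3)) (sym (ℤ.pos-* 3 (suc t))))
  positive-multiple (divides -[1+ t ] refl) ()

  not-multiple : ∀ {d} → ¬ (+ 3 ∣ + d) → T (not (d ℕ.% 3 ℕ.≡ᵇ 0))
  not-multiple {d} 3∤d with d ℕ.% 3 in eq
  ... | 0 = 3∤d (∣ᵤ⇒∣ (ℕ.m%n≡0⇒n∣m d 3 eq))
  ... | suc _ = tt

  to-≤ : ∀ {m d} → 0ℤ ≤ + 2 * + d - + m → m ℕ.≤ 2 ℕ.* d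
  to-≤ {m} {d} 0≤ = ℤ.drop‿+≤+ (ℤ.0≤i-j⇒j≤i (subst (λ z → 0ℤ ≤ z - + m) (sym (ℤ.pos-* 2 d)) 0≤))

  index< : ∀ {d m} → d ℕ.≤ 50 → 3 ℕ.* suc m ℕ.≤ 2 ℕ.* d → m ℕ.< 34
  index< {d} {m} d≤50 3m≤2d = ℕ.*-cancelˡ-< 3 m 34 (ℕ.<-≤-trans (ℕ.*-monoʳ-< 3 (ℕ.n<1+n m))
    (ℕ.≤-trans 3m≤2d (ℕ.≤-trans (ℕ.*-monoʳ-≤ 2 d≤50) (ℕ.m≤m+n 100 2))))

  below-d : ∀ b d m → d - b ≡ m → b ≡ d - m
  below-d b d m eq = ≡-via (- + 1) eq (ring b d m)
    where
    ring : ∀ b d m → b - (d - m) ≡ - + 1 * (d - b - m)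
    ring = solve-∀

  3∣-flip : ∀ b d → + 3 ∣ b - d → + 3 ∣ d - b
  3∣-flip b d (divides q eq) = divides (- q) (≡-via (- + 1) eq (ring b d q))
    where
    ring : ∀ b d q → d - b - - q * + 3 ≡ - + 1 * (b - d - q * + 3)
    ring = solve-∀

splits-checked : ∀ {d t s} → d ℕ.< 51 → t ℕ.< 34 → s ℕ.< 34 → T (splitGuard d t s ⇒ splitTest d t s)
splits-checked = allBelow³⇒∀ 51 34 34 (λ d t s → splitGuard d t s ⇒ splitTest d t s) tt

lones-checked : ∀ {d t s} → d ℕ.< 51 → t ℕ.< 34 → s ℕ.< 34 → T (loneGuard d t s ⇒ loneTest d t s)
lones-checked = allBelow³⇒∀ 51 34 34 (λ d t s → loneGuard d t s ⇒ loneTest d t s) tt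

split-small : ∀ {d a b} .{{_ : NonZero d}} → d ℕ.≤ 50 → Split d a b → Tricolourable (quad 0ℤ (+ d) a b)
split-small {d} {a} {b} d≤50 S
  with positive-multiple 3∣a 0≤a a≢0 | positive-multiple (3∣-flip b (+ d) 3∣b-d) b≤d (λ d-b≡0 → b≢d (sym (≡-by d-b≡0)))
  where open Split S
... | t , a≡ | s , d-b≡ = splitTest⇒tricolourable t s a≡ (below-d b (+ d) (+ (3 ℕ.* suc s)) d-b≡) S
  (modus-ponens {splitGuard d t s}
    (splits-checked (ℕ.s≤s d≤50)
      (index< d≤50 (ℕ.≤-trans (ℕ.*-monoʳ-≤ 3 (ℕ.m≤m+n (suc t) (suc s))) sum≤))
      (index< d≤50 (ℕ.≤-trans (ℕ.*-monoʳ-≤ 3 (ℕ.m≤n+m (suc s) (suc t))) sum≤)))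
    (Equivalence.from T-∧ (not-multiple {d} 3∤d , ℕ.≤⇒≤ᵇ sum≤)))
  where
  open Split S
  sum≤ : 3 ℕ.* (suc t ℕ.+ suc s) ℕ.≤ 2 ℕ.* d
  sum≤ = to-≤ {d = d} (subst (0ℤ ≤_) (≡-by (trans (ring a b (+ d) (+ (3 ℕ.* suc t)) (+ (3 ℕ.* suc s)) (+ (3 ℕ.* (suc t ℕ.+ suc s))))
    (cong₂ _+_ (cong₂ _+_ (vanish (- + 1) a≡) (vanish (- + 1) d-b≡)) (vanish (+ 1) (cong (+_) (ℕ.*-distribˡ-+ 3 (suc t) (suc s))))))) a-b≤d)
    where
    ring : ∀ a b d t s m → d - (a - b) - (+ 2 * d - m) ≡ - + 1 * (a - t) + - + 1 * (d - b - s) + + 1 * (m - (t + s))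
    ring = solve-∀

lone-small : ∀ {d a b} .{{_ : NonZero d}} → d ℕ.≤ 50 → Lone d a b → Tricolourable (quad 0ℤ (+ d) a b)
lone-small {d} {a} {b} d≤50 L
  with positive-multiple (3∣-flip a (+ d) 3∣a-d) a≤d (λ d-a≡0 → a≢d (sym (≡-by d-a≡0)))
     | positive-multiple (3∣-flip b (+ d) 3∣b-d) b≤d (λ d-b≡0 → b≢d (sym (≡-by d-b≡0)))
  where open Lone L
... | t , d-a≡ | s , d-b≡ = order (ℕ.<-cmp t s)
  where
  open Lone L
  a≡ : a ≡ + d - + (3 ℕ.* suc t)
  a≡ = below-d a (+ d) (+ (3 ℕ.* suc t)) d-a≡
  b≡ : b ≡ + d - + (3 ℕ.* suc s)
  b≡ = below-d b (+ d) (+ (3 ℕ.* suc s)) d-b≡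

  bound : ∀ x m → + d - x ≡ + m → 0ℤ ≤ x + + d → m ℕ.≤ 2 ℕ.* d
  bound x m eq -d≤x = to-≤ {d = d} (subst (0ℤ ≤_) (≡-via (- + 1) eq (ring x (+ d) (+ m))) -d≤x)
    where
    ring : ∀ x d m → x + d - (+ 2 * d - m) ≡ - + 1 * (d - x - m)
    ring = solve-∀

  checked : ∀ t s → t ℕ.< s → 3 ℕ.* suc t ℕ.≤ 2 ℕ.* d → 3 ℕ.* suc s ℕ.≤ 2 ℕ.* d → T (loneTest d t s)
  checked t s t<s t≤ s≤ = modus-ponens {loneGuard d t s}
    (lones-checked (ℕ.s≤s d≤50) (index< d≤50 t≤) (index< d≤50 s≤))
    (Equivalence.from T-∧ (not-multiple {d} 3∤d , Equivalence.from T-∧ (ℕ.<⇒<ᵇ t<s , ℕ.≤⇒≤ᵇ s≤)))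

  t≤ : 3 ℕ.* suc t ℕ.≤ 2 ℕ.* d
  t≤ = bound a (3 ℕ.* suc t) d-a≡ -d≤a
  s≤ : 3 ℕ.* suc s ℕ.≤ 2 ℕ.* d
  s≤ = bound b (3 ℕ.* suc s) d-b≡ -d≤b

  order : Tri (t ℕ.< s) (t ≡ s) (s ℕ.< t) → Tricolourable (quad 0ℤ (+ d) a b)
  order (tri< t<s _ _) = loneTest⇒tricolourable t s a≡ b≡ L (checked t s t<s t≤ s≤)
  order (tri≈ _ refl _) = contradiction (trans a≡ (sym b≡)) a≢b
  order (tri> _ _ s<t) = tricolourable-swap (loneTest⇒tricolourable s t b≡ a≡ (lone-swap L) (checked s t s<t s≤ t≤))

residue₃-≡⇒3∣ : ∀ u v → residue₃ u ≡ residue₃ v → + 3 ∣ u - v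
residue₃-≡⇒3∣ u v eq = divides (u /ℕ 3 - v /ℕ 3) (begin
  u - v                                                      ≡⟨ cong₂ _-_ (residue₃-spec u) (residue₃-spec v) ⟩
  + toℕ (residue₃ u) + u /ℕ 3 * + 3 - (+ toℕ (residue₃ v) + v /ℕ 3 * + 3)
    ≡⟨ cong (λ r → + toℕ r + u /ℕ 3 * + 3 - (+ toℕ (residue₃ v) + v /ℕ 3 * + 3)) eq ⟩
  + toℕ (residue₃ v) + u /ℕ 3 * + 3 - (+ toℕ (residue₃ v) + v /ℕ 3 * + 3)
    ≡⟨ ring (+ toℕ (residue₃ v)) (u /ℕ 3) (v /ℕ 3) ⟩
  (u /ℕ 3 - v /ℕ 3) * + 3                                    ∎)
  where
  open ≡-Reasoning
  ring : ∀ r x y → r + x * + 3 - (r + y * + 3) ≡ (x - y) * + 3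
  ring = solve-∀

private
  three-distinct : ∀ (p q r c : Fin 3) → p ≡ q ⊎ q ≡ r ⊎ p ≡ r ⊎ p ≡ c ⊎ q ≡ c ⊎ r ≡ c
  three-distinct = from-yes (all? λ (p : Fin 3) → all? λ (q : Fin 3) → all? λ (r : Fin 3) → all? λ (c : Fin 3) →
    (p ≟ᶠ q) ⊎-dec (q ≟ᶠ r) ⊎-dec (p ≟ᶠ r) ⊎-dec (p ≟ᶠ c) ⊎-dec (q ≟ᶠ c) ⊎-dec (r ≟ᶠ c))

three-residues⇒tricolourable : ∀ (s : Quad) i j k → ¬ (+ 3 ∣ s i - s j) → ¬ (+ 3 ∣ s j - s k) → ¬ (+ 3 ∣ s i - s k) → Tricolourable s
three-residues⇒tricolourable s i j k ij jk ik = residue₃ , λ n c → find n c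
  (three-distinct (residue₃ (n + s i)) (residue₃ (n + s j)) (residue₃ (n + s k)) c)
  where
  difference : ∀ n u v → residue₃ (n + u) ≡ residue₃ (n + v) → + 3 ∣ u - v
  difference n u v eq = subst (+ 3 ∣_) (ring n u v) (residue₃-≡⇒3∣ (n + u) (n + v) eq)
    where
    ring : ∀ n u v → n + u - (n + v) ≡ u - v
    ring = solve-∀
  find : ∀ n c → let p = residue₃ (n + s i); q = residue₃ (n + s j); r = residue₃ (n + s k) in
    p ≡ q ⊎ q ≡ r ⊎ p ≡ r ⊎ p ≡ c ⊎ q ≡ c ⊎ r ≡ c → ∃[ m ] residue₃ (n + s m) ≡ c
  find n c (inj₁ eq) = contradiction (difference n (s i) (s j) eq) ij
  find n c (inj₂ (inj₁ eq)) = contradiction (difference n (s j) (s k) eq) jk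
  find n c (inj₂ (inj₂ (inj₁ eq))) = contradiction (difference n (s i) (s k) eq) ik
  find n c (inj₂ (inj₂ (inj₂ (inj₁ eq)))) = i , eq
  find n c (inj₂ (inj₂ (inj₂ (inj₂ (inj₁ eq))))) = j , eq
  find n c (inj₂ (inj₂ (inj₂ (inj₂ (inj₂ eq))))) = k , eq

split⇒tricolourable : ∀ {d a b} .{{_ : NonZero d}} → Split d a b → Tricolourable (quad 0ℤ (+ d) a b)
split⇒tricolourable {d} S with d ℕ.≤? 50
... | yes d≤50 = split-small d≤50 S
... | no d≰50 = split-large (ℕ.≰⇒> d≰50) S

lone⇒tricolourable : ∀ {d a b} .{{_ : NonZero d}} → Lone d a b → Tricolourable (quad 0ℤ (+ d) a b)
lone⇒tricolourable {d} L with d ℕ.≤? 50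
... | yes d≤50 = lone-small d≤50 L
... | no d≰50 = lone-large (ℕ.≰⇒> d≰50) L

module _ (d : ℕ) .{{_ : NonZero d}} (a b : ℤ) (3∤d : ¬ (+ 3 ∣ + d))
  (widest : ∀ p q → ¬ (+ 3 ∣ quad 0ℤ (+ d) a b q - quad 0ℤ (+ d) a b p) → 0ℤ ≤ + d - (quad 0ℤ (+ d) a b q - quad 0ℤ (+ d) a b p))
  (a≢0 : a ≢ 0ℤ) (b≢0 : b ≢ 0ℤ) (a≢d : a ≢ + d) (b≢d : b ≢ + d) (a≢b : a ≢ b) (coprime : Coprime₃ a b (+ d))
  where

  private
    transfer : ∀ {x y z} → + 3 ∣ x → + 3 ∣ y → x + y ≡ z → + 3 ∣ z
    transfer 3∣x 3∣y eq = subst (+ 3 ∣_) eq (∣m∣n⇒∣m+n 3∣x 3∣y)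

    transfer- : ∀ {x y z} → + 3 ∣ x → + 3 ∣ y → x - y ≡ z → + 3 ∣ z
    transfer- 3∣x 3∣y eq = subst (+ 3 ∣_) eq (∣m∣n⇒∣m-n 3∣x 3∣y)

    ≥0 : ∀ {x y} → x ≡ y → 0ℤ ≤ x → 0ℤ ≤ y
    ≥0 = subst (0ℤ ≤_)

    upper : ∀ a d → d - (a - d) ≡ + 2 * d - a
    upper = solve-∀
    lower : ∀ a d → d - (d - a) ≡ a
    lower = solve-∀
    upper₀ : ∀ b d → d - (b - 0ℤ) ≡ d - b
    upper₀ = solve-∀
    lower₀ : ∀ b d → d - (0ℤ - b) ≡ b + d
    lower₀ = solve-∀
    c₁ : ∀ a d → a - (a - d) ≡ d
    c₁ = solve-∀
    c₂ : ∀ a d → a + (d - a) ≡ d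
    c₂ = solve-∀
    c₃ : ∀ b d → (b - 0ℤ) - (b - d) ≡ d
    c₃ = solve-∀
    c₄ : ∀ b d → - (0ℤ - b) - (b - d) ≡ d
    c₄ = solve-∀

    in-class-0 : ∀ p → + 3 ∣ quad 0ℤ (+ d) a b p → 0ℤ ≤ quad 0ℤ (+ d) a b p × 0ℤ ≤ + 2 * + d - quad 0ℤ (+ d) a b p
    in-class-0 p 3∣x =
      ≥0 (lower x (+ d)) (widest p 1F λ 3∣ → 3∤d (transfer 3∣x 3∣ (c₂ x (+ d)))) ,
      ≥0 (upper x (+ d)) (widest 1F p λ 3∣ → 3∤d (transfer- 3∣x 3∣ (c₁ x (+ d))))
      where x = quad 0ℤ (+ d) a b p

    in-class-d : ∀ p → + 3 ∣ quad 0ℤ (+ d) a b p - + d → 0ℤ ≤ quad 0ℤ (+ d) a b p + + d × 0ℤ ≤ + d - quad 0ℤ (+ d) a b p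
    in-class-d p 3∣x-d =
      ≥0 (lower₀ x (+ d)) (widest p 0F λ 3∣ → 3∤d (transfer- (∣m⇒∣-m 3∣) 3∣x-d (c₄ x (+ d)))) ,
      ≥0 (upper₀ x (+ d)) (widest 0F p λ 3∣ → 3∤d (transfer- 3∣ 3∣x-d (c₃ x (+ d))))
      where x = quad 0ℤ (+ d) a b p

    both-d : + 3 ∣ a - + d → + 3 ∣ b - + d → Lone d a b
    both-d 3∣a-d 3∣b-d = record
      { 3∤d = 3∤d ; 3∣a-d = 3∣a-d ; 3∣b-d = 3∣b-d
      ; -d≤a = proj₁ (in-class-d 2F 3∣a-d) ; a≤d = proj₂ (in-class-d 2F 3∣a-d)
      ; -d≤b = proj₁ (in-class-d 3F 3∣b-d) ; b≤d = proj₂ (in-class-d 3F 3∣b-d)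
      ; a≢d = a≢d ; b≢d = b≢d ; a≢b = a≢b ; coprime = coprime }

    both-0 : + 3 ∣ a → + 3 ∣ b → Lone d (+ d - b) (+ d - a)
    both-0 3∣a 3∣b = record
      { 3∤d = 3∤d
      ; 3∣a-d = subst (+ 3 ∣_) (r₁ b (+ d)) (∣m⇒∣-m 3∣b) ; 3∣b-d = subst (+ 3 ∣_) (r₁ a (+ d)) (∣m⇒∣-m 3∣a)
      ; -d≤a = ≥0 (r₂ b (+ d)) (proj₂ (in-class-0 3F 3∣b)) ; a≤d = ≥0 (r₃ b (+ d)) (proj₁ (in-class-0 3F 3∣b))
      ; -d≤b = ≥0 (r₂ a (+ d)) (proj₂ (in-class-0 2F 3∣a)) ; b≤d = ≥0 (r₃ a (+ d)) (proj₁ (in-class-0 2F 3∣a))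
      ; a≢d = λ eq → b≢0 (≡-via (- + 1) eq (r₄ b (+ d)))
      ; b≢d = λ eq → a≢0 (≡-via (- + 1) eq (r₄ a (+ d)))
      ; a≢b = λ eq → a≢b (≡-via (+ 1) eq (r₅ a b (+ d)))
      ; coprime = let open Coprime₃ coprime in coprime₃ (- v) (- u) (u + v + w) (trans (r₆ a b (+ d) u v w) bezout) }
      where
      r₁ : ∀ b d → - b ≡ d - b - d
      r₁ = solve-∀
      r₂ : ∀ b d → + 2 * d - b ≡ d - b + d
      r₂ = solve-∀
      r₃ : ∀ b d → b ≡ d - (d - b)
      r₃ = solve-∀
      r₄ : ∀ b d → b - 0ℤ ≡ - + 1 * (d - b - d)
      r₄ = solve-∀
      r₅ : ∀ a b d → a - b ≡ + 1 * (d - b - (d - a))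
      r₅ = solve-∀
      r₆ : ∀ a b d u v w → - v * (d - b) + - u * (d - a) + (u + v + w) * d ≡ u * a + v * b + w * d
      r₆ = solve-∀

    mixed : + 3 ∣ a → + 3 ∣ b - + d → Split d a b
    mixed 3∣a 3∣b-d = record
      { 3∤d = 3∤d ; 3∣a = 3∣a ; 3∣b-d = 3∣b-d
      ; 0≤a = proj₁ (in-class-0 2F 3∣a) ; a≤2d = proj₂ (in-class-0 2F 3∣a)
      ; -d≤b = proj₁ (in-class-d 3F 3∣b-d) ; b≤d = proj₂ (in-class-d 3F 3∣b-d)
      ; b-a≤d = widest 2F 3F λ 3∣b-a → 3∤d (transfer- (∣m∣n⇒∣m+n 3∣b-a 3∣a) 3∣b-d (r₁ a b (+ d)))
      ; a-b≤d = widest 3F 2F λ 3∣a-b → 3∤d (transfer- (∣m∣n⇒∣m-n 3∣a 3∣a-b) 3∣b-d (r₂ a b (+ d)))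
      ; a≢0 = a≢0 ; b≢d = b≢d ; coprime = coprime }
      where
      r₁ : ∀ a b d → b - a + a - (b - d) ≡ d
      r₁ = solve-∀
      r₂ : ∀ a b d → a - (a - b) - (b - d) ≡ d
      r₂ = solve-∀

    mixed-swap : + 3 ∣ a - + d → + 3 ∣ b → Split d b a
    mixed-swap 3∣a-d 3∣b = record
      { 3∤d = 3∤d ; 3∣a = 3∣b ; 3∣b-d = 3∣a-d
      ; 0≤a = proj₁ (in-class-0 3F 3∣b) ; a≤2d = proj₂ (in-class-0 3F 3∣b)
      ; -d≤b = proj₁ (in-class-d 2F 3∣a-d) ; b≤d = proj₂ (in-class-d 2F 3∣a-d)
      ; b-a≤d = widest 3F 2F λ 3∣a-b → 3∤d (transfer- (∣m∣n⇒∣m+n 3∣a-b 3∣b) 3∣a-d (r₁ b a (+ d)))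
      ; a-b≤d = widest 2F 3F λ 3∣b-a → 3∤d (transfer- (∣m∣n⇒∣m-n 3∣b 3∣b-a) 3∣a-d (r₂ b a (+ d)))
      ; a≢0 = b≢0 ; b≢d = a≢d
      ; coprime = let open Coprime₃ coprime in coprime₃ v u w (trans (cong (_+ w * + d) (ℤ.+-comm (v * b) (u * a))) bezout) }
      where
      r₁ : ∀ a b d → b - a + a - (b - d) ≡ d
      r₁ = solve-∀
      r₂ : ∀ a b d → a - (a - b) - (b - d) ≡ d
      r₂ = solve-∀

  widest-pair⇒tricolourable : Tricolourable (quad 0ℤ (+ d) a b)
  widest-pair⇒tricolourable with + 3 ∣? a | + 3 ∣? a - + d | + 3 ∣? b | + 3 ∣? b - + d
  ... | no 3∤a | no 3∤a-d | _ | _ = three-residues⇒tricolourable (quad 0ℤ (+ d) a b) 2F 1F 0F 3∤a-d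
    (λ 3∣d → 3∤d (subst (+ 3 ∣_) (ℤ.+-identityʳ (+ d)) 3∣d)) (λ 3∣a → 3∤a (subst (+ 3 ∣_) (ℤ.+-identityʳ a) 3∣a))
  ... | _ | _ | no 3∤b | no 3∤b-d = three-residues⇒tricolourable (quad 0ℤ (+ d) a b) 3F 1F 0F 3∤b-d
    (λ 3∣d → 3∤d (subst (+ 3 ∣_) (ℤ.+-identityʳ (+ d)) 3∣d)) (λ 3∣b → 3∤b (subst (+ 3 ∣_) (ℤ.+-identityʳ b) 3∣b))
  ... | yes 3∣a | _ | yes 3∣b | _ = tricolourable-reflect (lone⇒tricolourable (both-0 3∣a 3∣b))
  ... | yes 3∣a | _ | no _ | yes 3∣b-d = split⇒tricolourable (mixed 3∣a 3∣b-d)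
  ... | no _ | yes 3∣a-d | yes 3∣b | _ = tricolourable-swap (split⇒tricolourable (mixed-swap 3∣a-d 3∣b))
  ... | no _ | yes 3∣a-d | no _ | yes 3∣b-d = lone⇒tricolourable (both-d 3∣a-d 3∣b-d)

maximum : ∀ n (w : Fin (suc n) → ℤ) → ∃[ i ] (∀ j → w j ≤ w i)
maximum zero w = 0F , λ { 0F → ℤ.≤-refl }
maximum (suc n) w with maximum n (λ i → w (Fin.suc i))
... | i , w≤ with ℤ.≤-total (w 0F) (w (Fin.suc i))
... | inj₁ w₀≤ = Fin.suc i , λ { 0F → w₀≤ ; (Fin.suc j) → w≤ j }
... | inj₂ ≤w₀ = 0F , λ { 0F → ℤ.≤-refl ; (Fin.suc j) → ℤ.≤-trans (w≤ j) ≤w₀ }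

-- Zero for pairs in the same class mod 3, so that a maximal weight is the largest difference across classes.
weight : ℤ → ℤ
weight x with + 3 ∣? x
... | yes _ = 0ℤ
... | no _ = x

weight-cross : ∀ {x} → ¬ (+ 3 ∣ x) → weight x ≡ x
weight-cross {x} 3∤x with + 3 ∣? x
... | yes 3∣x = contradiction 3∣x 3∤x
... | no _ = refl

weight-same : ∀ {x} → + 3 ∣ x → weight x ≡ 0ℤ
weight-same {x} 3∣x with + 3 ∣? x
... | yes _ = refl
... | no 3∤x = contradiction 3∣x 3∤x

record Primitive (s : Quad) : Set where
  field
    injective : ∀ {i j} → s i ≡ s j → i ≡ j
    common-divisor : ∀ t → (∀ i j → t ∣ s i - s j) → t ∣ + 1

record WidestPair (s : Quad) : Set where
  field
    i j : Fin 4
    d : ℕ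
    d≡ : s j - s i ≡ + d
    3∤d : ¬ (+ 3 ∣ + d)
    widest : ∀ k l → ¬ (+ 3 ∣ s l - s k) → 0ℤ ≤ + d - (s l - s k)

3∤1 : ¬ (+ 3 ∣ + 1)
3∤1 (divides q eq) = 1≢3* q eq

maximum₂ : ∀ n (w : Fin (suc n) → Fin (suc n) → ℤ) → ∃[ i ] ∃[ j ] (∀ k l → w k l ≤ w i j)
maximum₂ n w with maximum n (λ i → w i (proj₁ (maximum n (w i))))
... | i , w≤ = i , proj₁ (maximum n (w i)) , λ k l → ℤ.≤-trans (proj₂ (maximum n (w k)) l) (w≤ k)

maximal⇒widestPair : ∀ s → Primitive s → ∀ i j → (∀ k l → weight (s l - s k) ≤ weight (s j - s i)) → WidestPair s
maximal⇒widestPair s S i j w≤ = pair (toNat 0≤D)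
  where
  open Primitive S

  w : Fin 4 → Fin 4 → ℤ
  w i j = weight (s j - s i)

  flip : ∀ x y → - (x - y) ≡ y - x
  flip = solve-∀

  cross≤ : ∀ k l → ¬ (+ 3 ∣ s l - s k) → s l - s k ≤ w i j
  cross≤ k l 3∤ = subst (_≤ w i j) (weight-cross 3∤) (w≤ k l)

  3∤D : ¬ (+ 3 ∣ s j - s i)
  3∤D 3∣D = 3∤1 (common-divisor (+ 3) λ k l → all-same k l (+ 3 ∣? s k - s l))
    where
    all-same : ∀ k l → Dec (+ 3 ∣ s k - s l) → + 3 ∣ s k - s l
    all-same k l (yes 3∣) = 3∣
    all-same k l (no 3∤) = contradiction (subst (+ 3 ∣_) (sym zero-difference) (divides 0ℤ refl)) 3∤
      where
      below : ∀ k l → ¬ (+ 3 ∣ s l - s k) → s l - s k ≤ 0ℤ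
      below k l 3∤ = subst (s l - s k ≤_) (weight-same 3∣D) (cross≤ k l 3∤)
      zero-difference : s k - s l ≡ 0ℤ
      zero-difference = ℤ.≤-antisym (below l k 3∤) (subst (0ℤ ≤_) (flip (s l) (s k))
        (ℤ.neg-mono-≤ (below k l λ 3∣ → 3∤ (subst (+ 3 ∣_) (flip (s l) (s k)) (∣m⇒∣-m 3∣)))))

  wᵢⱼ : w i j ≡ s j - s i
  wᵢⱼ = weight-cross 3∤D

  0≤D : 0ℤ ≤ s j - s i
  0≤D = nonneg-cancel 2 (subst (0ℤ ≤_) (double (s i) (s j))
    (nonneg (subst (s i - s j ≤_) wᵢⱼ (cross≤ j i λ 3∣ → 3∤D (subst (+ 3 ∣_) (flip (s i) (s j)) (∣m⇒∣-m 3∣))))))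
    where
    double : ∀ x y → y - x - (x - y) ≡ + 2 * (y - x)
    double = solve-∀

  pair : ∃[ d ] s j - s i ≡ + d → WidestPair s
  pair (d , d≡) = record
    { i = i ; j = j ; d = d ; d≡ = d≡
    ; 3∤d = subst (λ D → ¬ (+ 3 ∣ D)) d≡ 3∤D
    ; widest = λ k l 3∤ → nonneg (subst (s l - s k ≤_) (trans wᵢⱼ d≡) (cross≤ k l 3∤)) }

widestPair : ∀ s → Primitive s → WidestPair s
widestPair s S = let i , j , w≤ = maximum₂ 3 (λ i j → weight (s j - s i)) in maximal⇒widestPair s S i j w≤

private
  Others : Fin 4 → Fin 4 → Fin 4 → Fin 4 → Set
  Others i j k l = k ≢ i × k ≢ j × l ≢ i × l ≢ j × k ≢ l × (∀ m → m ≡ i ⊎ m ≡ j ⊎ m ≡ k ⊎ m ≡ l)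

  others : ∀ i j → i ≡ j ⊎ (∃[ k ] ∃[ l ] Others i j k l)
  others = from-yes (all? λ (i : Fin 4) → all? λ (j : Fin 4) → (i ≟ᶠ j) ⊎-dec any? λ k → any? λ l →
    ¬? (k ≟ᶠ i) ×-dec ¬? (k ≟ᶠ j) ×-dec ¬? (l ≟ᶠ i) ×-dec ¬? (l ≟ᶠ j) ×-dec ¬? (k ≟ᶠ l) ×-dec
    all? λ m → (m ≟ᶠ i) ⊎-dec (m ≟ᶠ j) ⊎-dec (m ≟ᶠ k) ⊎-dec (m ≟ᶠ l))

widestPair⇒tricolourable : ∀ s → Primitive s → WidestPair s → Tricolourable s
widestPair⇒tricolourable s S record { i = i ; j = j ; d = d ; d≡ = d≡ ; 3∤d = 3∤d ; widest = widest } = go (others i j)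
  where
  open Primitive S

  d≢0 : d ≢ 0
  d≢0 d≡0 = 3∤d (subst (λ d → + 3 ∣ + d) (sym d≡0) (divides 0ℤ refl))

  instance
    d-nonzero : NonZero d
    d-nonzero = ℕ.≢-nonZero d≢0

  go : i ≡ j ⊎ (∃[ k ] ∃[ l ] Others i j k l) → Tricolourable s
  go (inj₁ refl) = contradiction (ℤ.+-injective (trans (sym d≡) (ℤ.+-inverseʳ (s i)))) d≢0
  go (inj₂ (k , l , k≢i , k≢j , l≢i , l≢j , k≢l , cover)) =
    tricolourable-pull {s} {quad 0ℤ (+ d) a b} (+ 1) (- s i) σ (λ m → trans (at m) (ring₁ (s (σ m)) (s i)))
      (widest-pair⇒tricolourable d a b 3∤d widest′
        (λ eq → k≢i (injective (≡-by eq)))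
        (λ eq → l≢i (injective (≡-by eq)))
        (λ eq → k≢j (injective (cancel (trans eq (sym d≡)))))
        (λ eq → l≢j (injective (cancel (trans eq (sym d≡)))))
        (λ eq → k≢l (injective (cancel eq)))
        (coprime (gcd₃ a b (+ d))))
    where
    a b : ℤ
    a = s k - s i
    b = s l - s i
    σ : Fin 4 → Fin 4
    σ 0F = i
    σ 1F = j
    σ 2F = k
    σ 3F = l
    at : ∀ m → quad 0ℤ (+ d) a b m ≡ s (σ m) - s i
    at 0F = sym (ℤ.+-inverseʳ (s i))
    at 1F = sym d≡
    at 2F = refl
    at 3F = refl
    ring₁ : ∀ x y → x - y ≡ + 1 * x + - y
    ring₁ = solve-∀
    ring₂ : ∀ x y z → x - z - (y - z) ≡ x - y
    ring₂ = solve-∀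
    cancel : ∀ {x y z} → x - z ≡ y - z → x ≡ y
    cancel {x} {y} {z} eq = ≡-via (+ 1) eq (ring x y z)
      where
      ring : ∀ x y z → x - y ≡ + 1 * (x - z - (y - z))
      ring = solve-∀
    difference : ∀ p q → quad 0ℤ (+ d) a b q - quad 0ℤ (+ d) a b p ≡ s (σ q) - s (σ p)
    difference p q = trans (cong₂ _-_ (at q) (at p)) (ring₂ (s (σ q)) (s (σ p)) (s i))
    widest′ : ∀ p q → ¬ (+ 3 ∣ quad 0ℤ (+ d) a b q - quad 0ℤ (+ d) a b p) → 0ℤ ≤ + d - (quad 0ℤ (+ d) a b q - quad 0ℤ (+ d) a b p)
    widest′ p q 3∤ = subst (λ x → 0ℤ ≤ + d - x) (sym (difference p q))
      (widest (σ p) (σ q) (subst (λ x → ¬ (+ 3 ∣ x)) (difference p q) 3∤))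
    coprime : Gcd₃ a b (+ d) → Coprime₃ a b (+ d)
    coprime G = coprime₃ u v w (trans bezout (cong (+_) g≡1))
      where
      open Gcd₃ G
      g∣ : ∀ m → + g ∣ s m - s i
      g∣ m with cover m
      ... | inj₁ refl = subst (+ g ∣_) (sym (ℤ.+-inverseʳ (s i))) (divides 0ℤ refl)
      ... | inj₂ (inj₁ refl) = divides z′ (trans d≡ z≡)
      ... | inj₂ (inj₂ (inj₁ refl)) = divides x′ x≡
      ... | inj₂ (inj₂ (inj₂ refl)) = divides y′ y≡
      g≡1 : g ≡ 1
      g≡1 = ℕ.∣1⇒≡1 (∣⇒∣ᵤ (common-divisor (+ g) λ p q → subst (+ g ∣_) (ring₂ (s p) (s q) (s i)) (∣m∣n⇒∣m-n (g∣ p) (g∣ q))))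

gcd⇒tricolourable : ∀ (f : Quad) → (∀ {i j} → f i ≡ f j → i ≡ j) → Gcd₃ (f 1F - f 0F) (f 2F - f 0F) (f 3F - f 0F) → Tricolourable f
gcd⇒tricolourable f injective G = tricolourable-pull {f} {λ i → s i * + g} (+ 1) (- f 0F) (λ i → i) (λ i → trans (sym (at i)) (ring (f i) (f 0F)))
  (tricolourable-scale g (coloured record
    { injective = λ {i} {j} eq → injective (cancel (f i) (f j) (trans (at i) (trans (cong (_* + g) eq) (sym (at j)))))
    ; common-divisor = λ t t∣ → subst (t ∣_) (Coprime₃.bezout coprime′)
        (∣m∣n⇒∣m+n (∣m∣n⇒∣m+n (∣n⇒∣m*n u (from-0 (t∣ 1F 0F))) (∣n⇒∣m*n v (from-0 (t∣ 2F 0F)))) (∣n⇒∣m*n w (from-0 (t∣ 3F 0F)))) }))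
  where
  open Gcd₃ G

  s : Quad
  s = quad 0ℤ x′ y′ z′

  coloured : Primitive s → Tricolourable s
  coloured S = widestPair⇒tricolourable s S (widestPair s S)

  at : ∀ i → f i - f 0F ≡ s i * + g
  at 0F = ℤ.+-inverseʳ (f 0F)
  at 1F = x≡
  at 2F = y≡
  at 3F = z≡

  g≢0 : g ≢ 0
  g≢0 g≡0 with injective (≡-by {f 1F} {f 0F} (trans x≡ (trans (cong (λ g → x′ * + g) g≡0) (ℤ.*-zeroʳ x′))))
  ... | ()

  instance
    g-nonzero : NonZero g
    g-nonzero = ℕ.≢-nonZero g≢0

  coprime′ : Coprime₃ x′ y′ z′
  coprime′ = coprime-quotients

  from-0 : ∀ {t x} → t ∣ x - 0ℤ → t ∣ x
  from-0 {t} {x} = subst (t ∣_) (ℤ.+-identityʳ x)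

  cancel : ∀ x y {z} → x - z ≡ y - z → x ≡ y
  cancel x y {z} eq = ≡-via (+ 1) eq (ring′ x y z)
    where
    ring′ : ∀ x y z → x - y ≡ + 1 * (x - z - (y - z))
    ring′ = solve-∀

  ring : ∀ x y → x - y ≡ + 1 * x + - y
  ring = solve-∀

injective⇒tricolourable : ∀ (f : Quad) → (∀ {i j} → f i ≡ f j → i ≡ j) → Tricolourable f
injective⇒tricolourable f injective = gcd⇒tricolourable f injective (gcd₃ (f 1F - f 0F) (f 2F - f 0F) (f 3F - f 0F))

theorem1 : ∀ {s} (S : Pred ℤ s) → HasCardinality +-0-abelianGroup S 4 →
    HasPolychromaticColouring +-0-abelianGroup S 3 ×
    (∀ (p : ℕ) → IsPolychromaticNumber +-0-abelianGroup S p → p ≥ 3)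
theorem1 S (f , injective , member) = coloured , λ p (_ , largest) → largest 3 coloured
  where
  polychromatic : Tricolourable f → HasPolychromaticColouring +-0-abelianGroup S 3
  polychromatic (χ , rainbow) = χ , cong χ , λ n c →
    let i , χ≡c = rainbow n c in
    n + f i , (f i , Equivalence.from (member (f i)) (i , refl) , refl) , χ≡c

  coloured : HasPolychromaticColouring +-0-abelianGroup S 3
  coloured = polychromatic (injective⇒tricolourable f injective)
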